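{- The almost-sure repeated reachability problem is decidable for 1-VASS-MDPs.
   Context: A VASS-MDP of dimension $d\ge 0$ is a tuple $S=\langle Q,Q_1,Q_P,T,\tau\rangle$ where $Q$ is a finite set of control states partitioned into $Q_1$ (Player 1) and $Q_P$ (probabilistic), $T\subseteq Q\times\mathbb{Z}^d\times Q$ is finite, and $\tau:T\to\mathbb{N}_{>0}$. Configurations are $\langle q,\mathbf{v}\rangle\in Q\times\mathbb{N}^d$; $t=\langle q,\mathbf{z},q'\rangle$ is enabled in $\langle q,\mathbf{v}\rangle$ if $\mathbf{v}+\mathbf{z}\in\mathbb{N}^d$ and leads to $\langle q',\mathbf{v}+\mathbf{z}\rangle$. The induced MDP $M_S=\langle C,C_1,C_P,\rightarrow,p\rangle$ has $C=Q\times\mathbb{N}^d$, $C_1=Q_1\times\mathbb{N}^d$, $C_P=Q_P\times\mathbb{N}^d$, $c\rightarrow c'$ iff $c'$ is obtained from $c$ by an enabled transition, and for $c\in C_P$, $p(c)(c')$ is the total weight of enabled transitions from $c$ leading to $c'$ divided by the total weight of transitions enabled in $c$. A 1-VASS-MDP is a VASS-MDP in which every transition $\langle q,\mathbf{z},q'\rangle$ with $q\in Q_P$ has $\mathbf{z}=\mathbf{0}$. A strategy $\sigma$ of Player 1 maps each finite play ending in a non-deadlock configuration $c\in C_1$ to a successor of $c$; an initial configuration $c$ and $\sigma$ induce a probability measure $\mathbb{P}(M_S,c,\sigma,\cdot)$ on maximal plays. $[\![\Box\Diamond q_F]\!]$ is the set of infinite plays visiting control state $q_F$ infinitely often. The almost-sure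 repeated reachability problem asks, given $S$, an initial configuration $c_0$ and $q_F\in Q$, whether there is $\sigma$ with $\mathbb{P}(M_S,c_0,\sigma,[\![\Box\Diamond q_F]\!])=1$. -}

module Defs where

open import Data.Nat as ℕ using (ℕ; zero; suc; _∸_; NonZero)
open import Data.Integer as ℤ using (ℤ; +_; -[1+_])
open import Data.Rational.Unnormalised.Base as Q using (ℚᵘ; mkℚᵘ; 0ℚᵘ; 1ℚᵘ)
open import Data.Fin as Fin using (Fin)
open import Data.Vec as Vec using (Vec; []; _∷_)
open import Data.List as List using (List; []; _∷_; mapMaybe; _++_; [_])
open import Data.List.Relation.Unary.All using (All)
open import Data.List.Relation.Unary.Unique.Propositional using (Unique)
open import Data.List.Membership.Propositional using (_∈_)
open import Data.Nat.ListAction using () renaming (sum to sumℕ)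
open import Data.Maybe using (Maybe; just; nothing)
open import Data.Bool using (Bool; true; false; if_then_else_)
open import Data.Product using (Σ; ∃; _×_; _,_; proj₁; proj₂)
open import Relation.Nullary using (Dec; yes; no; ¬_; ⌊_⌋)
open import Relation.Binary.PropositionalEquality using (_≡_; refl)

-- A VASS-MDP of dimension d.  Control states are Fin nQ; isProb q = true
-- means q ∈ Q_P, isProb q = false means q ∈ Q_1.  The finite transition set
-- T is a duplicate-free list of triples ⟨q, z, q'⟩; τ gives positive weights.
Trans : ℕ → ℕ → Set
Trans nQ d = Fin nQ × Vec ℤ d × Fin nQ

record VASSMDP (d : ℕ) : Set where
  field
    nQ       : ℕ
    isProb   : Fin nQ → Bool
    T        : List (Trans nQ d)
    T-unique : Unique T
    τ        : Trans nQ d → ℕ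
    τ-pos    : All (λ t → NonZero (τ t)) T

addV : ∀ {d} → Vec ℕ d → Vec ℤ d → Maybe (Vec ℕ d)
addV [] [] = just []
addV (x ∷ xs) (z ∷ zs) with (+ x) ℤ.+ z | addV xs zs
... | + k    | just r = just (k ∷ r)
... | _      | _      = nothing

IsOneVASS : ∀ {d} → VASSMDP d → Set
IsOneVASS {d} S = All (λ t → isProb (proj₁ t) ≡ true → proj₁ (proj₂ t) ≡ Vec.replicate d (+ 0)) T
  where open VASSMDP S

isEmpty? : {A : Set} (xs : List A) → Dec (xs ≡ [])
isEmpty? []      = yes refl
isEmpty? (_ ∷ _) = no λ ()

sumℚ : List ℚᵘ → ℚᵘ
sumℚ = List.foldr Q._+_ 0ℚᵘ

module _ {d : ℕ} (S : VASSMDP d) where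
  open VASSMDP S

  Config : Set
  Config = Fin nQ × Vec ℕ d

  fire : Config → Trans nQ d → Maybe (Config × ℕ)
  fire (q , v) (q₁ , z , q₂) with q Fin.≟ q₁
  ... | no _ = nothing
  ... | yes _ with addV v z
  ...   | nothing = nothing
  ...   | just v' = just ((q₂ , v') , τ (q₁ , z , q₂))

  enabledW : Config → List (Config × ℕ)
  enabledW c = mapMaybe (fire c) T

  successors : Config → List Config
  successors c = List.map proj₁ (enabledW c)

  Step : Config → Config → Set
  Step c c' = c' ∈ successors c

  -- A Player-1 strategy: given the finite play  h ++ [ c ]  ending in a
  -- non-deadlock Player-1 configuration c, choose a successor of c.
  Strategy : Set
  Strategy = (h : List Config) (c : Config) → isProb (proj₁ c) ≡ false →
             ¬ (successors c ≡ []) → Σ Config (Step c)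

  dec : Fin nQ → Config → ℕ → ℕ
  dec qF c m = if ⌊ proj₁ c Fin.≟ qF ⌋ then m ∸ 1 else m

  -- aux σ qF m k h c: probability, from the current play h ++ [ c ], that the
  -- next at most k steps contain at least m further visits to q_F
  -- (m already accounts for c).  p(c)(c') = w / W is written mkℚᵘ w (W ∸ 1),
  -- where W ≥ 1 is the total enabled weight.
  aux : Strategy → Fin nQ → ℕ → ℕ → List Config → Config → ℚᵘ
  aux σ qF zero    _       h c = 1ℚᵘ
  aux σ qF (suc m) zero    h c = 0ℚᵘ
  aux σ qF (suc m) (suc k) h c with isEmpty? (successors c) | isProb (proj₁ c) in pq
  ... | yes _  | _     = 0ℚᵘ
  ... | no ne  | false =
        let c' = proj₁ (σ h c pq ne) in aux σ qF (dec qF c' (suc m)) k (h ++ [ c ]) c'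
  ... | no _   | true  =
        sumℚ (List.map (λ { (c' , w) → mkℚᵘ (+ w) (W ∸ 1) Q.* aux σ qF (dec qF c' (suc m)) k (h ++ [ c ]) c' })
                       (enabledW c))
    where W = sumℕ (List.map proj₂ (enabledW c))

  probWithin : Strategy → Config → Fin nQ → ℕ → ℕ → ℚᵘ
  probWithin σ c₀ qF m k = aux σ qF (dec qF c₀ m) k [] c₀

  -- P(M_S, c₀, σ, [[□◇ q_F]]) = 1, unfolded via continuity of measure:
  -- □◇q_F = ⋂_m (≥ m visits) = ⋂_m ⋃_k (≥ m visits within k steps),
  -- so the probability is 1 iff for all m and all ε = 1/(j+1) some k has
  -- probability ≥ 1 - ε.
  AlmostSureRepReach : Config → Fin nQ → Strategy → Set
  AlmostSureRepReach c₀ qF σ =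
    (m j : ℕ) → ∃ λ k → 1ℚᵘ Q.≤ (probWithin σ c₀ qF m k Q.+ mkℚᵘ (+ 1) j)

{-# OPTIONS --safe #-}
-- A 1-VASS-MDP is read as a game of the player against an environment: at a
-- probabilistic state the environment either lets the player choose the outcome
-- or fixes it, and fixing counts as a visit to q_F.  A set X from which the
-- player can always force another visit while staying in X yields an almost-sure
-- strategy: X may be taken upward closed with a finite basis (Dickson), so visits
-- occur within a bounded number of steps with probability bounded below.
-- Conversely the configurations with an almost surely winning continuation form
-- such a set, because a path of positive probability reaches q_F.
--
-- The resulting Büchi game with counters is decided in two stages.  With unknown
-- initial credit, a state with several options is split: winning plays against
-- either part are interleaved, and their credits add up.  This leaves a graph,
-- which is winning iff it has a reachable accepting cycle of effect ≥ 0; the cycle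
-- effects form a semilinear set, whose non-negative part is found by the double
-- description method.  If the counters in I are known, induct on |I|: once one of
-- them exceeds a bound obtained from the smaller sets it can be forgotten, and
-- below that bound the counters in I are part of the finite control.
module Submission where

-- Nothing is argued about infinite plays. The winning region is a greatest fixed point of an
-- inductive attractor, and "some good set contains the configuration" would quantify over
-- predicates and leave `Set`. The finite basis avoids this, and it makes membership decidable, so
-- that the strategy of Player 1 can be computed from it.
--
-- Why fixing an outcome may count as a visit: randomness has to be survived, so every outcome must
-- stay winning, but progress is only demanded along one favourable branch. One round of the game is
-- therefore a path of positive probability to q_F, all of whose siblings remain in the winning set.
-- A fixed outcome has to be enabled in the MDP, and it is, because probabilistic transitions leave
-- the counters unchanged.
--
-- The elimination of inequalities describes integer cones only up to a positive factor. This
-- suffices because the cycles through a fixed accepting edge can be repeated: their effects are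
-- closed under addition, so a multiple of an effect is again an effect.

open import Defs
open import Data.Nat using (ℕ)
open import Data.Fin using (Fin)
open import Data.Product using (∃; _,_)
open import Data.Vec using (lookup)
open import Relation.Nullary using (Dec)
open import Relation.Nullary.Decidable using (map′)

-- Almost-full relations and Dickson's lemma

module AlmostFull where

  open import Data.Nat using (ℕ; zero; suc; _≤_; _<_; z≤n; s≤s)
  import Data.Nat.Properties as ℕ
  open import Data.Fin using (Fin; zero; suc; toℕ; opposite)
  import Data.Fin.Properties as Fin
  open import Data.List using (List; []; _∷_)
  open import Data.List.Relation.Unary.Any using (Any; here; there)
  open import Data.Product using (_×_; _,_; proj₁; proj₂)
  open import Data.Sum using (_⊎_; inj₁; inj₂; [_,_]′)
  open import Data.Empty using (⊥-elim)
  open import Function using (_on_; _∘_)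
  open import Relation.Nullary using (¬_; yes; no)
  open import Relation.Binary.PropositionalEquality using (_≡_; sym; subst₂)

  -- Inductive almost-full relations (Vytiniotis, Coquand, Wahlstedt).
  data AF {X : Set} (R : X → X → Set) : Set where
    now   : (∀ x y → R x y) → AF R
    later : (∀ x → AF (λ y z → R y z ⊎ R x y)) → AF R

  private variable
    X Y : Set

  af-mono : {R S : X → X → Set} → (∀ x y → R x y → S x y) → AF R → AF S
  af-mono i (now f)   = now λ x y → i x y (f x y)
  af-mono i (later f) = later λ x → af-mono
    (λ { y z (inj₁ r) → inj₁ (i y z r) ; y z (inj₂ r) → inj₂ (i x y r) }) (f x)

  af-on : {R : X → X → Set} (f : Y → X) → AF R → AF (R on f)
  af-on f (now g)   = now λ x y → g (f x) (f y)
  af-on f (later g) = later λ x → af-on f (g (f x))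

  both : {R A B : Set} → R ⊎ A → R ⊎ B → R ⊎ (A × B)
  both (inj₁ r) _        = inj₁ r
  both (inj₂ a) (inj₁ r) = inj₁ r
  both (inj₂ a) (inj₂ b) = inj₂ (a , b)

  -- Intersection of almost-full relations, first for nullary, then for unary
  -- parts: the simultaneous induction for one arity ends in the previous one.
  af-∩₀ : {R P Q : X → X → Set} {A B : Set} →
          (∀ x y → P x y → R x y ⊎ A) → (∀ x y → Q x y → R x y ⊎ B) →
          AF P → AF Q → AF (λ x y → R x y ⊎ (A × B))
  af-∩₀ p q (now f) Q = af-mono (λ x y r → both (p x y (f x y)) (q x y r)) Q
  af-∩₀ {R = R} {P} p q (later f) Q = later λ x →
    af-mono (λ { y z (inj₁ (inj₁ r)) → inj₁ (inj₁ r)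
               ; y z (inj₁ (inj₂ r)) → inj₂ (inj₁ r)
               ; y z (inj₂ ab) → inj₁ (inj₂ ab) })
      (af-∩₀ {R = λ y z → R y z ⊎ R x y}
        (λ { y z (inj₁ r) → [ inj₁ ∘ inj₁ , inj₂ ]′ (p y z r)
           ; y z (inj₂ r) → [ inj₁ ∘ inj₂ , inj₂ ]′ (p x y r) })
        (λ y z r → [ inj₁ ∘ inj₁ , inj₂ ]′ (q y z r)) (f x) Q)

  af-∩₁ : {R P Q : X → X → Set} {A B : X → Set} →
          (∀ x y → P x y → R x y ⊎ A x) → (∀ x y → Q x y → R x y ⊎ B x) →
          AF P → AF Q → AF (λ x y → R x y ⊎ (A x × B x))
  af-∩₁ p q (now f) Q = af-mono (λ x y r → both (p x y (f x y)) (q x y r)) Q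
  af-∩₁ p q P@(later _) (now g) = af-mono (λ x y r → both (p x y r) (q x y (g x y))) P
  af-∩₁ {R = R} {A = A} {B} p q (later f) (later g) = later λ x →
    af-mono (λ { y z (inj₁ (inj₁ (inj₁ r)))  → inj₁ (inj₁ r)
               ; y z (inj₁ (inj₁ (inj₂ r)))  → inj₂ (inj₁ r)
               ; y z (inj₁ (inj₂ ab)) → inj₁ (inj₂ ab)
               ; y z (inj₂ ab)        → inj₂ (inj₂ ab) })
      (af-∩₀ {R = λ y z → (R y z ⊎ R x y) ⊎ (A y × B y)} {A = A x} {B = B x}
        (λ { y z (inj₁ (inj₁ r)) → inj₁ (inj₁ r)
           ; y z (inj₁ (inj₂ a)) → inj₂ a
           ; y z (inj₂ ab) → inj₁ (inj₂ ab) })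
        (λ { y z (inj₁ (inj₁ r)) → inj₁ (inj₁ r)
           ; y z (inj₁ (inj₂ a)) → inj₂ a
           ; y z (inj₂ ab) → inj₁ (inj₂ ab) })
        (af-∩₁ {R = λ y z → (R y z ⊎ R x y) ⊎ A x} {A = A} {B = B}
          (λ { y z (inj₁ r) → [ inj₁ ∘ inj₁ ∘ inj₁ , inj₂ ]′ (p y z r)
             ; y z (inj₂ r) → [ inj₁ ∘ inj₁ ∘ inj₂ , inj₁ ∘ inj₂ ]′ (p x y r) })
          (λ y z r → [ inj₁ ∘ inj₁ ∘ inj₁ , inj₂ ]′ (q y z r)) (f x) (later g))
        (af-∩₁ {R = λ y z → (R y z ⊎ R x y) ⊎ B x} {A = A} {B = B}
          (λ y z r → [ inj₁ ∘ inj₁ ∘ inj₁ , inj₂ ]′ (p y z r))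
          (λ { y z (inj₁ r) → [ inj₁ ∘ inj₁ ∘ inj₁ , inj₂ ]′ (q y z r)
             ; y z (inj₂ r) → [ inj₁ ∘ inj₁ ∘ inj₂ , inj₁ ∘ inj₂ ]′ (q x y r) })
          (later f) (g x)))

  -- An intuitionistic form of Ramsey's theorem. Once x is fixed, each recursive call leaves as its
  -- extra alternative `P x y` or `Q x y`, a property of y alone; these are the unary parts that
  -- `af-∩₁` conjoins.
  af-∩ : {P Q : X → X → Set} → AF P → AF Q → AF (λ x y → P x y × Q x y)
  af-∩ (now f) Q = af-mono (λ x y r → f x y , r) Q
  af-∩ P@(later _) (now g) = af-mono (λ x y r → r , g x y) P
  af-∩ {P = P} {Q} (later f) (later g) = later λ x →
    af-∩₁ {R = λ y z → P y z × Q y z} {A = P x} {B = Q x}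
      (λ { y z (inj₁ p , q) → inj₁ (p , q) ; y z (inj₂ p , _) → inj₂ p })
      (λ { y z (p , inj₁ q) → inj₁ (p , q) ; y z (_ , inj₂ q) → inj₂ q })
      (af-∩ (f x) (later g)) (af-∩ (later f) (g x))

  -- Induction on the first value n: a next value x ≥ n closes the sequence, and a smaller one is at
  -- most n - 1, so that the derivation for n - 1 applies.
  af-≤ : AF _≤_
  af-≤ = later from
    where
    from : ∀ n → AF (λ y z → y ≤ z ⊎ n ≤ y)
    from zero    = now λ _ _ → inj₂ z≤n
    from (suc n) = later λ x → step x (suc n ℕ.≤? x)
      where
      step : ∀ x → _ → _
      step x (yes n<x) = now λ _ _ → inj₂ (inj₂ n<x)
      step x (no n≮x)  = af-mono
        (λ { y z (inj₁ r) → inj₁ (inj₁ r)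
           ; y z (inj₂ r) → inj₂ (inj₁ (ℕ.≤-trans (ℕ.≤-pred (ℕ.≰⇒> n≮x)) r)) })
        (from n)

  -- Equality on Fin n is the intersection of two orders on ℕ.
  af-≡ : ∀ {n} → AF {Fin n} _≡_
  af-≡ {n} = af-mono
    (λ x y (x≤y , y≤x) → Fin.toℕ-injective (ℕ.≤-antisym x≤y (flip x y y≤x)))
    (af-∩ (af-on toℕ af-≤) (af-on (toℕ ∘ opposite) af-≤))
    where
    flip : ∀ (x y : Fin n) → toℕ (opposite x) ≤ toℕ (opposite y) → toℕ y ≤ toℕ x
    flip x y p = ℕ.≮⇒≥ λ x<y → ℕ.<⇒≱ (subst₂ _<_ (sym (Fin.opposite-prop y)) (sym (Fin.opposite-prop x))
      (ℕ.∸-monoʳ-< (s≤s x<y) (Fin.toℕ<n y))) p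

  infix 4 _≼_
  _≼_ : ∀ {d} → (Fin d → ℕ) → (Fin d → ℕ) → Set
  u ≼ v = ∀ i → u i ≤ v i

  ≼-refl : ∀ {d} {u : Fin d → ℕ} → u ≼ u
  ≼-refl i = ℕ.≤-refl

  ≼-trans : ∀ {d} {u v w : Fin d → ℕ} → u ≼ v → v ≼ w → u ≼ w
  ≼-trans p q i = ℕ.≤-trans (p i) (q i)

  af-≼ : ∀ d → AF (_≼_ {d})
  af-≼ zero    = now λ _ _ ()
  af-≼ (suc d) = af-mono (λ { u v (p , q) zero → p ; u v (p , q) (suc i) → q i })
    (af-∩ (af-on (λ u → u zero) af-≤) (af-on (λ u i → u (suc i)) (af-≼ d)))

  -- Accessibility of the bad sequence L (newest element first) under bad extensions. Recursion on
  -- it takes the place of the absence of infinite bad sequences.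
  data Term {X : Set} (R : X → X → Set) (L : List X) : Set where
    term : (∀ x → ¬ Any (λ b → R b x) L → Term R (x ∷ L)) → Term R L

  -- S is the residual relation at the current node of the derivation. Its alternatives to `R y z`
  -- say that y is above an element of L, which is impossible for an admissible y; so below `now` at
  -- most one more element fits.
  af⇒term : {R S : X → X → Set} {L : List X} → AF S →
            (∀ y z → S y z → R y z ⊎ Any (λ b → R b y) L) → Term R L
  af⇒term (now f) i = term λ x x∉ → term λ y y∉ →
    ⊥-elim ([ y∉ ∘ here , x∉ ]′ (i x y (f x y)))
  af⇒term (later f) i = term λ x x∉ → af⇒term (f x)
    λ { y z (inj₁ s) → [ inj₁ , inj₂ ∘ there ]′ (i y z s)
      ; y z (inj₂ s) → [ inj₂ ∘ here , ⊥-elim ∘ x∉ ]′ (i x y s) }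

  Conf : ℕ → ℕ → Set
  Conf n d = Fin n × (Fin d → ℕ)

  infix 4 _⊑_
  _⊑_ : ∀ {n d} → Conf n d → Conf n d → Set
  (q , u) ⊑ (r , v) = q ≡ r × u ≼ v

  dickson : ∀ {n d} → Term (_⊑_ {n} {d}) []
  dickson = af⇒term (af-∩ (af-on proj₁ af-≡) (af-on proj₂ (af-≼ _))) λ _ _ → inj₁

-- Büchi games on counters and finite bases of their winning regions

module Games where

  open AlmostFull
  open import Data.Nat using (ℕ; zero; suc; _≤_)
  import Data.Nat.Properties as ℕ
  open import Data.Integer as ℤ using (ℤ; +_)
  import Data.Integer.Properties as ℤ
  open import Data.Bool using (Bool; true)
  open import Data.Fin using (Fin; zero; suc)
  import Data.Fin.Properties as Fin
  open import Data.List using (List; []; _∷_; _++_; [_])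
  open import Data.List.Relation.Unary.Any using (Any; here; there; any?)
  import Data.List.Relation.Unary.Any as Any
  import Data.List.Relation.Unary.Any.Properties as Any
  open import Data.List.Relation.Unary.All using (All; []; _∷_)
  import Data.List.Relation.Unary.All as All
  import Data.List.Relation.Unary.All.Properties as All
  open import Data.List.Membership.Propositional using (_∈_)
  open import Data.Product using (∃; _×_; _,_; proj₁; proj₂)
  open import Data.Sum using (_⊎_; inj₁; inj₂; [_,_]′)
  import Data.Sum as Sum
  open import Function using (_∘_; id)
  open import Relation.Nullary using (Dec; yes; no)
  open import Relation.Nullary.Decidable using (_×-dec_)
  open import Relation.Binary.PropositionalEquality using (_≡_; refl)

  Edge : ℕ → ℕ → Set
  Edge n d = (Fin d → ℤ) × Bool × Fin n

  module _ {n d : ℕ} where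
    eff : Edge n d → Fin d → ℤ
    eff = proj₁

    acc : Edge n d → Bool
    acc e = proj₁ (proj₂ e)

    tgt : Edge n d → Fin n
    tgt e = proj₂ (proj₂ e)

  -- A game gives every state a non-empty list of options: the environment picks
  -- an option, then the player picks an edge of it.
  Game : ℕ → ℕ → Set
  Game n d = Fin n → List (Edge n d) × List (List (Edge n d))

  Pred : ℕ → ℕ → Set₁
  Pred n d = Fin n → (Fin d → ℕ) → Set

  options : ∀ {n d} → Game n d → Fin n → List (List (Edge n d))
  options δ q = proj₁ (δ q) ∷ proj₂ (δ q)

  -- Moves are lossy: counters may be decreased arbitrarily by a move.
  Fires : ∀ {d} → (Fin d → ℕ) → (Fin d → ℤ) → (Fin d → ℕ) → Set
  Fires v z v' = ∀ i → + v' i ℤ.≤ + v i ℤ.+ z i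

  fires-mono : ∀ {d} {u v u' v' : Fin d → ℕ} {z : Fin d → ℤ} →
               u ≼ v → v' ≼ u' → Fires u z u' → Fires v z v'
  fires-mono {z = z} p q f i =
    ℤ.≤-trans (ℤ.+≤+ (q i)) (ℤ.≤-trans (f i) (ℤ.+-monoˡ-≤ (z i) (ℤ.+≤+ (p i))))

  Move : ∀ {n d} → Pred n d → Pred n d → List (Edge n d) → (Fin d → ℕ) → Set
  Move X Y o v = ∃ λ e → e ∈ o × ∃ λ v' → Fires v (eff e) v' ×
    ((acc e ≡ true × X (tgt e) v') ⊎ Y (tgt e) v')

  -- Being inductive, it makes the next visit happen after finitely many moves against every
  -- environment. X is available only behind an accepting edge, so each tree contains an actual
  -- visit.
  data Attr {n d : ℕ} (δ : Game n d) (X : Pred n d) (q : Fin n) (v : Fin d → ℕ) : Set where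
    node : (∀ o → o ∈ options δ q → Move X (Attr δ X) o v) → Attr δ X q v

  -- Post-fixed points of `Attr δ`; the Büchi winning region is the largest of them.
  Good : ∀ {n d} → Game n d → Pred n d → Set
  Good δ X = ∀ q v → X q v → Attr δ X q v

  ↑ : ∀ {n d} → List (Conf n d) → Pred n d
  ↑ L q v = Any (_⊑ (q , v)) L

  -- Büchi winning configurations, witnessed by a finite basis of a good set.
  Win : ∀ {n d} → Game n d → Pred n d
  Win {n} {d} δ q v = ∃ λ (L : List (Conf n d)) → Good δ (↑ L) × ↑ L q v

  UWin : ∀ {n d} → Game n d → Fin n → Set
  UWin δ q = ∃ λ v → Win δ q v

  attr-up : ∀ {n d} {δ : Game n d} {X : Pred n d} {q : Fin n} {u v : Fin d → ℕ} →
            u ≼ v → Attr δ X q u → Attr δ X q v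
  attr-up p (node f) = node λ o m → let e , e∈ , v' , g , r = f o m in
    e , e∈ , v' , fires-mono {z = eff e} p ≼-refl g , r

  attr-map : ∀ {n d} {δ δ' : Game n d} {X X' : Pred n d} →
             (∀ q o → o ∈ options δ' q → o ∈ options δ q) →
             (∀ q v → X q v → X' q v) → ∀ {q v} → Attr δ X q v → Attr δ' X' q v
  attr-map {δ = δ} {δ'} {X} {X'} i j (node f) = node λ o m → go (f o (i _ o m))
    where
    go : ∀ {o v} → Move X (Attr δ X) o v → Move X' (Attr δ' X') o v
    go (e , e∈ , v' , g , inj₁ (a , x)) = e , e∈ , v' , g , inj₁ (a , j _ _ x)
    go (e , e∈ , v' , g , inj₂ t)       = e , e∈ , v' , g , inj₂ (attr-map i j t)

  module _ {n d : ℕ} where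

    _⊑?_ : (b c : Conf n d) → Dec (b ⊑ c)
    (q , u) ⊑? (r , v) = (q Fin.≟ r) ×-dec Fin.all? λ i → u i ℕ.≤? v i

    ↑? : (L : List (Conf n d)) → ∀ q v → Dec (↑ L q v)
    ↑? L q v = any? (_⊑? (q , v)) L

    ⊑-trans : {a b c : Conf n d} → a ⊑ b → b ⊑ c → a ⊑ c
    ⊑-trans (refl , p) (refl , q) = refl , ≼-trans p q

    ↑-up : ∀ {L : List (Conf n d)} {q u v} → u ≼ v → ↑ L q u → ↑ L q v
    ↑-up p = Any.map λ b → ⊑-trans b (refl , p)

    ∈⇒↑ : ∀ {L : List (Conf n d)} {q v} → (q , v) ∈ L → ↑ L q v
    ∈⇒↑ = Any.map λ { refl → refl , ≼-refl }

    holds : Pred n d → Conf n d → Set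
    holds X c = X (proj₁ c) (proj₂ c)

    -- Finite choice: as `P` is monotone in the list, finitely many witness lists can be
    -- concatenated into one.
    gather : {B : Set} (X : Pred n d) {P : List (Conf n d) → B → Set} →
             (∀ {L L'} b → (∀ q v → ↑ L q v → ↑ L' q v) → P L b → P L' b) →
             (bs : List B) → (∀ b → b ∈ bs → ∃ λ L → All (holds X) L × P L b) →
             ∃ λ L → All (holds X) L × (∀ b → b ∈ bs → P L b)
    gather X mono []       f = [] , [] , λ _ ()
    gather X mono (b ∷ bs) f =
      let L₁ , x₁ , p₁ = f b (here refl)
          L₂ , x₂ , p₂ = gather X mono bs (λ c m → f c (there m))
      in L₁ ++ L₂ , All.++⁺ x₁ x₂ ,
         λ { c (here refl) → mono c (λ _ _ → Any.++⁺ˡ) p₁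
           ; c (there m)   → mono c (λ _ _ → Any.++⁺ʳ L₁) (p₂ c m) }

    module _ (δ : Game n d) where

      -- Compactness: option lists are finite and the player answers each with one edge, so a tree
      -- has finitely many leaves in X.
      attr-leaves : ∀ {X q v} → Attr δ X q v →
                    ∃ λ L → All (holds X) L × Attr δ (↑ L) q v
      attr-leaves {X} {q} {v} (node f) =
        let L , xs , g = gather X {P = λ L o → Move (↑ L) (Attr δ (↑ L)) o v} mono
                           (options δ q) (λ o m → leaf (f o m))
        in L , xs , node g
        where
        mono : ∀ {L L'} o → (∀ q v → ↑ L q v → ↑ L' q v) →
               Move (↑ L) (Attr δ (↑ L)) o v → Move (↑ L') (Attr δ (↑ L')) o v
        mono o i (e , m , v' , g , r) = e , m , v' , g ,
          Sum.map (λ { (a , x) → a , i _ _ x }) (attr-map (λ _ _ → id) i) r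
        leaf : ∀ {o v} → Move X (Attr δ X) o v →
               ∃ λ L → All (holds X) L × Move (↑ L) (Attr δ (↑ L)) o v
        leaf (e , m , v' , g , inj₁ (a , x)) =
          [ tgt e , v' ] , x ∷ [] , e , m , v' , g , inj₁ (a , here (refl , ≼-refl))
        leaf (e , m , v' , g , inj₂ t) =
          let L , xs , t' = attr-leaves t in L , xs , e , m , v' , g , inj₂ t'

      -- Worklist closure: L is the processed part (a bad sequence), W the rest.
      saturate : ∀ {X} → Good δ X → ∀ L W → Term _⊑_ L → All (holds X) W →
                 All (holds (Attr δ (↑ (L ++ W)))) L →
                 ∃ λ B → Good δ (↑ B) × (∀ q v → ↑ (L ++ W) q v → ↑ B q v)
      saturate good L [] _ _ inv =
        L , (λ q v m → close inv m) , λ q v → [ id , (λ ()) ]′ ∘ Any.++⁻ L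
        where
        close : ∀ {M q v} → All (holds (Attr δ (↑ (L ++ [])))) M → ↑ M q v → Attr δ (↑ L) q v
        close (t ∷ ts) (here (refl , le)) =
          attr-map (λ _ _ → id) (λ q v → [ id , (λ ()) ]′ ∘ Any.++⁻ L) (attr-up le t)
        close (t ∷ ts) (there m) = close ts m
      saturate {X} good L ((q , v) ∷ W) T₀ (x ∷ xs) inv with ↑? L q v
      ... | yes dom = let B , g , i = saturate good L W T₀ xs (All.map (attr-map (λ _ _ → id) skip) inv)
                      in B , g , λ r u → i r u ∘ skip r u
        where
        skip : ∀ r u → ↑ (L ++ (q , v) ∷ W) r u → ↑ (L ++ W) r u
        skip r u m with Any.++⁻ L m
        ... | inj₁ m'                = Any.++⁺ˡ m'
        ... | inj₂ (here (refl , le)) = Any.++⁺ˡ (↑-up le dom)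
        ... | inj₂ (there m')        = Any.++⁺ʳ L m'
      saturate good L ((q , v) ∷ W) (term T) (x ∷ xs) inv | no ¬dom =
        -- The worklist grows by the leaves of the new tree, but the `Term` argument shrinks because
        -- (q , v) is dominated by nothing in L. They lie in X and can be expanded in turn.
        let ls , xls , t = attr-leaves (good q v x)
            L' = (q , v) ∷ L
            grow : ∀ r u → ↑ (L ++ (q , v) ∷ W) r u → ↑ (L' ++ ls ++ W) r u
            grow r u m = [ there ∘ Any.++⁺ˡ , [ here , there ∘ Any.++⁺ʳ L ∘ Any.++⁺ʳ ls ]′ ∘ Any.toSum ]′ (Any.++⁻ L m)
            B , g , i = saturate good L' (ls ++ W) (T (q , v) ¬dom) (All.++⁺ xls xs)
                          (attr-map (λ _ _ → id) (λ _ _ → there ∘ Any.++⁺ʳ L ∘ Any.++⁺ˡ) t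
                           ∷ All.map (attr-map (λ _ _ → id) grow) inv)
        in B , g , λ r u → i r u ∘ grow r u

      -- This permits the later proofs to use infinite invariants that need not even be upward
      -- closed.
      good⇒win : ∀ {X} → Good δ X → ∀ {q v} → X q v → Win δ q v
      good⇒win good {q} {v} x =
        let B , g , i = saturate good [] [ q , v ] dickson (x ∷ []) []
        in B , g , i q v (here (refl , ≼-refl))

      win-up : ∀ {q u v} → u ≼ v → Win δ q u → Win δ q v
      win-up p (L , g , m) = L , g , ↑-up p m

      win⇒attr : Good δ (Win δ)
      win⇒attr q v (L , g , m) = attr-map (λ _ _ → id) (λ r u m' → L , g , m') (g q v m)

      -- With `win⇒attr`, `Win` is a fixed point: one attractor layer added to a good set leaves it
      -- good.
      attr⇒win : ∀ {q v} → Attr δ (Win δ) q v → Win δ q v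
      attr⇒win t = good⇒win {X = λ q v → Win δ q v ⊎ Attr δ (Win δ) q v}
        (λ { q v (inj₁ w) → attr-map (λ _ _ → id) (λ _ _ → inj₁) (win⇒attr q v w)
           ; q v (inj₂ t) → attr-map (λ _ _ → id) (λ _ _ → inj₁) t }) (inj₂ t)

-- Integer cones and the double description method

module Cones where

  open import Data.Nat as ℕ using (ℕ; zero; suc)
  open import Data.Integer using (ℤ; +_; -[1+_]; _+_; _*_; -_; _-_; _≤_; _<_; 0ℤ; 1ℤ; +≤+)
  import Data.Integer.Properties as ℤ
  open import Data.Integer.Tactic.RingSolver using (solve-∀)
  open import Data.Fin using (Fin; zero; suc)
  open import Data.List using (List; []; _∷_; _++_; [_]; filter; cartesianProductWith)
  open import Data.List.Relation.Unary.Any using (here; there)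
  open import Data.List.Membership.Propositional using (_∈_)
  import Data.List.Membership.Propositional.Properties as ∈
  open import Data.Product using (∃; _×_; _,_; proj₂)
  open import Data.Sum using (_⊎_; inj₁; inj₂; [_,_]′)
  open import Data.Empty using (⊥-elim)
  open import Function using (_∘_; id)
  open import Relation.Nullary using (¬_; yes; no)
  open import Relation.Binary.PropositionalEquality using (_≡_; refl; sym; trans; cong; cong₂; subst; _≗_)

  Vecℤ : ℕ → Set
  Vecℤ m = Fin m → ℤ

  +-swapˡ : ∀ a b c → a + (b + c) ≡ b + (a + c)
  +-swapˡ = solve-∀

  +-swapʳ : ∀ a b c → (a + b) + c ≡ (a + c) + b
  +-swapʳ = solve-∀

  neg-≥0 : ∀ {z} → z < 0ℤ → 0ℤ ≤ - z
  neg-≥0 p = ℤ.neg-mono-≤ (ℤ.<⇒≤ p)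

  *-≥0 : ∀ {a b} → 0ℤ ≤ a → 0ℤ ≤ b → 0ℤ ≤ a * b
  *-≥0 {+ a} {+ b} _ _ = ℤ.≤-trans (+≤+ ℕ.z≤n) (ℤ.≤-reflexive (ℤ.pos-* a b))

  +-≥0 : ∀ {a b} → 0ℤ ≤ a → 0ℤ ≤ b → 0ℤ ≤ a + b
  +-≥0 = ℤ.+-mono-≤

  1≤* : ∀ {a b} → 1ℤ ≤ a → 1ℤ ≤ b → 1ℤ ≤ a * b
  1≤* {+ suc a} {+ suc b} _ _ = +≤+ (ℕ.s≤s ℕ.z≤n)
  1≤* {+ zero} (+≤+ ())
  1≤* {+ suc _} {+ zero} _ (+≤+ ())

  1≤⇒0≤ : ∀ {a} → 1ℤ ≤ a → 0ℤ ≤ a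
  1≤⇒0≤ = ℤ.≤-trans (+≤+ ℕ.z≤n)

  module _ {m : ℕ} where

    -- The generated monoid, with repetition in place of coefficients. Equations are pointwise
    -- because vectors are functions.
    data Gen (P : List (Vecℤ m)) (x : Vecℤ m) : Set where
      nil : (∀ i → x i ≡ 0ℤ) → Gen P x
      add : ∀ {p y} → p ∈ P → Gen P y → (∀ i → x i ≡ p i + y i) → Gen P x

    gen-resp : ∀ {P x x'} → x ≗ x' → Gen P x → Gen P x'
    gen-resp e (nil z)     = nil λ i → trans (sym (e i)) (z i)
    gen-resp e (add p g f) = add p g λ i → trans (sym (e i)) (f i)

    gen-+ : ∀ {P x y} → Gen P x → Gen P y → Gen P (λ i → x i + y i)
    gen-+ {x = x} {y} (nil z) h = gen-resp (λ i → sym (trans (cong (_+ y i) (z i)) (ℤ.+-identityˡ (y i)))) h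
    gen-+ {y = y} (add {p} {x'} m g f) h =
      add m (gen-+ g h) λ i → trans (cong (_+ y i) (f i)) (ℤ.+-assoc (p i) (x' i) (y i))

    gen-bind : ∀ {P Q} → (∀ p → p ∈ P → Gen Q p) → ∀ {x} → Gen P x → Gen Q x
    gen-bind f (nil z)     = nil z
    gen-bind f (add m g e) = gen-resp (sym ∘ e) (gen-+ (f _ m) (gen-bind f g))

    gen-∈ : ∀ {P p} → p ∈ P → Gen P p
    gen-∈ m = add m (nil λ _ → refl) λ i → sym (ℤ.+-identityʳ _)

    gen-⊆ : ∀ {P Q} → (∀ {p} → p ∈ P → p ∈ Q) → ∀ {x} → Gen P x → Gen Q x
    gen-⊆ i = gen-bind λ p m → gen-∈ (i m)

    gen-scale : ∀ {P x} k → 0ℤ ≤ k → Gen P x → Gen P (λ i → k * x i)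
    gen-scale {P} {x} (+ n) _ g = go n
      where
      go : ∀ n → Gen P (λ i → + n * x i)
      go zero    = nil λ i → refl
      go (suc n) = gen-resp (λ i → sym (ℤ.suc-* (+ n) (x i))) (gen-+ g (go n))

    gen-++⁻ : ∀ P {Q x} → Gen (P ++ Q) x →
              ∃ λ y → ∃ λ z → Gen P y × Gen Q z × (∀ i → x i ≡ y i + z i)
    gen-++⁻ P (nil e) = (λ _ → 0ℤ) , (λ _ → 0ℤ) , nil (λ _ → refl) , nil (λ _ → refl) , e
    gen-++⁻ P (add {p} m g e) with ∈.∈-++⁻ P m | gen-++⁻ P g
    ... | inj₁ m' | y , z , gy , gz , f =
      _ , z , add m' gy (λ _ → refl) , gz , λ i → trans (e i) (trans (cong (λ a → p i + a) (f i)) (sym (ℤ.+-assoc (p i) _ _)))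
    ... | inj₂ m' | y , z , gy , gz , f =
      y , _ , gy , add m' gz (λ _ → refl) , λ i → trans (e i) (trans (cong (λ a → p i + a) (f i)) (+-swapˡ (p i) (y i) (z i)))

    -- One step of the double description method: comb i p q has i-th coordinate 0.
    comb : Fin m → Vecℤ m → Vecℤ m → Vecℤ m
    comb i p q j = p i * q j + (- q i) * p j

    nonneg neg cut : Fin m → List (Vecℤ m) → List (Vecℤ m)
    nonneg i = filter λ p → 0ℤ ℤ.≤? p i
    neg    i = filter λ p → p i ℤ.<? 0ℤ
    cut i G = nonneg i G ++ cartesianProductWith (comb i) (nonneg i G) (neg i G)

    cut⁻ : ∀ i G {g} → g ∈ cut i G → (g ∈ G × 0ℤ ≤ g i) ⊎
           ∃ λ p → ∃ λ q → (p ∈ G × 0ℤ ≤ p i) × (q ∈ G × q i < 0ℤ) × g ≡ comb i p q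
    cut⁻ i G m with ∈.∈-++⁻ (nonneg i G) m
    ... | inj₁ m' = inj₁ (∈.∈-filter⁻ _ m')
    ... | inj₂ m' = let p , q , p∈ , q∈ , e = ∈.∈-cartesianProductWith⁻ (comb i) (nonneg i G) (neg i G) m'
                    in inj₂ (p , q , ∈.∈-filter⁻ _ p∈ , ∈.∈-filter⁻ _ q∈ , e)

    cut-sound : ∀ i G {x} → Gen (cut i G) x → Gen G x
    cut-sound i G = gen-bind λ g m → case (cut⁻ i G m)
      where
      case : ∀ {g} → _ → Gen G g
      case (inj₁ (m , _)) = gen-∈ m
      case (inj₂ (p , q , (p∈ , p≥) , (q∈ , q<) , refl)) =
        gen-+ (gen-scale (p i) p≥ (gen-∈ q∈)) (gen-scale (- q i) (neg-≥0 q<) (gen-∈ p∈))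

    comb-zero : ∀ i p q → comb i p q i ≡ 0ℤ
    comb-zero i p q = lemma (p i) (q i)
      where
      lemma : ∀ a b → a * b + (- b) * a ≡ 0ℤ
      lemma = solve-∀

    cut-≥0 : ∀ i G {g} → g ∈ cut i G → 0ℤ ≤ g i
    cut-≥0 i G m with cut⁻ i G m
    ... | inj₁ (_ , p) = p
    ... | inj₂ (p , q , _ , _ , refl) = ℤ.≤-reflexive (sym (comb-zero i p q))

    -- The coefficients `p i` and `- q i` of a combination are nonnegative, so inequalities imposed
    -- earlier survive.
    cut-keeps : ∀ i j G → (∀ {g} → g ∈ G → 0ℤ ≤ g j) → ∀ {g} → g ∈ cut i G → 0ℤ ≤ g j
    cut-keeps i j G pos m with cut⁻ i G m
    ... | inj₁ (g∈ , _) = pos g∈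
    ... | inj₂ (p , q , (p∈ , p≥) , (q∈ , q<) , refl) =
      +-≥0 (*-≥0 p≥ (pos q∈)) (*-≥0 (neg-≥0 q<) (pos p∈))

    split-sign : ∀ i G {x} → Gen G x →
                 ∃ λ u → ∃ λ z → Gen (nonneg i G) u × Gen (neg i G) z × (∀ j → x j ≡ u j + z j)
    split-sign i G g = gen-++⁻ (nonneg i G) (gen-⊆ in-either g)
      where
      in-either : ∀ {p} → p ∈ G → p ∈ nonneg i G ++ neg i G
      in-either {p} m with 0ℤ ℤ.≤? p i
      ... | yes h = ∈.∈-++⁺ˡ (∈.∈-filter⁺ _ m h)
      ... | no  h = ∈.∈-++⁺ʳ (nonneg i G) (∈.∈-filter⁺ (λ p → p i ℤ.<? 0ℤ) m (ℤ.≰⇒> h))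

    gen-nonneg : ∀ {i G x} → (∀ {g} → g ∈ G → 0ℤ ≤ g i) → Gen G x → 0ℤ ≤ x i
    gen-nonneg pos (nil e)     = ℤ.≤-reflexive (sym (e _))
    gen-nonneg pos (add m g e) = ℤ.≤-trans (+-≥0 (pos m) (gen-nonneg pos g)) (ℤ.≤-reflexive (sym (e _)))

    gen-neg : ∀ {i G z} → Gen (neg i G) z → (∀ j → z j ≡ 0ℤ) ⊎ z i < 0ℤ
    gen-neg (nil e) = inj₁ e
    gen-neg {i} {G} (add {p} {y} m g e) = inj₂ (subst (_< 0ℤ) (sym (e i)) (ℤ.+-mono-<-≤ p<0 y≤0))
      where
      p<0 = proj₂ (∈.∈-filter⁻ (λ p → p i ℤ.<? 0ℤ) {xs = G} m)
      y≤0 : y i ≤ 0ℤ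
      y≤0 = [ (λ e → ℤ.≤-reflexive (e i)) , ℤ.<⇒≤ ]′ (gen-neg {i} {G} g)

    -- `comb i` is bilinear, hence expands over the generators of both arguments.
    comb-gen : ∀ i G {u z} → Gen (nonneg i G) u → Gen (neg i G) z → Gen (cut i G) (comb i u z)
    comb-gen i G {u} gu (nil e) = nil λ j → trans (cong₂ (λ a b → u i * a + (- b) * u j) (e j) (e i)) (zeros (u i) (u j))
      where
      zeros : ∀ a b → a * 0ℤ + (- 0ℤ) * b ≡ 0ℤ
      zeros = solve-∀
    comb-gen i G {u} gu (add {q} {y} m g e) = gen-resp
      (λ j → sym (trans (cong₂ (λ a b → u i * a + (- b) * u j) (e j) (e i)) (bilinear (u i) (u j) (q i) (q j) (y i) (y j))))
      (gen-+ (single gu) (comb-gen i G gu g))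
      where
      bilinear : ∀ ui uj qi qj yi yj → ui * (qj + yj) + (- (qi + yi)) * uj ≡ (ui * qj + (- qi) * uj) + (ui * yj + (- yi) * uj)
      bilinear = solve-∀
      bilinear' : ∀ qi qj pi pj yi yj → (pi + yi) * qj + (- qi) * (pj + yj) ≡ (pi * qj + (- qi) * pj) + (yi * qj + (- qi) * yj)
      bilinear' = solve-∀
      single : ∀ {u} → Gen (nonneg i G) u → Gen (cut i G) (comb i u q)
      single {u} (nil e) = nil λ j → trans (cong₂ (λ a b → a * q j + (- q i) * b) (e i) (e j)) (zeros (q i) (q j))
        where
        zeros : ∀ a b → 0ℤ * b + (- a) * 0ℤ ≡ 0ℤ
        zeros = solve-∀
      single (add {p} {y} m' g e) = gen-resp
        (λ j → sym (trans (cong₂ (λ a b → a * q j + (- q i) * b) (e i) (e j)) (bilinear' (q i) (q j) (p i) (p j) (y i) (y j))))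
        (gen-+ (gen-∈ (∈.∈-++⁺ʳ (nonneg i G) (∈.∈-cartesianProductWith⁺ (comb i) m' m))) (single g))

    -- Elimination divides by a coordinate; over the integers the denominators are cleared by N.
    Multiple : List (Vecℤ m) → Vecℤ m → Set
    Multiple G x = ∃ λ N → 1ℤ ≤ N × Gen G (λ j → N * x j)

    -- Split x = u + z by the sign of the generators at i. Then u i · x = `comb i u z` + x i · u,
    -- and both summands lie in the cut; so the factor is u i.
    cut-complete : ∀ i G {x} → Gen G x → 0ℤ ≤ x i → Multiple (cut i G) x
    cut-complete i G {x} g x≥ with split-sign i G g
    ... | u , z , gu , gz , e = by (u i) refl (gen-nonneg {i} (λ {g} m → proj₂ (∈.∈-filter⁻ (λ p → 0ℤ ℤ.≤? p i) {xs = G} m)) gu)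
      where
      gu' : Gen (cut i G) u
      gu' = gen-⊆ ∈.∈-++⁺ˡ gu
      by : ∀ k → u i ≡ k → 0ℤ ≤ u i → Multiple (cut i G) x
      -- A nonempty z would make x i negative. So z vanishes, x equals u, and the factor 1 works.
      by (+ zero) k _ = 1ℤ , ℤ.≤-refl , gen-resp eq gu'
        where
        z≗0 : ∀ j → z j ≡ 0ℤ
        z≗0 = [ id , (λ z<0 → ⊥-elim (ℤ.<⇒≱ z<0 (subst (0ℤ ≤_)
                (trans (e i) (trans (cong (_+ z i) k) (ℤ.+-identityˡ (z i)))) x≥))) ]′ (gen-neg {i} {G} gz)
        eq : ∀ j → u j ≡ 1ℤ * x j
        eq j = sym (trans (ℤ.*-identityˡ (x j)) (trans (e j) (trans (cong (λ a → u j + a) (z≗0 j)) (ℤ.+-identityʳ (u j)))))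
      by (+ suc n) k u≥ = u i , subst (1ℤ ≤_) (sym k) (+≤+ (ℕ.s≤s ℕ.z≤n)) ,
        gen-resp (λ j → trans (cong (λ a → comb i u z j + a * u j) (e i))
                         (trans (lemma (u i) (u j) (z i) (z j)) (cong (u i *_) (sym (e j)))))
          (gen-+ (comb-gen i G gu gz) (gen-scale (x i) x≥ gu'))
        where
        lemma : ∀ ui uj zi zj → (ui * zj + (- zi) * uj) + (ui + zi) * uj ≡ ui * (uj + zj)
        lemma = solve-∀
      by -[1+ n ] k u≥ = ⊥-elim (neg≱ (subst (0ℤ ≤_) k u≥))
        where
        neg≱ : ¬ (0ℤ ≤ -[1+ n ])
        neg≱ ()

    cuts : List (Fin m) → List (Vecℤ m) → List (Vecℤ m)
    cuts []       G = G
    cuts (i ∷ is) G = cut i (cuts is G)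

    cuts-sound : ∀ is G {x} → Gen (cuts is G) x → Gen G x
    cuts-sound []       G = id
    cuts-sound (i ∷ is) G = cuts-sound is G ∘ cut-sound i (cuts is G)

    cuts-≥0 : ∀ is G {j} → j ∈ is → ∀ {g} → g ∈ cuts is G → 0ℤ ≤ g j
    cuts-≥0 (i ∷ is) G (here refl) = cut-≥0 i (cuts is G)
    cuts-≥0 (i ∷ is) G (there m)   = cut-keeps i _ (cuts is G) (cuts-≥0 is G m)

    cuts-complete : ∀ is G {x} → Gen G x → (∀ j → j ∈ is → 0ℤ ≤ x j) → Multiple (cuts is G) x
    cuts-complete []       G g _ = 1ℤ , ℤ.≤-refl , gen-resp (λ j → sym (ℤ.*-identityˡ _)) g
    cuts-complete (i ∷ is) G {x} g pos =
      let N , N≥ , h  = cuts-complete is G g (λ j → pos j ∘ there)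
          M , M≥ , h' = cut-complete i (cuts is G) h (*-≥0 (1≤⇒0≤ N≥) (pos i (here refl)))
      in M * N , 1≤* M≥ N≥ , gen-resp (λ j → sym (ℤ.*-assoc M N (x j))) h'

    gen-pos : ∀ {k G x} → Gen G x → 1ℤ ≤ x k → ∃ λ g → g ∈ G × 1ℤ ≤ g k
    gen-pos {k} (nil e) p with () ← ℤ.<⇒≱ {0ℤ} {1ℤ} (Data.Integer.+<+ (ℕ.s≤s ℕ.z≤n)) (subst (1ℤ ≤_) (e k) p)
    gen-pos {k} {x = x} (add {q} {y} m g e) p with 1ℤ ℤ.≤? q k
    ... | yes h = _ , m , h
    ... | no h  = gen-pos g (ℤ.≤-trans p (ℤ.≤-trans (ℤ.≤-reflexive (e k))
                    (ℤ.≤-trans (ℤ.+-monoˡ-≤ (y k) q≤0) (ℤ.≤-reflexive (ℤ.+-identityˡ (y k))))))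
      where
      <1⇒≤0 : ∀ {a} → a < 1ℤ → a ≤ 0ℤ
      <1⇒≤0 { + zero}   _ = ℤ.≤-refl
      <1⇒≤0 { + suc _}  (Data.Integer.+<+ (ℕ.s≤s ()))
      <1⇒≤0 { -[1+ _ ]} _ = Data.Integer.-≤+
      q≤0 : q k ≤ 0ℤ
      q≤0 = <1⇒≤0 (ℤ.≰⇒> h)

-- Semilinear sets: nonnegative members, sums and stars

module SemilinearSets where

  open Cones
  open import Data.Nat using (ℕ; zero; suc)
  open import Data.Integer using (ℤ; +_; _+_; _≤_; 0ℤ; 1ℤ; +≤+)
  import Data.Integer.Properties as ℤ
  open import Data.Integer.Tactic.RingSolver using (solve-∀)
  open import Data.Fin using (Fin; zero; suc)
  open import Data.List using (List; []; _∷_; _++_; [_]; map; cartesianProductWith; allFin)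
  open import Data.List.Relation.Unary.Any using (here; there; any?)
  open import Data.List.Membership.Propositional using (_∈_; find; lose)
  import Data.List.Membership.Propositional.Properties as ∈
  open import Data.Product using (∃; _×_; _,_; proj₁; proj₂)
  open import Data.Sum using (_⊎_; inj₁; inj₂; [_,_]′)
  open import Data.Empty using (⊥-elim)
  open import Function using (_∘_; id)
  open import Relation.Nullary using (¬_; Dec; yes; no)
  open import Relation.Binary.PropositionalEquality using (_≡_; refl; sym; trans; cong; cong₂; subst; _≗_)

  interchange : ∀ a b c e → (a + b) + (c + e) ≡ (a + c) + (b + e)
  interchange = solve-∀

  module _ {d : ℕ} where

    infixl 6 _⊞_
    _⊞_ : Vecℤ d → Vecℤ d → Vecℤ d
    (x ⊞ y) i = x i + y i

    ext : ℤ → Vecℤ d → Vecℤ (suc d)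
    ext k x zero    = k
    ext k x (suc i) = x i

    Lin : Set
    Lin = Vecℤ d × List (Vecℤ d)

    infix 4 _∈ₗ_
    _∈ₗ_ : Vecℤ d → Lin → Set
    x ∈ₗ (a , P) = ∃ λ y → Gen P y × x ≗ a ⊞ y

    Pos : Vecℤ d → Set
    Pos x = ∀ j → 0ℤ ≤ x j

    -- Homogenisation: coordinate zero counts the uses of the base.
    hom : Lin → List (Vecℤ (suc d))
    hom (a , P) = ext 1ℤ a ∷ map (ext 0ℤ) P

    sucs : List (Fin (suc d))
    sucs = map suc (allFin d)

    -- After the cuts all generators are nonnegative outside coordinate zero, and a sum of
    -- generators is positive at zero only if one of them is. Hence inspecting single generators
    -- decides.
    cone-dec : (G : List (Vecℤ (suc d))) → Dec (∃ λ x → Gen G x × Pos (x ∘ suc) × 1ℤ ≤ x zero)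
    cone-dec G with any? (λ g → 1ℤ ℤ.≤? g zero) (cuts sucs G)
    ... | yes h = let g , m , p = find h in
      yes (g , cuts-sound sucs G (gen-∈ m) , (λ j → cuts-≥0 sucs G (∈.∈-map⁺ suc (∈.∈-allFin j)) m) , p)
    ... | no h  = no λ { (x , g , pos , p) →
      let N , N≥ , g' = cuts-complete sucs G g (λ j m → pos' x pos j (∈.∈-map⁻ suc m))
          y , m , q   = gen-pos {k = zero} g' (1≤* N≥ p)
      in h (lose m q) }
      where
      pos' : ∀ (x : Vecℤ (suc d)) → Pos (x ∘ suc) → ∀ j → ∃ (λ i → i ∈ allFin d × j ≡ suc i) → 0ℤ ≤ x j
      pos' x pos _ (i , _ , refl) = pos i

    module _ {Q : Vecℤ d → Set} (Q-+ : ∀ {x y z} → Q x → Q y → z ≗ x ⊞ y → Q z)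
             {a P} (lin : ∀ x → x ∈ₗ (a , P) → Q x) where

      -- A vector with k uses of the base is a sum of k members of the linear set, hence in Q for k
      -- ≥ 1. Periods alone are not known to be in Q, so they are handed inwards, as y, to the
      -- innermost use of the base.
      hom-sound : ∀ {x} → Gen (hom (a , P)) x →
                  (x zero ≡ 0ℤ × Gen P (x ∘ suc)) ⊎
                  (∀ {y w} → Gen P y → w ≗ (x ∘ suc) ⊞ y → Q w)
      hom-sound (nil e) = inj₁ (e zero , nil (e ∘ suc))
      hom-sound (add (here refl) g e) with hom-sound g
      ... | inj₁ (_ , h) = inj₂ λ k f → lin _ (_ , gen-+ h k ,
              λ i → trans (f i) (trans (cong (_+ _) (e (suc i))) (ℤ.+-assoc (a i) _ _)))
      ... | inj₂ h = inj₂ λ k f → Q-+ (lin a (_ , nil (λ _ → refl) , λ i → sym (ℤ.+-identityʳ (a i)))) (h k (λ _ → refl))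
              λ i → trans (f i) (trans (cong (_+ _) (e (suc i))) (ℤ.+-assoc (a i) _ _))
      hom-sound (add {p} {y} (there m) g e) with ∈.∈-map⁻ (ext 0ℤ) m | hom-sound g
      ... | p' , m' , refl | inj₁ (z , h) =
              inj₁ (trans (e zero) (cong (λ b → 0ℤ + b) z) , gen-resp (sym ∘ e ∘ suc) (add m' h λ _ → refl))
      ... | p' , m' , refl | inj₂ h = inj₂ λ {u} k f → h (add m' k λ _ → refl)
              λ i → trans (f i) (trans (cong (_+ u i) (e (suc i))) (swap (p' i) (y (suc i)) (u i)))
        where
        swap : ∀ a b c → (a + b) + c ≡ b + (a + c)
        swap = solve-∀

      -- The two answers differ in scope on purpose: scaling may leave the linear set, but it stays
      -- in Q.
      lin-dec : (∃ λ x → Q x × Pos x) ⊎ (∀ x → x ∈ₗ (a , P) → ¬ Pos x)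
      lin-dec with cone-dec (hom (a , P))
      ... | yes (x , g , pos , 1≤) with hom-sound g
      ...   | inj₁ (z , _) = ⊥-elim (1≰0 (subst (1ℤ ≤_) z 1≤))
        where
        1≰0 : ¬ (1ℤ ≤ 0ℤ)
        1≰0 (+≤+ ())
      ...   | inj₂ h = inj₁ (x ∘ suc , h (nil {x = λ _ → 0ℤ} (λ _ → refl)) (λ i → sym (ℤ.+-identityʳ _)) , pos)
      lin-dec | no ¬h = inj₂ λ { x (y , g , e) pos → ¬h (ext 1ℤ x ,
        add {p = ext 1ℤ a} {y = ext 0ℤ y} (here refl) (gen-⊆ there (lift g)) (λ { zero → refl ; (suc i) → e i }) , pos , ℤ.≤-refl) }
        where
        lift : ∀ {y} → Gen P y → Gen (map (ext 0ℤ) P) (ext 0ℤ y)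
        lift (nil e)     = nil λ { zero → refl ; (suc i) → e i }
        lift (add m g e) = add (∈.∈-map⁺ (ext 0ℤ) m) (lift g) λ { zero → refl ; (suc i) → e i }

    Semilinear : (Vecℤ d → Set) → Set
    Semilinear Q = ∃ λ (ls : List Lin) →
      (∀ {l x} → l ∈ ls → x ∈ₗ l → Q x) × (∀ {x} → Q x → ∃ λ l → l ∈ ls × x ∈ₗ l)

    semilinear-dec : ∀ {Q} → Semilinear Q → (∀ {x y z} → Q x → Q y → z ≗ x ⊞ y → Q z) →
                     Dec (∃ λ x → Q x × Pos x)
    semilinear-dec {Q} (ls , sound , complete) Q-+ = conclude (search ls id)
      where
      search : ∀ ms → (∀ {l} → l ∈ ms → l ∈ ls) →
               (∃ λ x → Q x × Pos x) ⊎ (∀ l x → l ∈ ms → x ∈ₗ l → ¬ Pos x)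
      search []       i = inj₂ λ _ _ ()
      search (l ∷ ms) i with lin-dec Q-+ {proj₁ l} {proj₂ l} (λ x → sound {l} {x} (i (here refl))) | search ms (λ m → i (there m))
      ... | inj₁ y | _      = inj₁ y
      ... | inj₂ _ | inj₁ y = inj₁ y
      ... | inj₂ f | inj₂ g = inj₂ λ { _ x (here refl) → f x ; k x (there m) → g k x m }
      conclude : _ → Dec (∃ λ x → Q x × Pos x)
      conclude (inj₁ y) = yes y
      conclude (inj₂ f) = no λ { (x , q , pos) → let l , m , x∈ = complete q in f l x m x∈ pos }

    infixr 5 _⊕_
    _⊕_ : (Vecℤ d → Set) → (Vecℤ d → Set) → Vecℤ d → Set
    (P ⊕ Q) x = ∃ λ y → ∃ λ z → P y × Q z × x ≗ y ⊞ z

    data Star (P : Vecℤ d → Set) (x : Vecℤ d) : Set where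
      nil  : (∀ i → x i ≡ 0ℤ) → Star P x
      cons : ∀ {y z} → P y → Star P z → x ≗ y ⊞ z → Star P x

    ⊞-assoc : ∀ {x y a b c : Vecℤ d} → x ≗ y ⊞ c → y ≗ a ⊞ b → x ≗ a ⊞ (b ⊞ c)
    ⊞-assoc {a = a} {b} {c} e f i = trans (e i) (trans (cong (_+ c i) (f i)) (ℤ.+-assoc (a i) (b i) (c i)))

    ⊞-zeroˡ : ∀ {x y z : Vecℤ d} → x ≗ y ⊞ z → (∀ i → y i ≡ 0ℤ) → x ≗ z
    ⊞-zeroˡ {z = z} e f i = trans (e i) (trans (cong (_+ z i) (f i)) (ℤ.+-identityˡ _))

    star-resp : ∀ {P x y} → x ≗ y → Star P x → Star P y
    star-resp e (nil f)      = nil λ i → trans (sym (e i)) (f i)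
    star-resp e (cons p s f) = cons p s λ i → trans (sym (e i)) (f i)

    star-++ : ∀ {P x y z} → Star P y → Star P z → x ≗ y ⊞ z → Star P x
    star-++ (nil f) t e      = star-resp (sym ∘ ⊞-zeroˡ e f) t
    star-++ {z = z} (cons {y} {w} p s f) t e = cons p (star-++ s t λ _ → refl) (⊞-assoc {a = y} {w} {z} e f)

    semilinear-⊎ : ∀ {P Q} → Semilinear P → Semilinear Q → Semilinear (λ x → P x ⊎ Q x)
    semilinear-⊎ (ls , s , c) (ms , t , c') = ls ++ ms ,
      (λ m h → [ (λ m → inj₁ (s m h)) , (λ m → inj₂ (t m h)) ]′ (∈.∈-++⁻ ls m)) ,
      [ (λ p → let l , m , h = c p in l , ∈.∈-++⁺ˡ m , h)
      , (λ q → let l , m , h = c' q in l , ∈.∈-++⁺ʳ ls m , h) ]′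

    _+ₗ_ : Lin → Lin → Lin
    (a , P) +ₗ (b , Q) = a ⊞ b , P ++ Q

    +ₗ⁺ : ∀ {l m x y z} → x ∈ₗ l → y ∈ₗ m → z ≗ x ⊞ y → z ∈ₗ (l +ₗ m)
    +ₗ⁺ {a , P} {b , Q} (u , g , e) (v , h , f) k = u ⊞ v , gen-+ (gen-⊆ ∈.∈-++⁺ˡ g) (gen-⊆ (∈.∈-++⁺ʳ P) h) ,
      λ i → trans (k i) (trans (cong₂ _+_ (e i) (f i)) (interchange (a i) (u i) (b i) (v i)))

    +ₗ⁻ : ∀ {l m z} → z ∈ₗ (l +ₗ m) → ∃ λ x → ∃ λ y → x ∈ₗ l × y ∈ₗ m × z ≗ x ⊞ y
    +ₗ⁻ {a , P} {b , Q} (w , g , e) = let u , v , gu , gv , f = gen-++⁻ P g in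
      a ⊞ u , b ⊞ v , (u , gu , λ _ → refl) , (v , gv , λ _ → refl) ,
      λ i → trans (e i) (trans (cong (λ c → a i + b i + c) (f i)) (interchange (a i) (b i) (u i) (v i)))

    semilinear-⊕ : ∀ {P Q} → Semilinear P → Semilinear Q → Semilinear (P ⊕ Q)
    semilinear-⊕ (ls , s , c) (ms , t , c') = cartesianProductWith _+ₗ_ ls ms ,
      (λ m h → sound (∈.∈-cartesianProductWith⁻ _+ₗ_ ls ms m) h) ,
      λ { (y , z , p , q , e) → let l , lm , y∈ = c p ; m , mm , z∈ = c' q in
          l +ₗ m , ∈.∈-cartesianProductWith⁺ _+ₗ_ lm mm , +ₗ⁺ {l} {m} y∈ z∈ e }
      where
      sound : ∀ {l x} → (∃ λ a → ∃ λ b → a ∈ ls × b ∈ ms × l ≡ a +ₗ b) → x ∈ₗ l → _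
      sound (a , b , a∈ , b∈ , refl) h = let x , y , x∈ , y∈ , e = +ₗ⁻ {a} {b} h in
        x , y , s a∈ x∈ , t b∈ y∈ , e

    -- The part of a star that uses the linear set at least once.
    pump : Lin → Lin → Lin
    pump (a , P) l = (a , a ∷ P) +ₗ l

    -- One linear set for each choice of which members of the list occur at least once, because the
    -- periods of a linear set may be used only together with its base.
    stars : List Lin → List Lin
    stars []       = [ (λ _ → 0ℤ) , [] ]
    stars (l ∷ ls) = stars ls ++ map (pump l) (stars ls)

    semilinear-star : ∀ {P} → Semilinear P → Semilinear (Star P)
    semilinear-star {P} (ls , s , c) = stars ls , sound ls s , complete
      where
      -- Every extra copy of the base is by itself a member of the linear set; the remaining periods
      -- go to the one compulsory copy.
      absorb : ∀ {a Q z} → (∀ {x} → x ∈ₗ (a , Q) → P x) → Gen (a ∷ Q) z →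
               ∃ λ u → ∃ λ v → Star P u × Gen Q v × z ≗ u ⊞ v
      absorb i (nil e) = (λ _ → 0ℤ) , (λ _ → 0ℤ) , nil (λ _ → refl) , nil (λ _ → refl) , e
      absorb {a} i (add (here refl) g e) = let u , v , su , gv , f = absorb i g in
        a ⊞ u , v , cons (i (_ , nil (λ _ → refl) , λ j → sym (ℤ.+-identityʳ (a j)))) su (λ _ → refl) , gv ,
        λ j → trans (e j) (trans (cong (λ c → a j + c) (f j)) (sym (ℤ.+-assoc (a j) (u j) (v j))))
      absorb i (add {p} (there m) g e) = let u , v , su , gv , f = absorb i g in
        u , p ⊞ v , su , add m gv (λ _ → refl) ,
        λ j → trans (e j) (trans (cong (λ c → p j + c) (f j)) (+-swapˡ (p j) (u j) (v j)))

      sound : ∀ ms → (∀ {l x} → l ∈ ms → x ∈ₗ l → P x) → ∀ {l x} → l ∈ stars ms → x ∈ₗ l → Star P x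
      sound [] i (here refl) (y , nil f , e) = nil λ j → trans (e j) (trans (ℤ.+-identityˡ (y j)) (f j))
      sound [] i (here refl) (y , add () _ _ , e)
      sound ((a , Q) ∷ ms) i m h with ∈.∈-++⁻ (stars ms) m
      ... | inj₁ m' = sound ms (i ∘ there) m' h
      ... | inj₂ m' with ∈.∈-map⁻ (pump (a , Q)) m'
      ...   | l' , m'' , refl =
        let x₁ , x₂ , (w , g , e₁) , x₂∈ , e = +ₗ⁻ {a , a ∷ Q} {l'} h
            u , v , su , gv , f = absorb (i (here refl)) g
        in cons (i (here refl) (v , gv , λ _ → refl)) (star-++ su (sound ms (i ∘ there) m'' x₂∈) (λ _ → refl))
             λ j → trans (e j) (trans (cong (_+ x₂ j) (trans (e₁ j) (cong (λ c → a j + c) (f j)))) (shuffle (a j) (u j) (v j) (x₂ j)))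
        where
        shuffle : ∀ a b c e → (a + (b + c)) + e ≡ (a + c) + (b + e)
        shuffle = solve-∀

      -- If m already uses l, the new base is booked as a period of the pumped set; otherwise the
      -- variant pumped with l is chosen.
      step : ∀ ms {l m y z x} → l ∈ ms → y ∈ₗ l → m ∈ stars ms → z ∈ₗ m → x ≗ y ⊞ z →
             ∃ λ m' → m' ∈ stars ms × x ∈ₗ m'
      step ((a , Q) ∷ ms) l∈ y∈ m∈ z∈ e with ∈.∈-++⁻ (stars ms) m∈
      step ((a , Q) ∷ ms) {m = m} (here refl) (u , g , f) m∈ z∈ e | inj₁ m∈' =
        _ , ∈.∈-++⁺ʳ (stars ms) (∈.∈-map⁺ (pump (a , Q)) m∈') ,
        +ₗ⁺ {a , a ∷ Q} {m} (u , gen-⊆ there g , f) z∈ e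
      step ((a , Q) ∷ ms) (there l∈) y∈ m∈ z∈ e | inj₁ m∈' =
        let m' , m'∈ , x∈ = step ms l∈ y∈ m∈' z∈ e in m' , ∈.∈-++⁺ˡ m'∈ , x∈
      step ((a , Q) ∷ ms) l∈ y∈ m∈ z∈ e | inj₂ m∈' with ∈.∈-map⁻ (pump (a , Q)) m∈'
      step ((a , Q) ∷ ms) {x = x} (here refl) (u , g , f) m∈ z∈ e | inj₂ m∈' | m₀ , m₀∈ , refl =
        let z₁ , z₂ , (w , h , f₁) , z₂∈ , f₂ = +ₗ⁻ {a , a ∷ Q} {m₀} z∈
        in _ , m∈ , +ₗ⁺ {a , a ∷ Q} {m₀}
             (_ , gen-+ (gen-⊆ there g) (add (here refl) h λ _ → refl) , λ _ → refl) z₂∈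
             λ i → trans (e i) (trans (cong₂ _+_ (f i) (trans (f₂ i) (cong (_+ z₂ i) (f₁ i)))) (shuffle (a i) (u i) (a i) (w i) (z₂ i)))
        where
        shuffle : ∀ a b c e k → (a + b) + ((c + e) + k) ≡ (a + (b + (c + e))) + k
        shuffle = solve-∀
      step ((a , Q) ∷ ms) {y = y} (there l∈) y∈ m∈ z∈ e | inj₂ m∈' | m₀ , m₀∈ , refl =
        let z₁ , z₂ , z₁∈ , z₂∈ , f = +ₗ⁻ {a , a ∷ Q} {m₀} z∈
            m' , m'∈ , x∈ = step ms {x = y ⊞ z₂} l∈ y∈ m₀∈ z₂∈ (λ _ → refl)
        in _ , ∈.∈-++⁺ʳ (stars ms) (∈.∈-map⁺ (pump (a , Q)) m'∈) , +ₗ⁺ {a , a ∷ Q} {m'} z₁∈ x∈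
             λ i → trans (e i) (trans (cong (λ c → y i + c) (f i)) (+-swapˡ (y i) (z₁ i) (z₂ i)))

      zero∈ : ∀ ms {x} → (∀ i → x i ≡ 0ℤ) → ∃ λ l → l ∈ stars ms × x ∈ₗ l
      zero∈ [] e = _ , here refl , _ , nil (λ _ → refl) , e
      zero∈ (l ∷ ms) e = let m , m∈ , h = zero∈ ms e in m , ∈.∈-++⁺ˡ m∈ , h

      complete : ∀ {x} → Star P x → ∃ λ l → l ∈ stars ls × x ∈ₗ l
      complete (nil e) = zero∈ ls e
      complete (cons p st e) = let l , l∈ , y∈ = c p ; m , m∈ , z∈ = complete st in step ls l∈ y∈ m∈ z∈ e

-- Games without environment choice: walks and lassos

module OnePlayer where

  open AlmostFull
  open Games
  open Cones
  open SemilinearSets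
  open import Data.Nat as ℕ using (ℕ; zero; suc)
  import Data.Nat.Properties as ℕ
  open import Data.Integer using (ℤ; +_; -[1+_]; _+_; -_; _-_; _≤_; 0ℤ; +≤+; ∣_∣)
  import Data.Integer.Properties as ℤ
  open import Data.Integer.Tactic.RingSolver using (solve-∀)
  open import Data.Bool using (Bool; true)
  import Data.Bool.Properties as Bool
  open import Data.Fin as Fin using (Fin; zero; suc)
  import Data.Fin.Properties as Fin
  open import Data.List using (List; []; _∷_; [_]; map; allFin)
  open import Data.List.Relation.Unary.Any using (here; there; any?)
  open import Data.List.Relation.Unary.All using (All; []; _∷_)
  import Data.List.Relation.Unary.All as All
  open import Data.List.Membership.Propositional using (_∈_)
  import Data.List.Membership.Propositional.Properties as ∈
  open import Data.Product using (∃; _×_; _,_; proj₁; proj₂)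
  open import Data.Sum using (_⊎_; inj₁; inj₂)
  open import Data.Empty using (⊥-elim)
  open import Function using (_∘_; id)
  open import Relation.Nullary using (¬_; Dec; yes; no)
  open import Relation.Nullary.Decidable using (map′; _×-dec_)
  open import Relation.Binary.PropositionalEquality using (_≡_; refl; sym; trans; cong; cong₂; subst; _≗_)

  any∈? : {A : Set} {P : A → Set} (xs : List A) → (∀ x → x ∈ xs → Dec (P x)) →
          Dec (∃ λ x → x ∈ xs × P x)
  any∈? []       f = no λ { (_ , () , _) }
  any∈? (x ∷ xs) f with f x (here refl) | any∈? xs (λ y → f y ∘ there)
  ... | yes p | _                = yes (x , here refl , p)
  ... | no _  | yes (y , m , p)  = yes (y , there m , p)
  ... | no ¬p | no ¬q            = no λ { (_ , here refl , p) → ¬p p ; (y , there m , p) → ¬q (y , m , p) }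

  semilinear-map : ∀ {d} {P Q : Vecℤ d → Set} → (∀ x → P x → Q x) → (∀ x → Q x → P x) →
                   Semilinear P → Semilinear Q
  semilinear-map f g (ls , s , c) = ls , (λ m → f _ ∘ s m) , c ∘ g _

  semilinear-singleton : ∀ {d} (a : Vecℤ d) → Semilinear (_≗ a)
  semilinear-singleton a = [ a , [] ] ,
    (λ { (here refl) (y , nil f , e) i → trans (e i) (trans (cong (λ b → a i + b) (f i)) (ℤ.+-identityʳ (a i)))
       ; (here refl) (y , add () _ _ , e) }) ,
    λ e → _ , here refl , _ , nil {x = λ _ → 0ℤ} (λ _ → refl) , λ i → trans (e i) (sym (ℤ.+-identityʳ (a i)))

  semilinear-× : ∀ {d} {A : Set} {P : Vecℤ d → Set} → Dec A → Semilinear P → Semilinear (λ x → A × P x)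
  semilinear-× (yes a) = semilinear-map (λ _ p → a , p) (λ _ → proj₂)
  semilinear-× (no ¬a) _ = [] , (λ ()) , λ { (a , _) → ⊥-elim (¬a a) }

  semilinear-∃∈ : ∀ {d} {A : Set} {P : A → Vecℤ d → Set} → (∀ a → Semilinear (P a)) →
                  (xs : List A) → Semilinear (λ x → ∃ λ a → a ∈ xs × P a x)
  semilinear-∃∈ f []       = [] , (λ ()) , λ { (_ , () , _) }
  semilinear-∃∈ f (a ∷ xs) = semilinear-map
    (λ { x (inj₁ p) → a , here refl , p ; x (inj₂ (b , m , p)) → b , there m , p })
    (λ { x (_ , here refl , p) → inj₁ p ; x (b , there m , p) → inj₂ (b , m , p) })
    (semilinear-⊎ (f a) (semilinear-∃∈ f xs))

  +-cancelˡ-≤ : ∀ a {b c} → a + b ≤ a + c → b ≤ c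
  +-cancelˡ-≤ a {b} {c} p = begin
    b               ≡⟨ lemma a b ⟨
    - a + (a + b)   ≤⟨ ℤ.+-monoʳ-≤ (- a) p ⟩
    - a + (a + c)   ≡⟨ lemma a c ⟩
    c               ∎
    where
    open ℤ.≤-Reasoning
    lemma : ∀ a b → - a + (a + b) ≡ b
    lemma = solve-∀

  negPart : ℤ → ℕ
  negPart (+ _)    = 0
  negPart -[1+ n ] = suc n

  negPart-≥0 : ∀ z → 0ℤ ≤ + negPart z + z
  negPart-≥0 (+ n)    = +≤+ ℕ.z≤n
  negPart-≥0 -[1+ n ] = ℤ.≤-reflexive (sym (ℤ.+-inverseʳ (+ suc n)))

  module _ {d : ℕ} (v : Fin d → ℕ) (z : Vecℤ d) where

    -- The absolute value makes firing total. Its result matters only where the sum is nonnegative,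
    -- and there it is the largest successor that `Fires` allows.
    fired : Fin d → ℕ
    fired i = ∣ + v i + z i ∣

    fired-≡ : ∀ i → negPart (z i) ℕ.≤ v i → + fired i ≡ + v i + z i
    fired-≡ i p = ℤ.0≤i⇒+∣i∣≡i (ℤ.≤-trans (negPart-≥0 (z i)) (ℤ.+-monoˡ-≤ (z i) (+≤+ p)))

    fired-≥ : ∀ i m → negPart (z i) ℕ.+ m ℕ.≤ v i → m ℕ.≤ fired i
    fired-≥ i m p = ℤ.drop‿+≤+ (begin
      + m                        ≡⟨ ℤ.+-identityˡ (+ m) ⟨
      0ℤ + + m                   ≤⟨ ℤ.+-monoˡ-≤ (+ m) (negPart-≥0 (z i)) ⟩
      (+ negPart (z i) + z i) + + m ≡⟨ +-swapʳ (+ negPart (z i)) (z i) (+ m) ⟩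
      + (negPart (z i) ℕ.+ m) + z i ≤⟨ ℤ.+-monoˡ-≤ (z i) (+≤+ p) ⟩
      + v i + z i                ≡⟨ fired-≡ i (ℕ.≤-trans (ℕ.m≤m+n _ m) p) ⟨
      + fired i                  ∎)
      where open ℤ.≤-Reasoning

  module Solo {n d : ℕ} (es : Fin n → List (Edge n d)) where

    solo : Game n d
    solo q = es q , []

    infixr 5 _◂_
    data Walk : Fin n → Fin n → Set where
      []  : ∀ {q} → Walk q q
      _◂_ : ∀ {q e r} → e ∈ es q → Walk (tgt e) r → Walk q r

    total : ∀ {q r} → Walk q r → Vecℤ d
    total []            = λ _ → 0ℤ
    total (_◂_ {e = e} _ π) = eff e ⊞ total π

    _◂◂_ : ∀ {q r s} → Walk q r → Walk r s → Walk q s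
    []      ◂◂ ρ = ρ
    (m ◂ π) ◂◂ ρ = m ◂ (π ◂◂ ρ)

    total-++ : ∀ {q r s} (π : Walk q r) (ρ : Walk r s) → total (π ◂◂ ρ) ≗ total π ⊞ total ρ
    total-++ [] ρ i = sym (ℤ.+-identityˡ (total ρ i))
    total-++ (_◂_ {e = e} m π) ρ i =
      trans (cong (λ a → eff e i + a) (total-++ π ρ i)) (sym (ℤ.+-assoc (eff e i) (total π i) (total ρ i)))

    Eff : Fin n → Fin n → Vecℤ d → Set
    Eff q r x = ∃ λ (π : Walk q r) → x ≗ total π

    eff-⊕ : ∀ {q r s x} → (Eff q r ⊕ Eff r s) x → Eff q s x
    eff-⊕ (y , z , (π , e) , (ρ , f) , g) = π ◂◂ ρ ,
      λ i → trans (g i) (trans (cong₂ _+_ (e i) (f i)) (sym (total-++ π ρ i)))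

    -- Kleene's construction: walks whose inner states lie in the given list.
    Kl : List (Fin n) → Fin n → Fin n → Vecℤ d → Set
    Kl []       q r x = (q ≡ r × x ≗ λ _ → 0ℤ) ⊎ ∃ λ e → e ∈ es q × tgt e ≡ r × x ≗ eff e
    Kl (s ∷ ss) q r x = Kl ss q r x ⊎ (Kl ss q s ⊕ Star (Kl ss s s) ⊕ Kl ss s r) x

    kl-semilinear : ∀ ss q r → Semilinear (Kl ss q r)
    kl-semilinear [] q r = semilinear-⊎ (semilinear-× (q Fin.≟ r) (semilinear-singleton _))
      (semilinear-∃∈ (λ e → semilinear-× (tgt e Fin.≟ r) (semilinear-singleton (eff e))) (es q))
    kl-semilinear (s ∷ ss) q r = semilinear-⊎ (kl-semilinear ss q r)
      (semilinear-⊕ (kl-semilinear ss q s) (semilinear-⊕ (semilinear-star (kl-semilinear ss s s)) (kl-semilinear ss s r)))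

    kl-sound : ∀ ss {q r x} → Kl ss q r x → Eff q r x
    kl-sound [] (inj₁ (refl , e)) = [] , e
    kl-sound [] (inj₂ (e , m , refl , f)) = m ◂ [] , λ i → trans (f i) (sym (ℤ.+-identityʳ (eff e i)))
    kl-sound (s ∷ ss) (inj₁ k) = kl-sound ss k
    kl-sound (s ∷ ss) (inj₂ (x , y , a , (z , w , b , c , e) , f)) =
      eff-⊕ (x , y , kl-sound ss a , eff-⊕ (z , w , loops b , kl-sound ss c , e) , f)
      where
      loops : ∀ {x} → Star (Kl ss s s) x → Eff s s x
      loops (nil e)      = [] , e
      loops (cons p t e) = eff-⊕ (_ , _ , kl-sound ss p , loops t , e)

    kl-base : ∀ ss {q r x} → Kl [] q r x → Kl ss q r x
    kl-base []       = id
    kl-base (s ∷ ss) = inj₁ ∘ kl-base ss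

    -- If s heads the list, both walks are cut at their visits to s and the pieces form one star.
    -- Otherwise only the segments adjacent to the joint are merged, which avoid the head state, and
    -- they fall under the induction hypothesis.
    kl-trans : ∀ ss {q s r x} → s ∈ ss → (Kl ss q s ⊕ Kl ss s r) x → Kl ss q r x
    kl-trans (s ∷ ss) {q} {r = r} {x} (here refl) (y , z , p , p' , e) =
      let y₁ , y₂ , a , b , f = toˡ p
          z₁ , z₂ , c , g , h = toʳ p'
      in inj₂ (y₁ , (y₂ ⊞ z₁) ⊞ z₂ , a , (y₂ ⊞ z₁ , z₂ , star-++ b c (λ _ → refl) , g , λ _ → refl) ,
           λ i → trans (e i) (trans (cong₂ _+_ (f i) (h i)) (assoc (y₁ i) (y₂ i) (z₁ i) (z₂ i))))
      where
      assoc : ∀ a b c e → (a + b) + (c + e) ≡ a + ((b + c) + e)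
      assoc = solve-∀
      toˡ : ∀ {x} → Kl (s ∷ ss) q s x → (Kl ss q s ⊕ Star (Kl ss s s)) x
      toˡ {x} (inj₁ k) = x , (λ _ → 0ℤ) , k , nil (λ _ → refl) , λ i → sym (ℤ.+-identityʳ (x i))
      toˡ (inj₂ (u , v , k , (w , t , st , l , e) , f)) =
        u , v , k , star-++ st (cons {z = λ _ → 0ℤ} l (nil λ _ → refl) λ i → sym (ℤ.+-identityʳ (t i))) e , f
      toʳ : ∀ {x} → Kl (s ∷ ss) s r x → (Star (Kl ss s s) ⊕ Kl ss s r) x
      toʳ {x} (inj₁ k) = (λ _ → 0ℤ) , x , nil (λ _ → refl) , k , λ i → sym (ℤ.+-identityˡ (x i))
      toʳ (inj₂ (u , v , k , (w , t , st , l , e) , f)) =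
        u ⊞ w , t , cons k st (λ _ → refl) , l , λ i → trans (f i) (trans (cong (λ a → u i + a) (e i)) (sym (ℤ.+-assoc (u i) (w i) (t i))))
    kl-trans (s ∷ ss) (there m) (y , z , inj₁ p , inj₁ p' , e) = inj₁ (kl-trans ss m (y , z , p , p' , e))
    kl-trans (s ∷ ss) (there m) (y , z , inj₁ p , inj₂ (u , v , k , l , f) , e) =
      inj₂ (y ⊞ u , v , kl-trans ss m (y , u , p , k , λ _ → refl) , l ,
        λ i → trans (e i) (trans (cong (λ a → y i + a) (f i)) (sym (ℤ.+-assoc (y i) (u i) (v i)))))
    kl-trans (s ∷ ss) (there m) (y , z , inj₂ (u , v , k , (w , t , st , l , g) , f) , inj₁ p , e) =
      inj₂ (u , w ⊞ (t ⊞ z) , k , (w , t ⊞ z , st , kl-trans ss m (t , z , l , p , λ _ → refl) , λ _ → refl) ,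
        λ i → trans (e i) (trans (cong (_+ z i) (trans (f i) (cong (λ a → u i + a) (g i)))) (assoc (u i) (w i) (t i) (z i))))
      where
      assoc : ∀ a b c e → (a + (b + c)) + e ≡ a + (b + (c + e))
      assoc = solve-∀
    kl-trans (s ∷ ss) (there m) (y , z , inj₂ (u , v , k , (w , t , st , l , g) , f) , inj₂ (u' , v' , k' , (w' , t' , st' , l' , g') , f') , e) =
      inj₂ (u , (w ⊞ ((t ⊞ u') ⊞ w')) ⊞ t' , k ,
        (w ⊞ ((t ⊞ u') ⊞ w') , t' , star-++ st (cons (kl-trans ss m (t , u' , l , k' , λ _ → refl)) st' λ _ → refl) (λ _ → refl) , l' , λ _ → refl) ,
        λ i → trans (e i) (trans (cong₂ _+_ (trans (f i) (cong (λ a → u i + a) (g i))) (trans (f' i) (cong (λ a → u' i + a) (g' i))))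
                (assoc (u i) (w i) (t i) (u' i) (w' i) (t' i))))
      where
      assoc : ∀ a b c e f g → (a + (b + c)) + (e + (f + g)) ≡ a + ((b + ((c + e) + f)) + g)
      assoc = solve-∀

    kl-complete : ∀ {q r} (π : Walk q r) {x} → x ≗ total π → Kl (allFin n) q r x
    kl-complete [] e = kl-base (allFin n) (inj₁ (refl , e))
    kl-complete (_◂_ {e = e} m π) f = kl-trans (allFin n) (∈.∈-allFin (tgt e))
      (eff e , total π , kl-base (allFin n) (inj₂ (e , m , refl , λ _ → refl)) , kl-complete π (λ _ → refl) , f)

    eff-semilinear : ∀ q r → Semilinear (Eff q r)
    eff-semilinear q r = semilinear-map (λ _ → kl-sound (allFin n)) (λ { _ (π , e) → kl-complete π e })
      (kl-semilinear (allFin n) q r)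

    -- A linear set contains its base, so a semilinear set is empty exactly if its list is.
    walk? : ∀ q r → Dec (Walk q r)
    walk? q r with eff-semilinear q r
    ... | []     , _ , c = no λ π → absurd (c (π , λ _ → refl))
      where
      absurd : ∀ {P : Lin → Set} → ¬ ∃ λ l → l ∈ [] × P l
      absurd (_ , () , _)
    ... | (l ∷ _) , s , _ = yes (proj₁ (s (here refl) (_ , nil {x = λ _ → 0ℤ} (λ _ → refl) , λ _ → refl)))

    Cycle : Fin n → Edge n d → Set
    Cycle s e = acc e ≡ true × ∃ λ x → (∃ λ (π : Walk (tgt e) s) → x ≗ eff e ⊞ total π) × Pos x

    Lasso : Fin n → Set
    Lasso q = ∃ λ s → Walk q s × ∃ λ e → e ∈ es s × Cycle s e

    -- The state and the accepting edge are fixed so that two cycles can be concatenated; this gives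
    -- the closure under addition demanded by `semilinear-dec`.
    cycle? : ∀ s e → e ∈ es s → Dec (Cycle s e)
    cycle? s e m = (acc e Bool.≟ true) ×-dec semilinear-dec
      (semilinear-map (λ { x (y , z , p , (π , q) , f) → π , λ i → trans (f i) (cong₂ _+_ (p i) (q i)) })
                      (λ { x (π , p) → eff e , total π , (λ _ → refl) , (π , λ _ → refl) , p })
                      (semilinear-⊕ (semilinear-singleton (eff e)) (eff-semilinear (tgt e) s)))
      λ { {x} {y} {z} (π , p) (ρ , q) f → π ◂◂ (m ◂ ρ) , λ i →
          trans (f i) (trans (cong₂ _+_ (p i) (q i)) (trans (ℤ.+-assoc (eff e i) (total π i) _)
            (cong (λ a → eff e i + a) (sym (total-++ π (m ◂ ρ) i))))) }

    lasso? : ∀ q → Dec (Lasso q)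
    lasso? q = Fin.any? λ s → walk? q s ×-dec any∈? (es s) (cycle? s)

    -- An overestimate that ignores all gains, so that it suffices at every prefix of the walk.
    cost : ∀ {q r} → Walk q r → Fin d → ℕ
    cost []                = λ _ → 0
    cost (_◂_ {e = e} _ π) = λ i → negPart (eff e i) ℕ.+ cost π i

    cost-≥0 : ∀ {q r} (π : Walk q r) i → 0ℤ ≤ + cost π i + total π i
    cost-≥0 [] i = ℤ.≤-refl
    cost-≥0 (_◂_ {e = e} _ π) i = ℤ.≤-trans (+-≥0 (negPart-≥0 (eff e i)) (cost-≥0 π i))
      (ℤ.≤-reflexive (interchange (+ negPart (eff e i)) (eff e i) (+ cost π i) (total π i)))

    lasso⇒win : ∀ {q} → Lasso q → UWin solo q
    lasso⇒win {q} (s , ρ , e , m , a , x , (π , f) , pos) =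
      (λ i → C i ℕ.+ cost ρ i) , good⇒win solo good
        (ρ , (λ i → ℕ.m≤n+m _ (C i)) , λ i → begin
          + C i                              ≡⟨ ℤ.+-identityʳ (+ C i) ⟨
          + C i + 0ℤ                         ≤⟨ ℤ.+-monoʳ-≤ (+ C i) (cost-≥0 ρ i) ⟩
          + C i + (+ cost ρ i + total ρ i)   ≡⟨ ℤ.+-assoc (+ C i) (+ cost ρ i) (total ρ i) ⟨
          + (C i ℕ.+ cost ρ i) + total ρ i   ∎)
      where
      open ℤ.≤-Reasoning
      -- The credit for one full turn of the cycle; a turn of effect ≥ 0 returns at least this much.
      C : Fin d → ℕ
      C i = negPart (eff e i) ℕ.+ cost π i
      -- A walk to s that can be afforded and arrives with credit C.
      Z : Pred n d
      Z r v = ∃ λ (ρ : Walk r s) → cost ρ ≼ v × (∀ i → + C i ≤ + v i + total ρ i)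
      turn : ∀ {v} → C ≼ v → Attr solo Z s v
      turn {v} c = node λ { _ (here refl) → e , m , fired v (eff e) ,
        (λ i → ℤ.≤-reflexive (fired-≡ v (eff e) i (ℕ.≤-trans (ℕ.m≤m+n _ _) (c i)))) ,
        inj₁ (a , π , (λ i → fired-≥ v (eff e) i _ (c i)) , λ i → begin
          + C i                                ≤⟨ +≤+ (c i) ⟩
          + v i                                ≡⟨ ℤ.+-identityʳ (+ v i) ⟨
          + v i + 0ℤ                           ≤⟨ ℤ.+-monoʳ-≤ (+ v i) (pos i) ⟩
          + v i + x i                          ≡⟨ cong (λ b → + v i + b) (f i) ⟩
          + v i + (eff e i + total π i)        ≡⟨ ℤ.+-assoc (+ v i) (eff e i) (total π i) ⟨
          (+ v i + eff e i) + total π i        ≡⟨ cong (_+ total π i) (fired-≡ v (eff e) i (ℕ.≤-trans (ℕ.m≤m+n _ _) (c i))) ⟨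
          + fired v (eff e) i + total π i      ∎) }
      run : ∀ {r v} (ρ : Walk r s) → cost ρ ≼ v → (∀ i → + C i ≤ + v i + total ρ i) → Attr solo Z r v
      run [] _ c = turn λ i → ℤ.drop‿+≤+ (ℤ.≤-trans (c i) (ℤ.≤-reflexive (ℤ.+-identityʳ _)))
      run {v = v} (_◂_ {e = e'} m ρ) k c = node λ { _ (here refl) → e' , m , fired v (eff e') ,
        (λ i → ℤ.≤-reflexive (fired-≡ v (eff e') i (ℕ.≤-trans (ℕ.m≤m+n _ _) (k i)))) ,
        inj₂ (run ρ (λ i → fired-≥ v (eff e') i _ (k i)) λ i → begin
          + C i                              ≤⟨ c i ⟩
          + v i + (eff e' i + total ρ i)     ≡⟨ ℤ.+-assoc (+ v i) (eff e' i) (total ρ i) ⟨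
          (+ v i + eff e' i) + total ρ i     ≡⟨ cong (_+ total ρ i) (fired-≡ v (eff e') i (ℕ.≤-trans (ℕ.m≤m+n _ _) (k i))) ⟨
          + fired v (eff e') i + total ρ i   ∎) }
      good : Good solo Z
      good r v (ρ , k , c) = run ρ k c

    -- A path that ends with an accepting edge. Since moves are lossy, the final counters are only
    -- bounded from above by its effect.
    Link : Fin n → (Fin d → ℕ) → Fin n → (Fin d → ℕ) → Set
    Link q u r v = ∃ λ s → ∃ λ (π : Walk q s) → ∃ λ e → e ∈ es s × acc e ≡ true × tgt e ≡ r ×
      (∀ i → + v i ≤ + u i + (total π i + eff e i))

    follow : ∀ {X r v} → Attr solo X r v → ∃ λ r' → ∃ λ v' → X r' v' × Link r v r' v'
    follow {X} {r} {v} (node f) = go (f _ (here refl))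
      where
      go : Move X (Attr solo X) (es r) v → ∃ λ r' → ∃ λ v' → X r' v' × Link r v r' v'
      go (e , m , v' , g , inj₁ (a , x)) = _ , v' , x , r , [] , e , m , a , refl ,
        λ i → ℤ.≤-trans (g i) (ℤ.≤-reflexive (cong (λ b → + v i + b) (sym (ℤ.+-identityˡ (eff e i)))))
      go (e , m , v' , g , inj₂ t) = let r' , w , x , s , π , e' , m' , a , p , h = follow t in
        r' , w , x , s , m ◂ π , e' , m' , a , p , λ i → ℤ.≤-trans (h i)
          (ℤ.≤-trans (ℤ.+-monoˡ-≤ (total π i + eff e' i) (g i))
            (ℤ.≤-reflexive (assoc (+ v i) (eff e i) (total π i) (eff e' i))))
        where
        assoc : ∀ a b c e → (a + b) + (c + e) ≡ a + ((b + c) + e)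
        assoc = solve-∀

    link-trans : ∀ {q u r v s w} → Link q u r v → Link r v s w → Link q u s w
    link-trans {u = u} {v = v} {w = w} (a , π , e , m , _ , refl , g) (b , ρ , e' , m' , ac , p , h) =
      b , π ◂◂ (m ◂ ρ) , e' , m' , ac , p , λ i → begin
        + w i                                                         ≤⟨ h i ⟩
        + v i + (total ρ i + eff e' i)                                ≤⟨ ℤ.+-monoˡ-≤ _ (g i) ⟩
        (+ u i + (total π i + eff e i)) + (total ρ i + eff e' i)      ≡⟨ assoc (+ u i) (total π i) (eff e i) (total ρ i) (eff e' i) ⟩
        + u i + ((total π i + (eff e i + total ρ i)) + eff e' i)      ≡⟨ cong (λ b → + u i + (b + eff e' i)) (total-++ π (m ◂ ρ) i) ⟨
        + u i + (total (π ◂◂ (m ◂ ρ)) i + eff e' i)                   ∎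
      where
      open ℤ.≤-Reasoning
      assoc : ∀ a b c e f → (a + (b + c)) + (e + f) ≡ a + ((b + (c + e)) + f)
      assoc = solve-∀

    -- Losses can only lower v, so u ≼ v forces the effect of the connecting path to be nonnegative.
    close : ∀ {q r u v} → Walk q r → Link r u r v → u ≼ v → Lasso q
    close {u = u} {v} ρ (s , π , e , m , a , refl , g) le =
      s , ρ ◂◂ π , e , m , a , eff e ⊞ total π , (π , λ _ → refl) , λ i → +-cancelˡ-≤ (+ u i) (begin
        + u i + 0ℤ                     ≡⟨ ℤ.+-identityʳ (+ u i) ⟩
        + u i                          ≤⟨ +≤+ (le i) ⟩
        + v i                          ≤⟨ g i ⟩
        + u i + (total π i + eff e i)  ≡⟨ cong (λ b → + u i + b) (ℤ.+-comm (total π i) (eff e i)) ⟩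
        + u i + (eff e i + total π i)  ∎)
      where open ℤ.≤-Reasoning

    module _ {q : Fin n} {X : Pred n d} (good : Good solo X) where

      Past : Fin n → (Fin d → ℕ) → Conf n d → Set
      Past r v (p , u) = Walk q p × Link p u r v

      dominated : ∀ {r v} L → All (Past r v) L → ↑ L r v → Lasso q
      dominated (_ ∷ _) ((ρ , l) ∷ _)  (here (refl , le)) = close ρ l le
      dominated (_ ∷ L) (_ ∷ ps)       (there m)          = dominated L ps m

      -- The good set is followed from visit to visit, each past configuration linked to the current
      -- one; by Dickson's lemma one of them is eventually dominated.
      chase : ∀ L → Term _⊑_ L → ∀ {r v} → X r v → Walk q r → All (Past r v) L → Lasso q
      chase L (term T) {r} {v} x ρ ps with ↑? L r v
      ... | yes dom = dominated L ps dom
      ... | no ¬dom = let r' , v' , x' , l@(s , π , e , m , _ , p , _) = follow (good r v x) in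
        chase ((r , v) ∷ L) (T (r , v) ¬dom) x' (subst (Walk q) p (ρ ◂◂ (π ◂◂ (m ◂ []))))
          ((ρ , l) ∷ All.map (λ { (ρ' , l') → ρ' , link-trans l' l }) ps)

    win⇒lasso : ∀ {q} → UWin solo q → Lasso q
    win⇒lasso (v , w) = chase (win⇒attr solo) [] dickson w [] []

    solo? : ∀ q → Dec (UWin solo q)
    solo? q = map′ lasso⇒win win⇒lasso (lasso? q)

-- Unknown initial credit: splitting the options of a state

module UnknownCredit where

  open AlmostFull
  open Games
  open Cones
  open OnePlayer
  open import Data.Nat as ℕ using (ℕ; zero; suc)
  import Data.Nat.Properties as ℕ
  open import Data.Integer using (ℤ; +_; _+_; _≤_; +≤+)
  import Data.Integer.Properties as ℤ
  open import Data.Fin as Fin using (Fin; zero; suc)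
  import Data.Fin.Properties as Fin
  open import Data.List using (List; []; _∷_; allFin)
  open import Data.List.Relation.Unary.Any using (here; there)
  open import Data.List.Membership.Propositional using (_∈_)
  import Data.List.Membership.Propositional.Properties as ∈
  open import Data.Product using (∃; _×_; _,_; proj₁; proj₂)
  open import Data.Sum using (_⊎_; inj₁; inj₂)
  open import Data.Empty using (⊥-elim)
  open import Function using (_∘_; id)
  open import Relation.Nullary using (¬_; Dec; yes; no)
  open import Relation.Nullary.Decidable using (map′; _×-dec_)
  open import Relation.Binary.PropositionalEquality using (_≡_; _≢_; refl; cong; subst)

  module _ {n d : ℕ} where

    update : Game n d → Fin n → List (Edge n d) × List (List (Edge n d)) → Game n d
    update δ s x q with q Fin.≟ s
    ... | yes _ = x
    ... | no  _ = δ q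

    update-≡ : ∀ δ s x → update δ s x s ≡ x
    update-≡ δ s x with s Fin.≟ s
    ... | yes _ = refl
    ... | no s≢s = ⊥-elim (s≢s refl)

    update-≢ : ∀ δ s x {q} → q ≢ s → update δ s x q ≡ δ q
    update-≢ δ s x {q} q≢s with q Fin.≟ s
    ... | yes q≡s = ⊥-elim (q≢s q≡s)
    ... | no _    = refl

    win-map : ∀ {δ δ' : Game n d} → (∀ q o → o ∈ options δ' q → o ∈ options δ q) →
              ∀ {q v} → Win δ q v → Win δ' q v
    win-map i (L , g , m) = L , (λ q v m' → attr-map i (λ _ _ → id) (g q v m')) , m

    module Split (δ : Game n d) (s : Fin n) {o o₂ : List (Edge n d)} {os : List (List (Edge n d))}
                 (eq : δ s ≡ (o , o₂ ∷ os)) where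

      δ₁ δ₂ : Game n d
      δ₁ = update δ s (o , [])
      δ₂ = update δ s (o₂ , os)

      ⊆₁ : ∀ q c → c ∈ options δ₁ q → c ∈ options δ q
      ⊆₁ q c m with q Fin.≟ s
      ⊆₁ q c (here refl) | yes refl rewrite eq = here refl
      ⊆₁ q c (there ())  | yes refl
      ... | no _ = m

      ⊆₂ : ∀ q c → c ∈ options δ₂ q → c ∈ options δ q
      ⊆₂ q c m with q Fin.≟ s
      ... | yes refl rewrite eq = there m
      ... | no _ = m

      same₁ : ∀ {q c} → q ≢ s → c ∈ options δ q → c ∈ options δ₁ q
      same₁ q≢s m rewrite update-≢ δ s (o , []) q≢s = m

      same₂ : ∀ {q c} → q ≢ s → c ∈ options δ q → c ∈ options δ₂ q
      same₂ q≢s m rewrite update-≢ δ s (o₂ , os) q≢s = m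

      cover : ∀ {c} → c ∈ options δ s → c ∈ options δ₁ s ⊎ c ∈ options δ₂ s
      cover m rewrite eq | update-≡ δ s (o , []) | update-≡ δ s (o₂ , os) with m
      ... | here refl = inj₁ (here refl)
      ... | there m'  = inj₂ m'

      infixl 6 _∔_
      _∔_ : (Fin d → ℕ) → (Fin d → ℕ) → Fin d → ℕ
      (u ∔ v) i = u i ℕ.+ v i

      -- Two plays run in parallel and share the counters; one of them waits at s.
      Y : Pred n d
      Y r v = ∃ λ v₁ → ∃ λ v₂ → v₁ ∔ v₂ ≼ v ×
        ((Win δ₁ r v₁ × Win δ₂ s v₂) ⊎ (Win δ₁ s v₁ × Win δ₂ r v₂))

      fires-left : ∀ {v₁ v₂ v v' z} → v₁ ∔ v₂ ≼ v → Fires v₁ z v' → Fires v z (v' ∔ v₂)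
      fires-left {v₁} {v₂} {v} {v'} {z} le f i = begin
        + v' i + + v₂ i          ≤⟨ ℤ.+-monoˡ-≤ (+ v₂ i) (f i) ⟩
        (+ v₁ i + z i) + + v₂ i  ≡⟨ +-swapʳ (+ v₁ i) (z i) (+ v₂ i) ⟩
        (+ v₁ i + + v₂ i) + z i  ≤⟨ ℤ.+-monoˡ-≤ (z i) (+≤+ (le i)) ⟩
        + v i + z i              ∎
        where open ℤ.≤-Reasoning

      fires-right : ∀ {v₁ v₂ v v' z} → v₁ ∔ v₂ ≼ v → Fires v₂ z v' → Fires v z (v₁ ∔ v')
      fires-right {v₁} {v₂} {v} {v'} {z} le f i =
        subst (λ a → + a ≤ + v i + z i) (ℕ.+-comm (v' i) (v₁ i))
          (fires-left {v₂} {v₁} {v' = v'} {z} (λ j → subst (ℕ._≤ v j) (ℕ.+-comm (v₁ j) (v₂ j)) (le j)) f i)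

      mutual
        -- Induction on the pair of trees, one of which shrinks with every move. Away from s the
        -- running play moves on; at s both plays are present and the environment's option belongs
        -- to one of the two games, which selects the play that answers. Each move is charged to the
        -- credit of its own play.
        left : ∀ {r v₁ v₂ v} → Attr δ₁ (Win δ₁) r v₁ → Attr δ₂ (Win δ₂) s v₂ → v₁ ∔ v₂ ≼ v → Attr δ Y r v
        left {r} (node f) (node g) le = node λ c m → choose c m (r Fin.≟ s)
          where
          choose : ∀ c → c ∈ options δ r → Dec (r ≡ s) → Move Y (Attr δ Y) c _
          choose c m (no r≢s)   = advance₁ (f c (same₁ r≢s m)) (node g) le
          choose c m (yes refl) with cover m
          ... | inj₁ m₁ = advance₁ (f c m₁) (node g) le
          ... | inj₂ m₂ = advance₂ (node f) (g c m₂) le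

        right : ∀ {r v₁ v₂ v} → Attr δ₁ (Win δ₁) s v₁ → Attr δ₂ (Win δ₂) r v₂ → v₁ ∔ v₂ ≼ v → Attr δ Y r v
        right {r} (node f) (node g) le = node λ c m → choose c m (r Fin.≟ s)
          where
          choose : ∀ c → c ∈ options δ r → Dec (r ≡ s) → Move Y (Attr δ Y) c _
          choose c m (no r≢s)   = advance₂ (node f) (g c (same₂ r≢s m)) le
          choose c m (yes refl) with cover m
          ... | inj₁ m₁ = advance₁ (f c m₁) (node g) le
          ... | inj₂ m₂ = advance₂ (node f) (g c m₂) le

        advance₁ : ∀ {c v₁ v₂ v} → Move (Win δ₁) (Attr δ₁ (Win δ₁)) c v₁ → Attr δ₂ (Win δ₂) s v₂ →
                   v₁ ∔ v₂ ≼ v → Move Y (Attr δ Y) c v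
        -- A visit in either play is a visit of the combined play. The waiting play may be in the
        -- middle of its tree, which `attr⇒win` turns back into a winning configuration.
        advance₁ {v₂ = v₂} (e , m , v' , h , inj₁ (a , x)) t le =
          e , m , v' ∔ v₂ , fires-left {v' = v'} {eff e} le h , inj₁ (a , v' , v₂ , ≼-refl , inj₁ (x , attr⇒win δ₂ t))
        advance₁ {v₂ = v₂} (e , m , v' , h , inj₂ t₁) t le =
          e , m , v' ∔ v₂ , fires-left {v' = v'} {eff e} le h , inj₂ (left t₁ t ≼-refl)

        advance₂ : ∀ {c v₁ v₂ v} → Attr δ₁ (Win δ₁) s v₁ → Move (Win δ₂) (Attr δ₂ (Win δ₂)) c v₂ →
                   v₁ ∔ v₂ ≼ v → Move Y (Attr δ Y) c v
        advance₂ {v₁ = v₁} t (e , m , v' , h , inj₁ (a , x)) le =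
          e , m , v₁ ∔ v' , fires-right {v' = v'} {eff e} le h , inj₁ (a , v₁ , v' , ≼-refl , inj₂ (attr⇒win δ₁ t , x))
        advance₂ {v₁ = v₁} t (e , m , v' , h , inj₂ t₂) le =
          e , m , v₁ ∔ v' , fires-right {v' = v'} {eff e} le h , inj₂ (right t t₂ ≼-refl)

      good-Y : Good δ Y
      good-Y r v (v₁ , v₂ , le , inj₁ (a , b)) = left (win⇒attr δ₁ _ _ a) (win⇒attr δ₂ _ _ b) le
      good-Y r v (v₁ , v₂ , le , inj₂ (a , b)) = right (win⇒attr δ₁ _ _ a) (win⇒attr δ₂ _ _ b) le

      -- If s is lost with every credit, a winning play of the restricted game never enters it, so
      -- the missing options at s are never met.
      avoid : ∀ {δ'} → (∀ {q c} → q ≢ s → c ∈ options δ q → c ∈ options δ' q) →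
              ¬ UWin δ' s → Good δ (Win δ')
      avoid {δ'} same lose q v w = go (win⇒attr δ' q v w)
        where
        go : ∀ {q v} → Attr δ' (Win δ') q v → Attr δ (Win δ') q v
        move : ∀ {c v} → Move (Win δ') (Attr δ' (Win δ')) c v → Move (Win δ') (Attr δ (Win δ')) c v
        go {q} t@(node f) = node λ c m → move (f c (same (λ { refl → lose (_ , attr⇒win δ' t) }) m))
        move (e , m , v' , h , inj₁ x) = e , m , v' , h , inj₁ x
        move (e , m , v' , h , inj₂ t) = e , m , v' , h , inj₂ (go t)

      -- When both parts can be won from s, the play for the second game starts out waiting there,
      -- and its credit is added to that of the first.
      join : Dec (UWin δ₁ s) → Dec (UWin δ₂ s) → ∀ {q} → UWin δ₁ q → UWin δ₂ q → UWin δ q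
      join (no l)        _             (v , w) _ = v , good⇒win δ (avoid same₁ l) w
      join (yes _)       (no l)        _ (v , w) = v , good⇒win δ (avoid same₂ l) w
      join (yes _)       (yes (u , x)) (v , w) _ = v ∔ u , good⇒win δ good-Y (v , u , ≼-refl , inj₁ (w , x))

      split? : (∀ q → Dec (UWin δ₁ q)) → (∀ q → Dec (UWin δ₂ q)) → ∀ q → Dec (UWin δ q)
      split? D₁ D₂ q = map′ (λ { (a , b) → join (D₁ s) (D₂ s) a b })
        (λ { (v , w) → (v , win-map ⊆₁ w) , (v , win-map ⊆₂ w) }) (D₁ q ×-dec D₂ q)

    Single : Game n d → Fin n → Set
    Single δ q = proj₂ (δ q) ≡ []

    -- Recursion on the states left to treat and, for the current one, on its number of options: the
    -- first game of a split is finished at s, the second has one option fewer there.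
    uwin?-on : (todo : List (Fin n)) (δ : Game n d) → (∀ q → q ∈ todo ⊎ Single δ q) →
               ∀ q → Dec (UWin δ q)
    uwin?-on [] δ h q = map′ (λ { (v , w) → v , win-map to w }) (λ { (v , w) → v , win-map from w }) (solo? q)
      where
      open Solo (proj₁ ∘ δ)
      to : ∀ q o → o ∈ options δ q → o ∈ options solo q
      to q o m with h q
      ... | inj₂ e rewrite e = m
      from : ∀ q o → o ∈ options solo q → o ∈ options δ q
      from q o (here p) = here p
    uwin?-on (s ∷ todo) δ h = elim (proj₁ (δ s)) (proj₂ (δ s)) δ refl h
      where
      elim : ∀ o os (δ : Game n d) → δ s ≡ (o , os) → (∀ q → q ∈ s ∷ todo ⊎ Single δ q) → ∀ q → Dec (UWin δ q)
      elim o [] δ eq h = uwin?-on todo δ λ q → settle (h q)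
        where
        settle : ∀ {q} → q ∈ s ∷ todo ⊎ Single δ q → q ∈ todo ⊎ Single δ q
        settle (inj₁ (here refl)) = inj₂ (cong proj₂ eq)
        settle (inj₁ (there m))   = inj₁ m
        settle (inj₂ e)           = inj₂ e
      elim o (o₂ ∷ os) δ eq h = split? (uwin?-on todo δ₁ rest) (elim o₂ os δ₂ (update-≡ δ s _) other)
        where
        open Split δ s eq
        rest : ∀ q → q ∈ todo ⊎ Single δ₁ q
        rest q with q Fin.≟ s | h q
        ... | yes _ | _                  = inj₂ refl
        ... | no ¬e | inj₁ (here e)      = ⊥-elim (¬e e)
        ... | no _  | inj₁ (there m)     = inj₁ m
        ... | no _  | inj₂ e             = inj₂ e
        other : ∀ q → q ∈ s ∷ todo ⊎ Single δ₂ q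
        other q with q Fin.≟ s | h q
        ... | yes e | _      = inj₁ (here e)
        ... | no _  | inj₁ m = inj₁ m
        ... | no _  | inj₂ e = inj₂ e

    uwin? : (δ : Game n d) → ∀ q → Dec (UWin δ q)
    uwin? δ = uwin?-on (allFin n) δ λ q → inj₁ (∈.∈-allFin q)

-- Known initial credit: induction on the set of known counters

module KnownCredit where

  open AlmostFull
  open Games
  open Cones
  open OnePlayer
  open UnknownCredit
  open import Data.Nat as ℕ using (ℕ; zero; suc; z≤n; _^_)
  import Data.Nat.Properties as ℕ
  open import Data.Integer using (ℤ; +_; _+_; _≤_; +≤+; 0ℤ)
  import Data.Integer.Properties as ℤ
  open import Data.Bool using (true)
  open import Data.Fin as Fin using (Fin; zero; suc; toℕ; fromℕ<; combine; remQuot; finToFun; funToFin)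
  import Data.Fin.Properties as Fin
  open import Data.Fin.Subset using (Subset; _-_; ⊤) renaming (_∈_ to _∈ₛ_; _∉_ to _∉ₛ_; ∣_∣ to card)
  import Data.Fin.Subset.Properties as Subset
  open import Data.List using (List; []; _∷_; [_]; _++_; map; concatMap; allFin)
  open import Data.List.Relation.Unary.Any using (Any; here; there; any?)
  import Data.List.Relation.Unary.Any as Any
  import Data.List.Relation.Unary.Any.Properties as Any
  open import Data.List.Relation.Unary.All using (All; []; _∷_)
  import Data.List.Relation.Unary.All as All
  import Data.List.Relation.Unary.All.Properties as All
  open import Data.List.Membership.Propositional using (_∈_; find; lose)
  import Data.List.Membership.Propositional.Properties as ∈
  open import Data.Product using (∃; _×_; _,_; proj₁; proj₂)
  open import Data.Sum using (_⊎_; inj₁; inj₂; [_,_]′)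
  open import Data.Unit using (tt) renaming (⊤ to Unit)
  open import Data.Empty using (⊥-elim)
  open import Function using (_∘_; id)
  open import Relation.Nullary using (¬_; Dec; yes; no)
  open import Relation.Nullary.Decidable using (map′; _×-dec_; _→-dec_)
  open import Relation.Binary.PropositionalEquality using (_≡_; refl; sym; trans; cong; subst)

  module _ {d : ℕ} where

    infix 4 _≼[_]_
    _≼[_]_ : (Fin d → ℕ) → Subset d → (Fin d → ℕ) → Set
    u ≼[ I ] v = ∀ i → i ∈ₛ I → u i ℕ.≤ v i

    -- Coordinates outside I are ignored: for them the credit is unknown and may be chosen large
    -- enough.
    ⇑ : ∀ {n} → Subset d → List (Conf n d) → Pred n d
    ⇑ I L q v = Any (λ b → proj₁ b ≡ q × proj₂ b ≼[ I ] v) L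

    ⇑? : ∀ {n} I (L : List (Conf n d)) q v → Dec (⇑ I L q v)
    ⇑? I L q v = any? (λ b → (proj₁ b Fin.≟ q) ×-dec Fin.all? λ i → (i Subset.∈? I) →-dec (proj₂ b i ℕ.≤? v i)) L

    ⇑-mono : ∀ {n I} {L L' : List (Conf n d)} → (∀ q v → ↑ L q v → ↑ L' q v) →
             ∀ {q v} → ⇑ I L q v → ⇑ I L' q v
    ⇑-mono i m = let (q , u) , b∈ , (e , le) = find m in
      Any.map (λ { (e' , le') → trans e' e , λ j j∈ → ℕ.≤-trans (le' j) (le j j∈) }) (i q u (∈⇒↑ b∈))

    ⇑-up : ∀ {n I} {L : List (Conf n d)} {q u v} → u ≼[ I ] v → ⇑ I L q u → ⇑ I L q v
    ⇑-up p = Any.map λ { (e , le) → e , λ j j∈ → ℕ.≤-trans (le j j∈) (p j j∈) }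

    mix : {A : Set} → Subset d → (Fin d → A) → (Fin d → A) → Fin d → A
    mix I f g i with i Subset.∈? I
    ... | yes _ = f i
    ... | no  _ = g i

    mix-elim : ∀ {A : Set} {I} {f g : Fin d → A} {i} (P : A → Set) →
               (i ∈ₛ I → P (f i)) → (i ∉ₛ I → P (g i)) → P (mix I f g i)
    mix-elim {I = I} {i = i} P p q with i Subset.∈? I
    ... | yes i∈ = p i∈
    ... | no  i∉ = q i∉

    mix-∈ : ∀ {A : Set} {I} {f g : Fin d → A} {i} → i ∈ₛ I → mix I f g i ≡ f i
    mix-∈ {I = I} {i = i} i∈ with i Subset.∈? I
    ... | yes _ = refl
    ... | no i∉ = ⊥-elim (i∉ i∈)

    mix-∉ : ∀ {A : Set} {I} {f g : Fin d → A} {i} → i ∉ₛ I → mix I f g i ≡ g i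
    mix-∉ {I = I} {i = i} i∉ with i Subset.∈? I
    ... | yes i∈ = ⊥-elim (i∉ i∈)
    ... | no _ = refl

  bounded : ∀ {d} (u : Fin d → ℕ) → ∃ λ B → ∀ i → u i ℕ.≤ B
  bounded {zero}  u = 0 , λ ()
  bounded {suc d} u = let B , p = bounded (u ∘ suc) in u zero ℕ.⊔ B ,
    λ { zero → ℕ.m≤m⊔n _ _ ; (suc i) → ℕ.≤-trans (p i) (ℕ.m≤n⊔m (u zero) B) }

  bounded-list : ∀ {n d} (L : List (Conf n d)) → ∃ λ B → ∀ {b} → b ∈ L → ∀ i → proj₂ b i ℕ.≤ B
  bounded-list []            = 0 , λ ()
  bounded-list ((q , u) ∷ L) = let B , p = bounded u ; C , r = bounded-list L in B ℕ.⊔ C ,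
    λ { (here refl) i → ℕ.≤-trans (p i) (ℕ.m≤m⊔n _ _) ; (there m) i → ℕ.≤-trans (r m i) (ℕ.m≤n⊔m B C) }

  -- The game on states (q , a) with a ∈ [0 , B]^I, in which only the counters
  -- outside I remain counters.  K is a list of winning configurations that covers
  -- every winning configuration with a counter in I above B; leaving the box is
  -- therefore winning iff it leads above an element of K.
  module Capped {n d : ℕ} (δ : Game n d) (I : Subset d) (K : List (Conf n d)) (K-win : All (holds (Win δ)) K)
                (B : ℕ) (K≤B : ∀ {b} → b ∈ K → ∀ i → proj₂ b i ℕ.≤ B)
                (cover : ∀ i → i ∈ₛ I → ∀ q v → Win δ q v → ⇑ (I - i) K q v) where

    -- `cover i` leaves coordinate i out of the comparison; as a i exceeds B, which bounds all
    -- entries of K, that coordinate holds as well.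
    big : ∀ {q v a} → Win δ q v → v ≼[ I ] a → (∀ i → i ∉ₛ I → a i ≡ 0) →
          ¬ (∀ i → a i ℕ.< suc B) → ⇑ I K q a
    big {q} {v} {a} w le zeros ¬small =
      let i , ¬lt = Fin.¬∀⟶∃¬ d _ (λ i → a i ℕ.<? suc B) ¬small
          B<a = ℕ.≮⇒≥ ¬lt
          i∈I : i ∈ₛ I
          i∈I = inside i B<a
          (r , u) , b∈ , e , le' = find (cover i i∈I q (mix I a v) (win-up δ
            (λ j → mix-elim {f = a} {v} (v j ℕ.≤_) (le j) (λ _ → ℕ.≤-refl)) w))
      in lose b∈ (e , λ j j∈ → below i B<a b∈ j j∈ (subst (u j ℕ.≤_) (mix-∈ {f = a} {v} j∈) ∘ le' j))
      where
      inside : ∀ i → suc B ℕ.≤ a i → i ∈ₛ I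
      inside i p with i Subset.∈? I
      ... | yes i∈ = i∈
      ... | no i∉ with () ← subst (suc B ℕ.≤_) (zeros i i∉) p
      below : ∀ i → suc B ℕ.≤ a i → ∀ {b} → b ∈ K → ∀ j → j ∈ₛ I → (j ∈ₛ I - i → proj₂ b j ℕ.≤ a j) → proj₂ b j ℕ.≤ a j
      below i p b∈ j j∈ f with j Fin.≟ i
      ... | yes refl = ℕ.≤-trans (K≤B b∈ j) (ℕ.≤-trans (ℕ.n≤1+n B) p)
      ... | no j≢i   = f (Subset.x∈p∧x≢y⇒x∈p-y j∈ j≢i)

    Inner : Set
    Inner = Fin (n ℕ.* suc B ^ d)

    state : Inner → Fin n
    state y = proj₁ (remQuot (suc B ^ d) y)

    val : Inner → Fin d → ℕ
    val y i = toℕ (finToFun {suc B} {d} (proj₂ (remQuot {n} (suc B ^ d) y)) i)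

    encode : Fin n → (a : Fin d → ℕ) → (∀ i → a i ℕ.< suc B) → Inner
    encode q a a< = combine q (funToFin (λ i → fromℕ< (a< i)))

    state-encode : ∀ q a a< → state (encode q a a<) ≡ q
    state-encode q a a< = cong proj₁ (Fin.remQuot-combine {n} q (funToFin (λ i → fromℕ< (a< i))))

    val-encode : ∀ q a a< i → val (encode q a a<) i ≡ a i
    val-encode q a a< i =
      trans (cong (λ p → toℕ (finToFun {suc B} {d} (proj₂ p) i)) (Fin.remQuot-combine {n} q (funToFin (λ i → fromℕ< (a< i)))))
        (trans (cong toℕ (Fin.finToFun-funToFin (λ i → fromℕ< (a< i)) i)) (Fin.toℕ-fromℕ< (a< i)))

    module _ (a : Fin d → ℕ) (e : Edge n d) where

      -- The default 0 keeps the coordinates outside I within the box, so a landing that is not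
      -- small has a large counter in I.
      landing : Fin d → ℕ
      landing = mix I (fired a (eff e)) (λ _ → 0)

      outer : Fin d → ℤ
      outer = mix I (λ _ → 0ℤ) (eff e)

      Afford : Set
      Afford = ∀ i → i ∈ₛ I → 0ℤ ≤ + a i + eff e i

      afford? : Dec Afford
      afford? = Fin.all? λ i → (i Subset.∈? I) →-dec (0ℤ ℤ.≤? + a i + eff e i)

      small? : Dec (∀ i → landing i ℕ.< suc B)
      small? = Fin.all? λ i → landing i ℕ.<? suc B

      exit? : Dec (⇑ I K (tgt e) landing)
      exit? = ⇑? I K (tgt e) landing

      cap : Dec Afford → Dec (∀ i → landing i ℕ.< suc B) → Dec (⇑ I K (tgt e) landing) → List (Edge (suc (n ℕ.* suc B ^ d)) d)
      cap (no _)  _       _       = []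
      cap (yes _) (yes s) _       = [ outer , acc e , suc (encode (tgt e) landing s) ]
      cap (yes _) (no _)  (yes _) = [ outer , true , zero ]
      cap (yes _) (no _)  (no _)  = []

      capEdge : List (Edge (suc (n ℕ.* suc B ^ d)) d)
      capEdge = cap afford? small? exit?

      landing-≡ : Afford → ∀ {i} → i ∈ₛ I → + landing i ≡ + a i + eff e i
      landing-≡ af {i} i∈ = trans (cong +_ (mix-∈ {f = fired a (eff e)} {λ _ → 0} i∈)) (ℤ.0≤i⇒+∣i∣≡i (af i i∈))

    capOption : (Fin d → ℕ) → List (Edge n d) → List (Edge (suc (n ℕ.* suc B ^ d)) d)
    capOption a = concatMap (capEdge a)

    capped : Game (suc (n ℕ.* suc B ^ d)) d
    -- The target of all winning exits: a free accepting self-loop, won with every credit.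
    capped zero    = [ (λ _ → 0ℤ) , true , zero ] , []
    capped (suc y) = capOption (val y) (proj₁ (δ (state y))) , map (capOption (val y)) (proj₂ (δ (state y)))

    merge : Inner → (Fin d → ℕ) → Fin d → ℕ
    merge y w = mix I (val y) w

    Z : Pred (suc (n ℕ.* suc B ^ d)) d
    Z zero    w = Unit
    Z (suc y) w = Win δ (state y) (merge y w)

    -- The capped play loses nothing, so its values keep dominating those of the given play. When
    -- the box is left, `big` provides the winning exit.
    into : ∀ {r u} → Attr δ (Win δ) r u → ∀ {y w} → state y ≡ r → u ≼ merge y w → Attr capped Z (suc y) w
    into {u = u} (node f) {y} {w} refl le = node λ o m → go o (∈.∈-map⁻ (capOption (val y)) m)
      where
      go : ∀ o' → (∃ λ o → o ∈ options δ (state y) × o' ≡ capOption (val y) o) → Move Z (Attr capped Z) o' w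
      go _ (o , o∈ , refl) = step (f o o∈)
        where
        step : Move (Win δ) (Attr δ (Win δ)) o u → Move Z (Attr capped Z) (capOption (val y) o) w
        step (e , e∈ , v' , fires , res) = finish (afford? a e) (small? a e) (exit? a e) refl
          where
          a = val y
          land = landing a e
          w' : Fin d → ℕ
          w' = mix I w (fired w (eff e))

          fires' : Fires (merge y w) (eff e) v'
          fires' = fires-mono {z = eff e} le ≼-refl fires

          af : Afford a e
          af i i∈ = ℤ.≤-trans (+≤+ z≤n) (subst (λ b → + v' i ≤ + b + eff e i) (mix-∈ {f = a} {w} i∈) (fires' i))

          out : ∀ i → i ∉ₛ I → + v' i ≤ + w i + eff e i
          out i i∉ = subst (λ b → + v' i ≤ + b + eff e i) (mix-∉ {f = a} {w} i∉) (fires' i)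

          fired≡ : ∀ i → i ∉ₛ I → + fired w (eff e) i ≡ + w i + eff e i
          fired≡ i i∉ = ℤ.0≤i⇒+∣i∣≡i (ℤ.≤-trans (+≤+ z≤n) (out i i∉))

          w-fires : Fires w (outer a e) w'
          w-fires i with i Subset.∈? I
          ... | yes _ = ℤ.≤-reflexive (sym (ℤ.+-identityʳ (+ w i)))
          ... | no i∉ = ℤ.≤-reflexive (fired≡ i i∉)

          v'≼land : v' ≼[ I ] land
          v'≼land i i∈ = ℤ.drop‿+≤+ (subst (+ v' i ≤_) (sym (landing-≡ a e af i∈))
            (subst (λ b → + v' i ≤ + b + eff e i) (mix-∈ {f = a} {w} i∈) (fires' i)))

          v'≼merge : ∀ {y'} → (∀ i → val y' i ≡ land i) → v' ≼ merge y' w'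
          v'≼merge {y'} eq i = mix-elim {f = val y'} {w'} (v' i ℕ.≤_)
            (λ i∈ → subst (v' i ℕ.≤_) (sym (eq i)) (v'≼land i i∈))
            (λ i∉ → subst (v' i ℕ.≤_) (sym (mix-∉ {f = w} {fired w (eff e)} i∉))
              (ℤ.drop‿+≤+ (subst (+ v' i ≤_) (sym (fired≡ i i∉)) (out i i∉))))

          won : Win δ (tgt e) v'
          won = [ proj₂ , attr⇒win δ ]′ res

          finish : ∀ A S X → cap a e A S X ≡ capEdge a e → Move Z (Attr capped Z) (capOption a o) w
          finish (no ¬af) _ _ _ = ⊥-elim (¬af af)
          finish (yes _) (yes s) X eq = (outer a e , acc e , suc (encode (tgt e) land s)) ,
            ∈.∈-concatMap⁺ (capEdge a) (lose e∈ (subst ((outer a e , acc e , suc (encode (tgt e) land s)) ∈_) eq (here refl))) , w' , w-fires , inner res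
            where
            y' = encode (tgt e) land s
            inner : _ → (acc e ≡ true × Win δ (state y') (merge y' w')) ⊎ Attr capped Z (suc y') w'
            inner (inj₁ (ac , x)) = inj₁ (ac , subst (λ r → Win δ r (merge y' w')) (sym (state-encode (tgt e) land s))
              (win-up δ (v'≼merge (val-encode (tgt e) land s)) x))
            inner (inj₂ t) = inj₂ (into t (state-encode (tgt e) land s) (v'≼merge (val-encode (tgt e) land s)))
          finish (yes _) (no ¬s) (yes x) eq = (outer a e , true , zero) ,
            ∈.∈-concatMap⁺ (capEdge a) (lose e∈ (subst ((outer a e , true , zero) ∈_) eq (here refl))) , w' , w-fires , inj₁ (refl , tt)
          finish (yes _) (no ¬s) (no ¬x) _ = ⊥-elim (¬x (big won v'≼land (λ i i∉ → mix-∉ {f = fired a (eff e)} i∉) ¬s))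

    good-Z : Good capped Z
    good-Z zero    w _ = node λ { _ (here refl) → _ , here refl , w , (λ i → ℤ.≤-reflexive (sym (ℤ.+-identityʳ (+ w i)))) , inj₁ (refl , tt) }
    good-Z (suc y) w x = into (win⇒attr δ _ _ x) refl ≼-refl

    win⇒capped : ∀ {q v} y → Win δ q v → state y ≡ q → v ≼[ I ] val y → UWin capped (suc y)
    win⇒capped {v = v} y x refl le = v , good⇒win capped good-Z {suc y}
      (win-up δ (λ i → mix-elim {f = val y} {v} (v i ℕ.≤_) (le i) (λ _ → ℕ.≤-refl)) x)

    -- The reserve B outside I pays for any element of K when leaving the box.
    lift : Inner → (Fin d → ℕ) → Fin d → ℕ
    lift y w = merge y (λ i → w i ℕ.+ B)

    Y : Pred n d
    Y r v = Win δ r v ⊎ ∃ λ y → ∃ λ w → state y ≡ r × Win capped (suc y) w × lift y w ≼ v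

    -- Counters in I are replayed exactly from `val y`, the others with an untouched reserve. At an
    -- exit a winning tree of the original game takes over.
    from : ∀ {y w v} → Attr capped (Win capped) (suc y) w → lift y w ≼ v → Attr δ Y (state y) v
    from {y} {w} {v} (node f) le = node λ o o∈ → step o (f (capOption a o) (∈.∈-map⁺ (capOption a) o∈))
      where
      a = val y
      step : ∀ o → Move (Win capped) (Attr capped (Win capped)) (capOption a o) w → Move Y (Attr δ Y) o v
      step o (e' , e'∈ , w' , fires , res) =
        let e , e∈ , m = find (∈.∈-concatMap⁻ (capEdge a) {xs = o} e'∈)
        in finish e e∈ (afford? a e) (small? a e) (exit? a e) m fires res
        where
        finish : ∀ e → e ∈ o → ∀ A S X {e'} → e' ∈ cap a e A S X → Fires w (eff e') w' →
                 (acc e' ≡ true × Win capped (tgt e') w') ⊎ Attr capped (Win capped) (tgt e') w' → Move Y (Attr δ Y) o v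
        finish e e∈ (yes af) S X m fires res = e , e∈ , v' , v-fires outer-fires , inner S X m res
          where
          land = landing a e
          v' : Fin d → ℕ
          v' = mix I land (λ i → w' i ℕ.+ B)

          outer-fires : ∀ i → i ∉ₛ I → + w' i ≤ + w i + eff e i
          outer-fires i i∉ = effect S X m fires
            where
            at : ∀ {e'} → eff e' ≡ outer a e → Fires w (eff e') w' → + w' i ≤ + w i + eff e i
            at refl g = subst (λ z → + w' i ≤ + w i + z) (mix-∉ {f = λ _ → 0ℤ} {eff e} i∉) (g i)
            effect : ∀ S X {e'} → e' ∈ cap a e (yes af) S X → Fires w (eff e') w' → + w' i ≤ + w i + eff e i
            effect (yes _) _       {e'} (here refl) g = at {e'} refl g
            effect (no _)  (yes _) {e'} (here refl) g = at {e'} refl g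

          v-fires : (∀ i → i ∉ₛ I → + w' i ≤ + w i + eff e i) → Fires v (eff e) v'
          v-fires g i = mix-elim {f = land} {λ i → w' i ℕ.+ B} (λ b → + b ≤ + v i + eff e i)
            (λ i∈ → ℤ.≤-trans (ℤ.≤-reflexive (landing-≡ a e af i∈))
              (ℤ.+-monoˡ-≤ (eff e i) (+≤+ (subst (ℕ._≤ v i) (mix-∈ {f = a} i∈) (le i)))))
            (λ i∉ → begin
              + w' i + + B             ≤⟨ ℤ.+-monoˡ-≤ (+ B) (g i i∉) ⟩
              (+ w i + eff e i) + + B  ≡⟨ +-swapʳ (+ w i) (eff e i) (+ B) ⟩
              + (w i ℕ.+ B) + eff e i  ≤⟨ ℤ.+-monoˡ-≤ (eff e i) (+≤+ (subst (ℕ._≤ v i) (mix-∉ {f = a} i∉) (le i))) ⟩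
              + v i + eff e i          ∎)
            where open ℤ.≤-Reasoning

          inner : ∀ S X {e'} → e' ∈ cap a e (yes af) S X →
                  (acc e' ≡ true × Win capped (tgt e') w') ⊎ Attr capped (Win capped) (tgt e') w' →
                  (acc e ≡ true × Y (tgt e) v') ⊎ Attr δ Y (tgt e) v'
          inner (yes s) X (here refl) res = go res
            where
            y' = encode (tgt e) land s
            le' : lift y' w' ≼ v'
            le' i with i Subset.∈? I
            ... | yes _ = ℕ.≤-reflexive (val-encode (tgt e) land s i)
            ... | no _  = ℕ.≤-refl
            go : _ → (acc e ≡ true × Y (tgt e) v') ⊎ Attr δ Y (tgt e) v'
            go (inj₁ (ac , x)) = inj₁ (ac , inj₂ (y' , w' , state-encode (tgt e) land s , x , le'))
            go (inj₂ t) = inj₂ (subst (λ r → Attr δ Y r v') (state-encode (tgt e) land s) (from t le'))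
          inner (no _) (yes x) (here refl) _ =
            let (r , u) , b∈ , e≡ , u≤ = find x
            in inj₂ (attr-map (λ _ _ → id) (λ _ _ → inj₁) (win⇒attr δ _ _
                 (subst (λ r → Win δ r v') e≡ (win-up δ
                   (λ i → mix-elim {f = land} {λ i → w' i ℕ.+ B} (u i ℕ.≤_) (u≤ i) (λ _ → ℕ.≤-trans (K≤B b∈ i) (ℕ.m≤n+m B (w' i))))
                   (All.lookup K-win b∈)))))

    good-Y : Good δ Y
    good-Y r v (inj₁ x)                      = attr-map (λ _ _ → id) (λ _ _ → inj₁) (win⇒attr δ r v x)
    good-Y r v (inj₂ (y , w , refl , x , le)) = from (win⇒attr capped _ _ x) le

    capped⇒win : ∀ {y w} → Win capped (suc y) w → Win δ (state y) (lift y w)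
    capped⇒win {y} {w} x = good⇒win δ good-Y (inj₂ (y , w , refl , x , ≼-refl))

  module _ {n d : ℕ} (δ : Game n d) where

    -- Only completeness is relative to I. The elements win with all their counters, so for I = `⊤`
    -- the basis describes the winning region exactly.
    Basis : Subset d → Set
    Basis I = ∃ λ (L : List (Conf n d)) → All (holds (Win δ)) L × (∀ q v → Win δ q v → ⇑ I L q v)

    extend : ∀ I → (∀ i → i ∈ₛ I → Basis (I - i)) → Basis I
    extend I sub = K ++ W , All.++⁺ K-win W-win , complete
      where
      collected = gather (Win δ) {P = λ L i → i ∈ₛ I → ∀ q v → Win δ q v → ⇑ (I - i) L q v}
        (λ i f g i∈ q v w → ⇑-mono f (g i∈ q v w)) (allFin d) λ i _ → one i (i Subset.∈? I)
        where
        one : ∀ i → Dec (i ∈ₛ I) → ∃ λ L → All (holds (Win δ)) L × (i ∈ₛ I → ∀ q v → Win δ q v → ⇑ (I - i) L q v)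
        one i (yes i∈) = let L , w , c = sub i i∈ in L , w , λ _ → c
        one i (no i∉)  = [] , [] , λ i∈ → ⊥-elim (i∉ i∈)
      K = proj₁ collected
      K-win = proj₁ (proj₂ collected)
      B = proj₁ (bounded-list K)
      open Capped δ I K K-win B (proj₂ (bounded-list K)) (λ i → proj₂ (proj₂ collected) i (∈.∈-allFin i))
      inner = gather (Win δ) {P = λ L y → UWin capped (suc y) → ⇑ I L (state y) (val y)}
        (λ y f g w → ⇑-mono f (g w)) (allFin (n ℕ.* suc B ^ d)) λ y _ → one y (uwin? capped (suc y))
        where
        one : ∀ y → Dec (UWin capped (suc y)) → ∃ λ L → All (holds (Win δ)) L × (UWin capped (suc y) → ⇑ I L (state y) (val y))
        -- `lift y w` agrees with `val y` on I, so a single winning credit represents the whole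
        -- state of the box.
        one y (yes (w , x)) = [ state y , lift y w ] , capped⇒win x ∷ [] ,
          λ _ → here (refl , λ i i∈ → ℕ.≤-reflexive (mix-∈ {f = val y} i∈))
        one y (no ¬x) = [] , [] , λ x → ⊥-elim (¬x x)
      W = proj₁ inner
      W-win = proj₁ (proj₂ inner)
      complete : ∀ q v → Win δ q v → ⇑ I (K ++ W) q v
      complete q v x = by (Fin.all? λ i → a i ℕ.<? suc B)
        where
        a : Fin d → ℕ
        a = mix I v (λ _ → 0)
        a≡v : ∀ {i} → i ∈ₛ I → a i ≡ v i
        a≡v = mix-∈ {f = v}
        by : Dec (∀ i → a i ℕ.< suc B) → ⇑ I (K ++ W) q v
        by (no ¬s) = Any.++⁺ˡ (⇑-up (λ i i∈ → ℕ.≤-reflexive (a≡v i∈))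
          (big x (λ i i∈ → ℕ.≤-reflexive (sym (a≡v i∈))) (λ i → mix-∉ {f = v}) ¬s))
        by (yes s) = Any.++⁺ʳ K (⇑-up (λ i i∈ → ℕ.≤-reflexive (trans (val-encode q a s i) (a≡v i∈)))
          (subst (λ r → ⇑ I W r (val y)) (state-encode q a s) (proj₂ (proj₂ inner) y (∈.∈-allFin y)
            (win⇒capped y x (state-encode q a s) λ i i∈ → ℕ.≤-reflexive (sym (trans (val-encode q a s i) (a≡v i∈)))))))
          where
          y = encode q a s

    basis : ∀ k I → card I ℕ.≤ k → Basis I
    basis zero    I le = extend I λ i i∈ → ⊥-elim (ℕ.n≮0 (ℕ.≤-trans (Subset.x∈p⇒∣p-x∣<∣p∣ i∈) le))
    basis (suc k) I le = extend I λ i i∈ → basis k (I - i) (ℕ.≤-pred (ℕ.≤-trans (Subset.x∈p⇒∣p-x∣<∣p∣ i∈) le))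

    basis-sound : ∀ {L} → All (holds (Win δ)) L → ∀ {q v} → ⇑ ⊤ L q v → Win δ q v
    basis-sound wins {v = v} m = let (r , u) , b∈ , e , le = find m in
      subst (λ r → Win δ r v) e (win-up δ (λ i → le i Subset.∈⊤) (All.lookup wins b∈))

    win? : ∀ q v → Dec (Win δ q v)
    win? q v = let L , wins , complete = basis (card (⊤ {d})) ⊤ ℕ.≤-refl in
      map′ (basis-sound wins) (complete q v) (⇑? ⊤ L q v)

-- Weighted means and monotonicity of the visit probabilities

module Probability where

  open import Defs
  open import Data.Nat as ℕ using (ℕ; zero; suc; z≤n; _∸_)
  import Data.Nat.Properties as ℕ
  open import Data.Nat.ListAction using () renaming (sum to sumℕ)
  open import Data.Integer as ℤ using (ℤ; +_)
  import Data.Integer.Properties as ℤ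
  open import Data.Rational.Unnormalised.Base using (ℚᵘ; mkℚᵘ; 0ℚᵘ; 1ℚᵘ; _+_; _*_; -_; _≤_; _≃_; *≤*; *≡*)
  import Data.Rational.Unnormalised.Properties as ℚ
  open import Data.Rational.Unnormalised.Solver using (module +-*-Solver)
  open import Data.Bool using (true; false)
  open import Data.Fin as Fin using (Fin)
  open import Data.List using (List; []; _∷_; [_]; _++_; map; mapMaybe)
  import Data.List.Properties as List
  open import Data.List.Relation.Unary.Any using (here; there)
  open import Data.List.Relation.Unary.All using (All; []; _∷_)
  import Data.List.Relation.Unary.All as All
  open import Data.List.Membership.Propositional using (_∈_)
  open import Data.Maybe using (Maybe; just; nothing)
  open import Data.Product using (∃; _×_; _,_; proj₁; proj₂)
  open import Data.Sum using (_⊎_; inj₁; inj₂)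
  open import Data.Unit using (⊤; tt)
  open import Data.Empty using (⊥-elim)
  open import Relation.Nullary using (¬_; yes; no)
  open import Relation.Binary.PropositionalEquality using (_≡_; refl; sym; cong; subst)

  +-cancelˡ-≤ : ∀ r {p q} → r + p ≤ r + q → p ≤ q
  +-cancelˡ-≤ r {p} {q} h = begin
    p               ≃⟨ lemma r p ⟨
    - r + (r + p)   ≤⟨ ℚ.+-monoʳ-≤ (- r) h ⟩
    - r + (r + q)   ≃⟨ lemma r q ⟩
    q               ∎
    where
    open ℚ.≤-Reasoning
    open +-*-Solver
    lemma : ∀ r p → - r + (r + p) ≃ p
    lemma = solve 2 (λ r p → :- r :+ (r :+ p) := p) ℚ.≃-refl

  weight : ℕ → ℕ → ℚᵘ
  weight D w = mkℚᵘ (+ w) D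

  weight-+ : ∀ D v w → weight D (v ℕ.+ w) ≃ weight D v + weight D w
  weight-+ D v w = *≡* (lemma (+ v) (+ w) (+ suc D))
    where
    open import Data.Integer.Tactic.RingSolver using (solve-∀)
    lemma : ∀ v w D → (v ℤ.+ w) ℤ.* (D ℤ.* D) ≡ (v ℤ.* D ℤ.+ w ℤ.* D) ℤ.* D
    lemma = solve-∀

  module _ {A : Set} (D : ℕ) where

    mean : (A → ℚᵘ) → List (A × ℕ) → ℚᵘ
    mean f xs = sumℚ (map (λ x → weight D (proj₂ x) * f (proj₁ x)) xs)

    mean-mono : ∀ {f g} xs → (∀ x w → (x , w) ∈ xs → f x ≤ g x) → mean f xs ≤ mean g xs
    mean-mono []             le = ℚ.≤-refl
    mean-mono ((x , w) ∷ xs) le = ℚ.+-mono-≤ (ℚ.*-monoʳ-≤-nonNeg (weight D w) (le x w (here refl)))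
                                             (mean-mono xs λ y v m → le y v (there m))

    -- Subtraction-free form of mean g - mean f ≥ (weight of x) · (g x - f x); the other entries
    -- contribute nonnegatively.
    mean-gap : ∀ {f g} xs → (∀ x w → (x , w) ∈ xs → f x ≤ g x) → ∀ {x w} → (x , w) ∈ xs →
               mean f xs + weight D w * g x ≤ mean g xs + weight D w * f x
    mean-gap {f} {g} ((x , w) ∷ xs) le (here refl) = begin
      (weight D w * f x + mean f xs) + weight D w * g x  ≃⟨ lemma (weight D w * f x) (mean f xs) (weight D w * g x) ⟩
      (weight D w * g x + mean f xs) + weight D w * f x  ≤⟨ ℚ.+-monoˡ-≤ _ (ℚ.+-monoʳ-≤ (weight D w * g x) (mean-mono xs λ y v m → le y v (there m))) ⟩
      (weight D w * g x + mean g xs) + weight D w * f x  ∎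
      where
      open ℚ.≤-Reasoning
      open +-*-Solver
      lemma : ∀ a b c → (a + b) + c ≃ (c + b) + a
      lemma = solve 3 (λ a b c → (a :+ b) :+ c := (c :+ b) :+ a) ℚ.≃-refl
    mean-gap {f} {g} ((y , v) ∷ xs) le {x} {w} (there m) = begin
      (weight D v * f y + mean f xs) + weight D w * g x  ≃⟨ ℚ.+-assoc (weight D v * f y) _ _ ⟩
      weight D v * f y + (mean f xs + weight D w * g x)  ≤⟨ ℚ.+-mono-≤ (ℚ.*-monoʳ-≤-nonNeg (weight D v) (le y v (here refl)))
                                                          (mean-gap xs (λ z u m → le z u (there m)) m) ⟩
      weight D v * g y + (mean g xs + weight D w * f x)  ≃⟨ ℚ.+-assoc (weight D v * g y) _ _ ⟨
      (weight D v * g y + mean g xs) + weight D w * f x  ∎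
      where
      open ℚ.≤-Reasoning

    mean-const : ∀ c xs → mean (λ _ → c) xs ≃ weight D (sumℕ (map proj₂ xs)) * c
    mean-const c []             = ℚ.≃-sym (ℚ.≃-trans (ℚ.*-congʳ {c} {weight D 0} {0ℚᵘ} (*≡* refl)) (ℚ.*-zeroˡ c))
    mean-const c ((x , w) ∷ xs) = begin
      weight D w * c + mean (λ _ → c) xs        ≈⟨ ℚ.+-congʳ (weight D w * c) (mean-const c xs) ⟩
      weight D w * c + weight D s * c             ≈⟨ ℚ.*-distribʳ-+ c (weight D w) (weight D s) ⟨
      (weight D w + weight D s) * c               ≈⟨ ℚ.*-congʳ {c} (weight-+ D w s) ⟨
      weight D (w ℕ.+ s) * c                    ∎
      where
      open ℚ.≃-Reasoning
      s = sumℕ (map proj₂ xs)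

    mean-full : ∀ c xs → sumℕ (map proj₂ xs) ≡ suc D → mean (λ _ → c) xs ≃ c
    mean-full c xs e = ℚ.≃-trans (mean-const c xs) (ℚ.≃-trans (ℚ.*-congʳ {c} one) (ℚ.*-identityˡ c))
      where
      one : weight D (sumℕ (map proj₂ xs)) ≃ 1ℚᵘ
      one rewrite e = *≡* (ℤ.*-comm (+ suc D) (+ 1))

  module _ {A B : Set} {f : A → Maybe B} where

    ∈-mapMaybe⁻ : ∀ xs {y} → y ∈ mapMaybe f xs → ∃ λ x → x ∈ xs × f x ≡ just y
    ∈-mapMaybe⁻ (x ∷ xs) m with f x in eq
    ∈-mapMaybe⁻ (x ∷ xs) m           | nothing = let z , z∈ , e = ∈-mapMaybe⁻ xs m in z , there z∈ , e
    ∈-mapMaybe⁻ (x ∷ xs) (here refl) | just _  = x , here refl , eq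
    ∈-mapMaybe⁻ (x ∷ xs) (there m)   | just _  = let z , z∈ , e = ∈-mapMaybe⁻ xs m in z , there z∈ , e

    ∈-mapMaybe⁺ : ∀ {xs x y} → x ∈ xs → f x ≡ just y → y ∈ mapMaybe f xs
    ∈-mapMaybe⁺ {x ∷ xs} (here refl) e rewrite e = here refl
    ∈-mapMaybe⁺ {x ∷ xs} (there m)   e with f x
    ... | nothing = ∈-mapMaybe⁺ m e
    ... | just _  = there (∈-mapMaybe⁺ m e)

  module Play {d : ℕ} (S : VASSMDP d) where
    open VASSMDP S

    total : Config S → ℕ
    total c = sumℕ (map proj₂ (enabledW S c))

    fire-inv : ∀ c t {c' w} → fire S c t ≡ just (c' , w) →
               proj₁ c ≡ proj₁ t × addV (proj₂ c) (proj₁ (proj₂ t)) ≡ just (proj₂ c') ×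
               proj₁ c' ≡ proj₂ (proj₂ t) × w ≡ τ t
    fire-inv (q , v) (q₁ , z , q₂) e with q Fin.≟ q₁
    ... | yes refl with addV v z
    fire-inv (q , v) (q₁ , z , q₂) refl | yes refl | just _ = refl , refl , refl , refl

    fire-intro : ∀ q v z q' {v'} → addV v z ≡ just v' → fire S (q , v) (q , z , q') ≡ just ((q' , v') , τ (q , z , q'))
    fire-intro q v z q' e with q Fin.≟ q
    ... | no q≢q = ⊥-elim (q≢q refl)
    ... | yes _ rewrite e = refl

    weights-pos : ∀ c {c' w} → (c' , w) ∈ enabledW S c → 1 ℕ.≤ w
    weights-pos c m = let t , t∈ , e = ∈-mapMaybe⁻ T m in
      subst (1 ℕ.≤_) (sym (proj₂ (proj₂ (proj₂ (fire-inv c t e))))) (ℕ.>-nonZero⁻¹ _ {{All.lookup τ-pos t∈}})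

    ∈⇒≤sum : ∀ {A : Set} (xs : List (A × ℕ)) {x w} → (x , w) ∈ xs → w ℕ.≤ sumℕ (map proj₂ xs)
    ∈⇒≤sum (_ ∷ xs)       (here refl) = ℕ.m≤m+n _ _
    ∈⇒≤sum ((_ , v) ∷ xs) (there m)   = ℕ.≤-trans (∈⇒≤sum xs m) (ℕ.m≤n+m _ v)

    enabled-≢[] : ∀ c → ¬ successors S c ≡ [] → ∃ λ c' → ∃ λ w → (c' , w) ∈ enabledW S c
    enabled-≢[] c ne with enabledW S c
    ... | []            = ⊥-elim (ne refl)
    ... | (c' , w) ∷ _  = c' , w , here refl

    -- Shows that the truncated subtraction in the denominators is exact; with it the outcome
    -- probabilities sum to one.
    total-pos : ∀ c → ¬ successors S c ≡ [] → total c ≡ suc (total c ∸ 1)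
    total-pos c ne = let _ , _ , m = enabled-≢[] c ne in
      sym (ℕ.m+[n∸m]≡n {1} (ℕ.≤-trans (weights-pos c m) (∈⇒≤sum (enabledW S c) m)))

    module _ (σ : Strategy S) (qF : Fin nQ) where

      next : ℕ → ℕ → List (Config S) → Config S → Config S → ℚᵘ
      next m k h c c' = aux S σ qF (dec S qF c' m) k (h ++ [ c ]) c'

      -- `aux` passes to the strategy proofs from its own case split; packing them here spares later
      -- statements from naming them.
      data Chosen (h : List (Config S)) (c : Config S) : Config S → Set where
        chosen : ∀ pq ne → Chosen h c (proj₁ (σ h c pq ne))

      Unfolding : List (Config S) → Config S → Set
      Unfolding h c =
        (successors S c ≡ [] × (∀ m k → aux S σ qF (suc m) (suc k) h c ≡ 0ℚᵘ)) ⊎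
        (∃ λ c' → Chosen h c c' × (∀ m k → aux S σ qF (suc m) (suc k) h c ≡ next (suc m) k h c c')) ⊎
        (isProb (proj₁ c) ≡ true × ¬ successors S c ≡ [] × (∀ m k → aux S σ qF (suc m) (suc k) h c ≡
          mean (total c ∸ 1) (next (suc m) k h c) (enabledW S c)))

      -- The clause of aux for player configurations stores a proof of an equation
      -- about isProb in its result.  Since isProb (q tt) and isProb (q u) are
      -- convertible but not syntactically equal, abstracting the latter leaves the
      -- left-hand side of this equation intact.
      unfold′ : ∀ h (q : ⊤ → Fin nQ) v u → Unfolding h (q u , v)
      unfold′ h q v u with isEmpty? (successors S (q u , v)) | isProb (q u) | loop
        where
        loop : isProb (q tt) ≡ isProb (q u)
        loop = refl
      ... | yes e | _     | _  = inj₁ (e , λ _ _ → refl)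
      ... | no ne | false | pq = inj₂ (inj₁ (_ , chosen pq ne , λ _ _ → refl))
      ... | no ne | true  | _  = inj₂ (inj₂ (refl , ne , λ m k → cong sumℚ (List.map-cong (λ { (c' , w) → refl }) (enabledW S (q u , v)))))

      unfold : ∀ h c → Unfolding h c
      unfold h (q , v) = unfold′ h (λ _ → q) v tt

      private
        p : ℕ → ℕ → List (Config S) → Config S → ℚᵘ
        p = aux S σ qF

      mean-1 : ∀ c → ¬ successors S c ≡ [] → mean (total c ∸ 1) (λ _ → 1ℚᵘ) (enabledW S c) ≃ 1ℚᵘ
      mean-1 c ne = mean-full (total c ∸ 1) 1ℚᵘ (enabledW S c) (total-pos c ne)

      mean-0 : ∀ c → mean (total c ∸ 1) (λ _ → 0ℚᵘ) (enabledW S c) ≃ 0ℚᵘ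
      mean-0 c = ℚ.≃-trans (mean-const (total c ∸ 1) 0ℚᵘ (enabledW S c)) (ℚ.*-zeroʳ (mkℚᵘ (+ total c) (total c ∸ 1)))

      chance-mono : ∀ c f g → (∀ c' → f c' ≤ g c') →
                    mean (total c ∸ 1) f (enabledW S c) ≤ mean (total c ∸ 1) g (enabledW S c)
      chance-mono c f g le = mean-mono (total c ∸ 1) (enabledW S c) λ c' _ _ → le c'

      0≤1 : 0ℚᵘ ≤ 1ℚᵘ
      0≤1 = *≤* (ℤ.+≤+ z≤n)

      aux-≥0 : ∀ m k h c → 0ℚᵘ ≤ p m k h c
      aux-≥0 zero    k       h c = 0≤1
      aux-≥0 (suc m) zero    h c = ℚ.≤-refl
      aux-≥0 (suc m) (suc k) h c with unfold h c
      ... | inj₁ (_ , e)                   = ℚ.≤-reflexive-≡ (sym (e m k))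
      ... | inj₂ (inj₁ (c' , _ , e))       = subst (0ℚᵘ ≤_) (sym (e m k)) (aux-≥0 (dec S qF c' (suc m)) k (h ++ [ c ]) c')
      ... | inj₂ (inj₂ (_ , _ , e))        = subst (0ℚᵘ ≤_) (sym (e m k))
        (ℚ.≤-trans (ℚ.≤-reflexive (ℚ.≃-sym (mean-0 c))) (chance-mono c (λ _ → 0ℚᵘ) (next (suc m) k h c) λ c' → aux-≥0 (dec S qF c' (suc m)) k (h ++ [ c ]) c'))

      aux-≤1 : ∀ m k h c → p m k h c ≤ 1ℚᵘ
      aux-≤1 zero    k       h c = ℚ.≤-refl
      aux-≤1 (suc m) zero    h c = 0≤1
      aux-≤1 (suc m) (suc k) h c with unfold h c
      ... | inj₁ (_ , e)                   = subst (_≤ 1ℚᵘ) (sym (e m k)) 0≤1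
      ... | inj₂ (inj₁ (c' , _ , e))       = subst (_≤ 1ℚᵘ) (sym (e m k)) (aux-≤1 (dec S qF c' (suc m)) k (h ++ [ c ]) c')
      ... | inj₂ (inj₂ (_ , ne , e))       = subst (_≤ 1ℚᵘ) (sym (e m k))
        (ℚ.≤-trans (chance-mono c (next (suc m) k h c) (λ _ → 1ℚᵘ) λ c' → aux-≤1 (dec S qF c' (suc m)) k (h ++ [ c ]) c') (ℚ.≤-reflexive (mean-1 c ne)))

      aux-anti : ∀ m k h c → p (suc m) k h c ≤ p m k h c
      dec-anti : ∀ m k h c c' → next (suc (suc m)) k h c c' ≤ next (suc m) k h c c'
      dec-anti m k h c c' with proj₁ c' Fin.≟ qF
      ... | yes _ = aux-anti m k _ c'
      ... | no  _ = aux-anti (suc m) k _ c'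
      aux-anti zero    k       h c = aux-≤1 1 k h c
      aux-anti (suc m) zero    h c = ℚ.≤-refl
      aux-anti (suc m) (suc k) h c with unfold h c
      ... | inj₁ (_ , e)                   rewrite e m k | e (suc m) k = ℚ.≤-refl
      ... | inj₂ (inj₁ (c' , _ , e))       rewrite e m k | e (suc m) k = dec-anti m k h c c'
      ... | inj₂ (inj₂ (_ , ne , e))       rewrite e m k | e (suc m) k =
        chance-mono c (next (suc (suc m)) k h c) (next (suc m) k h c) λ c' → dec-anti m k h c c'

      aux-suc : ∀ m k h c → p m k h c ≤ p m (suc k) h c
      aux-suc zero    k       h c = ℚ.≤-refl
      aux-suc (suc m) zero    h c = aux-≥0 (suc m) 1 h c
      aux-suc (suc m) (suc k) h c with unfold h c
      ... | inj₁ (_ , e)                   rewrite e m k | e m (suc k) = ℚ.≤-refl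
      ... | inj₂ (inj₁ (c' , _ , e))       rewrite e m k | e m (suc k) = aux-suc (dec S qF c' (suc m)) k (h ++ [ c ]) c'
      ... | inj₂ (inj₂ (_ , ne , e))       rewrite e m k | e m (suc k) =
        chance-mono c (next (suc m) k h c) (next (suc m) (suc k) h c) λ c' → aux-suc (dec S qF c' (suc m)) k (h ++ [ c ]) c'

      aux-mono : ∀ m {k k'} h c → k ℕ.≤′ k' → p m k h c ≤ p m k' h c
      aux-mono m h c ℕ.≤′-refl     = ℚ.≤-refl
      aux-mono m h c (ℕ.≤′-step s) = ℚ.≤-trans (aux-mono m h c s) (aux-suc m _ h c)

-- From almost-surely winning strategies to winning in the game

module Reduction where

  open AlmostFull
  open Games
  open OnePlayer
  open Probability
  open import Defs
  open import Data.Nat as ℕ using (ℕ; zero; suc; s≤s; z≤n; _∸_)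
  import Data.Nat.Properties as ℕ
  open import Data.Integer as ℤ using (ℤ; +_)
  import Data.Integer.Properties as ℤ
  open import Data.Rational.Unnormalised.Base using (ℚᵘ; mkℚᵘ; 0ℚᵘ; 1ℚᵘ; _+_; _*_; _≤_; _≃_; *≤*; *≡*)
  import Data.Rational.Unnormalised.Properties as ℚ
  open import Data.Rational.Unnormalised.Solver using (module +-*-Solver)
  open import Data.Bool using (true; false; if_then_else_)
  open import Data.Fin as Fin using (Fin; zero; suc)
  import Data.Fin.Properties as Fin
  open import Data.Vec as Vec using (Vec; []; _∷_; lookup)
  import Data.Vec.Properties as Vec
  open import Data.List using (List; []; _∷_; [_]; _++_; map; filter)
  open import Data.List.Relation.Unary.Any using (here; there)
  import Data.List.Relation.Unary.All as All
  open import Data.List.Membership.Propositional using (_∈_)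
  import Data.List.Membership.Propositional.Properties as ∈
  open import Data.Maybe using (just)
  open import Data.Product using (∃; _×_; _,_; proj₁; proj₂)
  open import Data.Sum using (_⊎_; inj₁; inj₂)
  open import Data.Empty using (⊥-elim)
  open import Function using (_∘_)
  open import Relation.Nullary using (¬_; Dec; yes; no; ⌊_⌋)
  open import Relation.Binary.PropositionalEquality using (_≡_; refl; sym; trans; subst; subst₂)

  addV-lookup : ∀ {d} (v : Vec ℕ d) z {v'} → addV v z ≡ just v' →
                ∀ i → + lookup v' i ≡ + lookup v i ℤ.+ lookup z i
  addV-lookup (x ∷ v) (z ∷ zs) e i with (+ x) ℤ.+ z in eq | addV v zs in eq'
  addV-lookup (x ∷ v) (z ∷ zs) refl zero    | + k | just r = sym eq
  addV-lookup (x ∷ v) (z ∷ zs) refl (suc i) | + k | just r = addV-lookup v zs eq' i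

  addV-defined : ∀ {d} (v : Vec ℕ d) z → (∀ i → + 0 ℤ.≤ + lookup v i ℤ.+ lookup z i) →
                 ∃ λ v' → addV v z ≡ just v'
  addV-defined []      []       f = [] , refl
  addV-defined (x ∷ v) (z ∷ zs) f with (+ x) ℤ.+ z | f zero | addV-defined v zs (f ∘ suc)
  ... | + k | _ | v' , e rewrite e = k ∷ v' , refl

  -- The denominator is `suc (j + suc j)`, that is 2(j + 1).
  half : ℕ → ℚᵘ
  half j = mkℚᵘ (+ 1) (j ℕ.+ suc j)

  half+half : ∀ j → half j + half j ≃ mkℚᵘ (+ 1) j
  half+half j = *≡* (lemma (+ j))
    where
    open import Data.Integer.Tactic.RingSolver using (solve-∀)
    lemma : ∀ j → (+ 1 ℤ.* ((+ 1 ℤ.+ j) ℤ.+ (+ 1 ℤ.+ j)) ℤ.+ + 1 ℤ.* ((+ 1 ℤ.+ j) ℤ.+ (+ 1 ℤ.+ j))) ℤ.* (+ 1 ℤ.+ j) ≡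
                  + 1 ℤ.* (((+ 1 ℤ.+ j) ℤ.+ (+ 1 ℤ.+ j)) ℤ.* ((+ 1 ℤ.+ j) ℤ.+ (+ 1 ℤ.+ j)))
    lemma = solve-∀

  module Translation {d : ℕ} (S : VASSMDP d) (qF : Fin (VASSMDP.nQ S)) where
    open VASSMDP S
    open Play S

    outgoing : Fin nQ → List (Trans nQ d)
    outgoing q = filter (λ t → proj₁ t Fin.≟ q) T

    edge forced : Trans nQ d → Edge nQ d
    edge   (_ , z , q') = lookup z , ⌊ q' Fin.≟ qF ⌋ , q'
    forced (_ , z , q') = lookup z , true , q'

    -- At a probabilistic state the environment either grants the player the
    -- choice of the outcome or fixes the outcome, and must not do the latter
    -- infinitely often: fixing is rewarded like a visit to qF.
    game : Game nQ d
    game q = map edge (outgoing q) , (if isProb q then map (λ t → [ forced t ]) (outgoing q) else [])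

    options-player : ∀ {q o} → isProb q ≡ false → o ∈ options game q → o ≡ map edge (outgoing q)
    options-player pq m rewrite pq with m
    ... | here e = e

    options-chance : ∀ {q o} → isProb q ≡ true → o ∈ options game q →
                     o ≡ map edge (outgoing q) ⊎ ∃ λ t → t ∈ outgoing q × o ≡ [ forced t ]
    options-chance pq m rewrite pq with m
    ... | here e   = inj₁ e
    ... | there m' = inj₂ (∈.∈-map⁻ (λ t → [ forced t ]) m')

    forced-option : ∀ {q t} → isProb q ≡ true → t ∈ outgoing q → [ forced t ] ∈ options game q
    forced-option pq t∈ rewrite pq = there (∈.∈-map⁺ (λ t → [ forced t ]) t∈)

    step-transition : ∀ c {c' w} → (c' , w) ∈ enabledW S c → ∃ λ t → t ∈ outgoing (proj₁ c) ×
      proj₁ c' ≡ proj₂ (proj₂ t) × (∀ i → + lookup (proj₂ c') i ≡ + lookup (proj₂ c) i ℤ.+ lookup (proj₁ (proj₂ t)) i)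
    step-transition c {c'} m =
      let t , t∈ , e = ∈-mapMaybe⁻ T m
          q≡ , a , q'≡ , _ = fire-inv c t e
      in t , ∈.∈-filter⁺ _ t∈ (sym q≡) , q'≡ , addV-lookup (proj₂ c) (proj₁ (proj₂ t)) a

    transition-step : ∀ q v z q' → (q , z , q') ∈ T → (∀ i → + 0 ℤ.≤ + lookup v i ℤ.+ lookup z i) →
      ∃ λ v' → ∃ λ w → ((q' , v') , w) ∈ enabledW S (q , v) × (∀ i → + lookup v' i ≡ + lookup v i ℤ.+ lookup z i)
    transition-step q v z q' t∈ f = let v' , a = addV-defined v z f in
      v' , _ , ∈-mapMaybe⁺ t∈ (fire-intro q v z q' a) , addV-lookup v z a

    ∈-outgoing : ∀ {q t} → t ∈ outgoing q → t ∈ T × proj₁ t ≡ q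
    ∈-outgoing {q} = ∈.∈-filter⁻ (λ t → proj₁ t Fin.≟ q)

    module Forward (one : IsOneVASS S) (σ : Strategy S) where

      p : ℕ → ℕ → List (Config S) → Config S → ℚᵘ
      p = aux S σ qF

      -- Here m is not decremented for c, so only visits after c count. The history is kept because
      -- the strategy may depend on it.
      Sure : List (Config S) → Config S → Set
      Sure h c = ∀ m j → ∃ λ k → 1ℚᵘ ≤ p m k h c + mkℚᵘ (+ 1) j

      X : Pred nQ d
      X q f = ∃ λ v → ∃ λ h → f ≡ lookup v × Sure h (q , v)

      next-≤ : ∀ m k h c c' → next σ qF (suc m) k h c c' ≤ p m k (h ++ [ c ]) c'
      next-≤ m k h c c' with proj₁ c' Fin.≟ qF
      ... | yes _ = ℚ.≤-refl
      ... | no  _ = aux-anti σ qF m k (h ++ [ c ]) c'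

      sure-suc : ∀ {h c} → Sure h c → ∀ m j → ∃ λ k → 1ℚᵘ ≤ p (suc m) (suc k) h c + mkℚᵘ (+ 1) j
      sure-suc {h} {c} s m j = let k , le = s (suc m) j in
        k , ℚ.≤-trans le (ℚ.+-monoˡ-≤ (mkℚᵘ (+ 1) j) (aux-suc σ qF (suc m) k h c))

      sure-player : ∀ {h c c'} → Sure h c → (∀ m k → p (suc m) (suc k) h c ≡ next σ qF (suc m) k h c c') →
                    Sure (h ++ [ c ]) c'
      sure-player {h} {c} {c'} s e m j = let k , le = sure-suc s m j in
        k , ℚ.≤-trans (subst (λ a → 1ℚᵘ ≤ a + mkℚᵘ (+ 1) j) (e m k) le) (ℚ.+-monoˡ-≤ (mkℚᵘ (+ 1) j) (next-≤ m k h c c'))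

      -- If an average of numbers ≤ 1 is within ε of one, an entry of weight w / W is within ε · W /
      -- w of one. So sureness passes to every outcome.
      sure-chance : ∀ {h c c' w} → Sure h c → ¬ successors S c ≡ [] → (c' , w) ∈ enabledW S c →
                    (∀ m k → p (suc m) (suc k) h c ≡ mean (total c ∸ 1) (next σ qF (suc m) k h c) (enabledW S c)) →
                    Sure (h ++ [ c ]) c'
      sure-chance {h} {c} {c'} {zero}  s ne m∈ e m j = ⊥-elim (ℕ.n≮0 (weights-pos c m∈))
      sure-chance {h} {c} {c'} {suc w} s ne m∈ e m j =
        -- The index is (D + 1)(j + 1) - 1, which makes the tolerance δ / W; this is at most w / W
        -- times δ because w ≥ 1.
        let k , le = sure-suc s m (D ℕ.* suc j ℕ.+ j)
            f = next σ qF (suc m) k h c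
        in k , ℚ.*-cancelˡ-≤-pos (weight D (suc w)) (begin
          weight D (suc w) * 1ℚᵘ                                 ≤⟨ bound f (subst (λ a → 1ℚᵘ ≤ a + ε) (e m k) le)
                                                                     (mean-gap D {f} {λ _ → 1ℚᵘ} (enabledW S c) (λ x v _ → aux-≤1 σ qF (dec S qF x (suc m)) k (h ++ [ c ]) x) m∈) ⟩
          weight D (suc w) * f c' + ε                            ≤⟨ ℚ.+-monoʳ-≤ (weight D (suc w) * f c') ε≤ ⟩
          weight D (suc w) * f c' + weight D (suc w) * δ         ≃⟨ ℚ.*-distribˡ-+ (weight D (suc w)) (f c') δ ⟨
          weight D (suc w) * (f c' + δ)                          ≤⟨ ℚ.*-monoʳ-≤-nonNeg (weight D (suc w)) (ℚ.+-monoˡ-≤ δ (next-≤ m k h c c')) ⟩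
          weight D (suc w) * (p m k (h ++ [ c ]) c' + δ)         ∎)
        where
        open ℚ.≤-Reasoning
        D = total c ∸ 1
        δ = mkℚᵘ (+ 1) j
        ε = mkℚᵘ (+ 1) (D ℕ.* suc j ℕ.+ j)
        ε≤ : ε ≤ weight D (suc w) * δ
        ε≤ = *≤* (subst₂ (λ a b → + 1 ℤ.* + suc a ℤ.≤ b ℤ.* + suc (D ℕ.* suc j ℕ.+ j))
                    (ℕ.+-comm (D ℕ.* suc j) j) (sym (ℤ.*-identityʳ (+ suc w)))
                    (ℤ.*-monoʳ-≤-nonNeg (+ suc (D ℕ.* suc j ℕ.+ j)) (ℤ.+≤+ (s≤s (z≤n {w})))))
        bound : ∀ f → 1ℚᵘ ≤ mean D f (enabledW S c) + ε →
                mean D f (enabledW S c) + weight D (suc w) * 1ℚᵘ ≤ mean D (λ _ → 1ℚᵘ) (enabledW S c) + weight D (suc w) * f c' →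
                weight D (suc w) * 1ℚᵘ ≤ weight D (suc w) * f c' + ε
        bound f le gap = Probability.+-cancelˡ-≤ 1ℚᵘ (begin
          1ℚᵘ + a                          ≤⟨ ℚ.+-monoˡ-≤ a le ⟩
          (μ + ε) + a                      ≃⟨ swap μ ε a ⟩
          (μ + a) + ε                      ≤⟨ ℚ.+-monoˡ-≤ ε gap ⟩
          (mean D (λ _ → 1ℚᵘ) (enabledW S c) + b) + ε  ≃⟨ ℚ.+-congˡ ε (ℚ.+-congˡ b (mean-1 σ qF c ne)) ⟩
          (1ℚᵘ + b) + ε                    ≃⟨ ℚ.+-assoc 1ℚᵘ b ε ⟩
          1ℚᵘ + (b + ε)                    ∎)
          where
          a = weight D (suc w) * 1ℚᵘ
          b = weight D (suc w) * f c'
          μ = mean D f (enabledW S c)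
          open +-*-Solver
          swap : ∀ x y z → (x + y) + z ≃ (x + z) + y
          swap = solve 3 (λ x y z → (x :+ y) :+ z := (x :+ z) :+ y) ℚ.≃-refl

      move : ∀ q v {c' w} {Y : Pred nQ d} → (c' , w) ∈ enabledW S (q , v) →
             (proj₁ c' ≡ qF → X (proj₁ c') (lookup (proj₂ c'))) → (¬ proj₁ c' ≡ qF → Y (proj₁ c') (lookup (proj₂ c'))) →
             Move X Y (map edge (outgoing q)) (lookup v)
      move q v {c'} m f g with step-transition (q , v) m
      ... | t@(_ , _ , q') , t∈ , refl , e = edge t , ∈.∈-map⁺ edge t∈ , lookup (proj₂ c') , (λ i → ℤ.≤-reflexive (e i)) , res (q' Fin.≟ qF) f g
        where
        res : ∀ {A B : Set} (D : Dec (q' ≡ qF)) → (q' ≡ qF → A) → (¬ q' ≡ qF → B) → (⌊ D ⌋ ≡ true × A) ⊎ B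
        res (yes e) f g = inj₁ (refl , f e)
        res (no ne) f g = inj₂ (g ne)

      positive : ∀ D f (xs : List (Config S × ℕ)) → ¬ mean D f xs ≤ 0ℚᵘ → ∃ λ c' → ∃ λ w → (c' , w) ∈ xs × ¬ f c' ≤ 0ℚᵘ
      positive D f xs pos with any∈? {P = λ x → ¬ f (proj₁ x) ≤ 0ℚᵘ} xs (λ x _ → ¬? (f (proj₁ x) ℚ.≤? 0ℚᵘ))
        where open import Relation.Nullary.Decidable using (¬?)
      ... | yes ((c' , w) , m , n) = c' , w , m , n
      ... | no none = ⊥-elim (pos (ℚ.≤-trans
        (mean-mono D {f} {λ _ → 0ℚᵘ} xs λ x w m → decidable-stable (f x ℚ.≤? 0ℚᵘ) λ n → none ((x , w) , m , n))
        (ℚ.≤-reflexive (ℚ.≃-trans (mean-const D 0ℚᵘ xs) (ℚ.*-zeroʳ (weight D (sumℕ (map proj₂ xs))))))))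
        where
        open import Relation.Nullary.Decidable using (decidable-stable)
        open import Data.Nat.ListAction using () renaming (sum to sumℕ)

      next-no : ∀ m k h c c' → ¬ proj₁ c' ≡ qF → next σ qF m k h c c' ≡ p m k (h ++ [ c ]) c'
      next-no m k h c c' ¬F with proj₁ c' Fin.≟ qF
      ... | yes F = ⊥-elim (¬F F)
      ... | no _  = refl

      -- The restriction to 1-VASS enters here. With zero effect, every transition the environment
      -- can fix is enabled, so it has positive probability and its outcome is sure; a disabled one
      -- would lose the game although no play takes it.
      forced-move : ∀ {q v t Y} → (∀ {c' w} → (c' , w) ∈ enabledW S (q , v) → X (proj₁ c') (lookup (proj₂ c'))) →
                    isProb q ≡ true → t ∈ outgoing q → Move X Y [ forced t ] (lookup v)
      forced-move {q} {v} {_ , z , q'} x pq t∈ with ∈-outgoing t∈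
      ... | t∈T , refl = let v' , w , m , f = transition-step q v z q' t∈T enabled in
        forced (q , z , q') , here refl , lookup v' , (λ i → ℤ.≤-reflexive (f i)) , inj₁ (refl , x m)
        where
        enabled : ∀ i → + 0 ℤ.≤ + lookup v i ℤ.+ lookup z i
        enabled i = subst (λ z → + 0 ℤ.≤ + lookup v i ℤ.+ lookup z i) (sym (All.lookup one t∈T pq))
          (subst (λ a → + 0 ℤ.≤ + lookup v i ℤ.+ a) (sym (Vec.lookup-replicate i (+ 0))) (ℤ.+≤+ z≤n))

      -- Induction on the horizon along a branch on which a visit has positive probability. A
      -- granted choice follows this branch; a fixed outcome ends the tree at once, since all
      -- outcomes are again `Sure`.
      attr : ∀ k h q v → Sure h (q , v) → ¬ p 1 k h (q , v) ≤ 0ℚᵘ → Attr game X q (lookup v)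
      attr zero    h q v s pos = ⊥-elim (pos ℚ.≤-refl)
      attr (suc k) h q v s pos with unfold σ qF h (q , v)
      ... | inj₁ (_ , e) = ⊥-elim (pos (ℚ.≤-reflexive-≡ (e 0 k)))
      ... | inj₂ (inj₁ (c' , ch@(chosen pq ne) , e)) =
        node λ o m → subst (λ o → Move X (Attr game X) o (lookup v)) (sym (options-player pq m))
          (let (c″ , w) , m' , eq = ∈.∈-map⁻ proj₁ (proj₂ (σ h (q , v) pq ne))
           in move q v (subst (λ c → (c , w) ∈ enabledW S (q , v)) (sym eq) m') (λ _ → _ , _ , refl , s')
                λ ¬F → attr k (h ++ [ q , v ]) (proj₁ c') (proj₂ c') s'
                  (subst (λ a → ¬ a ≤ 0ℚᵘ) (trans (e 0 k) (next-no 1 k h (q , v) c' ¬F)) pos))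
        where
        s' : Sure (h ++ [ q , v ]) (proj₁ (σ h (q , v) pq ne))
        s' = sure-player s e
      ... | inj₂ (inj₂ (pq , ne , e)) = node λ o m → answer (options-chance pq m)
        where
        answer : ∀ {o} → o ≡ map edge (outgoing q) ⊎ (∃ λ t → t ∈ outgoing q × o ≡ [ forced t ]) →
                 Move X (Attr game X) o (lookup v)
        answer (inj₂ (t , t∈ , refl)) = forced-move (λ m → _ , _ , refl , sure-chance s ne m e) pq t∈
        answer (inj₁ refl) =
          let c' , w , m , pos' = positive (total (q , v) ∸ 1) (next σ qF 1 k h (q , v)) (enabledW S (q , v))
                                    (subst (λ a → ¬ a ≤ 0ℚᵘ) (e 0 k) pos)
              s' = sure-chance s ne m e
          in move q v m (λ _ → _ , _ , refl , s') λ ¬F →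
               attr k (h ++ [ q , v ]) (proj₁ c') (proj₂ c') s'
                 (subst (λ a → ¬ a ≤ 0ℚᵘ) (next-no 1 k h (q , v) c' ¬F) pos')

      good-X : Good game X
      -- One visit with tolerance 1/2: its probability is at least 1/2, hence not ≤ 0.
      good-X q _ (v , h , refl , s) = let k , le = s 1 1 in attr k h q v s λ z → half≱1 (ℚ.≤-trans le (ℚ.+-monoˡ-≤ (mkℚᵘ (+ 1) 1) z))
        where
        half≱1 : ¬ 1ℚᵘ ≤ 0ℚᵘ + mkℚᵘ (+ 1) 1
        half≱1 (*≤* (ℤ.+≤+ (s≤s ())))

      -- One visit more is requested because the initial configuration may itself be counted, while
      -- `Sure` counts only later ones.
      sure⇒win : ∀ {q v} → AlmostSureRepReach S (q , v) qF σ → Win game q (lookup v)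
      sure⇒win {q} {v} s = good⇒win game good-X {q} {lookup v} (v , [] , refl , λ m j → let k , le = s (suc m) j in
        k , ℚ.≤-trans le (ℚ.+-monoˡ-≤ (mkℚᵘ (+ 1) j) (start m k)))
        where
        start : ∀ m k → p (dec S qF (q , v) (suc m)) k [] (q , v) ≤ p m k [] (q , v)
        start m k with q Fin.≟ qF
        ... | yes _ = ℚ.≤-refl
        ... | no  _ = aux-anti σ qF m k [] (q , v)

-- From winning in the game to an almost-surely winning strategy

module Strategies where

  open AlmostFull
  open Games
  open OnePlayer
  open Probability
  open Reduction
  open import Defs
  open import Data.Nat as ℕ using (ℕ; zero; suc; s≤s; z≤n; _∸_)
  import Data.Nat.Properties as ℕ
  open import Data.Nat.ListAction using () renaming (sum to sumℕ)
  open import Data.Integer as ℤ using (ℤ; +_)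
  import Data.Integer.Properties as ℤ
  open import Data.Rational.Unnormalised.Base using (ℚᵘ; mkℚᵘ; 0ℚᵘ; 1ℚᵘ; _+_; _*_; _≤_; _≃_; *≤*; *≡*; NonNegative; Positive)
  import Data.Rational.Unnormalised.Properties as ℚ
  open import Data.Rational.Unnormalised.Solver using (module +-*-Solver)
  open import Data.Bool using (Bool; true)
  import Data.Bool.Properties as Bool
  open import Data.Fin as Fin using (Fin; zero; suc)
  import Data.Fin.Properties as Fin
  open import Data.Vec using (lookup)
  open import Data.List using (List; []; _∷_; [_]; _++_; map; mapMaybe)
  open import Data.List.Relation.Unary.Any using (here; there)
  open import Data.List.Membership.Propositional using (_∈_; find)
  import Data.List.Membership.Propositional.Properties as ∈
  open import Data.Maybe using (just; nothing)
  open import Data.Product using (∃; Σ; _×_; _,_; proj₁; proj₂)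
  open import Data.Sum using (_⊎_; inj₁; inj₂; [_,_]′)
  import Data.Sum as Sum
  open import Data.Empty using (⊥; ⊥-elim)
  open import Function using (_∘_; id)
  open import Relation.Nullary using (¬_; Dec; yes; no; ⌊_⌋)
  open import Relation.Nullary.Decidable using (map′; _×-dec_; _⊎-dec_)
  open import Relation.Binary.PropositionalEquality using (_≡_; refl; sym; subst; subst₂)

  -- Truncation at depth k makes the attractor decidable, which the strategy needs in order to
  -- compare successors.
  Attr≤ : ∀ {n d} → Game n d → Pred n d → ℕ → Pred n d
  Attr≤ δ X zero    q v = ⊥
  Attr≤ δ X (suc k) q v = ∀ o → o ∈ options δ q → Move X (Attr≤ δ X k) o v

  module _ {n d : ℕ} {δ : Game n d} {X : Pred n d} where

    move-map : ∀ {Y Y' : Pred n d} {o v} → (∀ {q v} → Y q v → Y' q v) → Move X Y o v → Move X Y' o v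
    move-map f (e , e∈ , v' , g , r) = e , e∈ , v' , g , Sum.map₂ f r

    attr≤-suc : ∀ k {q v} → Attr≤ δ X k q v → Attr≤ δ X (suc k) q v
    attr≤-suc (suc k) f o m = move-map (attr≤-suc k) (f o m)

    attr≤-mono : ∀ {k l q v} → k ℕ.≤′ l → Attr≤ δ X k q v → Attr≤ δ X l q v
    attr≤-mono ℕ.≤′-refl     = id
    attr≤-mono (ℕ.≤′-step s) = attr≤-suc _ ∘ attr≤-mono s

    attr≤-up : ∀ k {q u v} → u ≼ v → Attr≤ δ X k q u → Attr≤ δ X k q v
    attr≤-up (suc k) p f o m = let e , e∈ , v' , g , r = f o m in e , e∈ , v' , fires-mono {z = eff e} p ≼-refl g , r

    uniform : ∀ {A : Set} {P : ℕ → A → Set} → (∀ {k l a} → k ℕ.≤ l → P k a → P l a) →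
              (xs : List A) → (∀ a → a ∈ xs → ∃ λ k → P k a) → ∃ λ k → ∀ a → a ∈ xs → P k a
    uniform mono []       f = 0 , λ _ ()
    uniform mono (x ∷ xs) f =
      let k , p = f x (here refl)
          l , r = uniform mono xs (λ a → f a ∘ there)
      in k ℕ.⊔ l , λ { a (here refl) → mono (ℕ.m≤m⊔n k l) p ; a (there m) → mono (ℕ.m≤n⊔m k l) (r a m) }

    attr-bounded : ∀ {q v} → Attr δ X q v → ∃ λ k → Attr≤ δ X k q v
    attr-bounded {q} {v} (node f) =
      let k , g = uniform {P = λ k o → Move X (Attr≤ δ X k) o v} (λ le → move-map (attr≤-mono (ℕ.≤⇒≤′ le)))
                    (options δ q) (λ o m → bound (f o m))
      in suc k , g
      where
      bound : ∀ {o v} → Move X (Attr δ X) o v → ∃ λ k → Move X (Attr≤ δ X k) o v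
      bound (e , e∈ , v' , g , inj₁ x) = 0 , e , e∈ , v' , g , inj₁ x
      bound (e , e∈ , v' , g , inj₂ t) = let k , a = attr-bounded t in k , e , e∈ , v' , g , inj₂ a

    module _ (X-up : ∀ {q u v} → u ≼ v → X q u → X q v) (X? : ∀ q v → Dec (X q v)) where

      -- It suffices to try the exact successor, which dominates the lossy ones.
      fire-dec : ∀ v (z : Fin d → ℤ) {P : (Fin d → ℕ) → Set} → (∀ {u w} → u ≼ w → P u → P w) →
                 (∀ w → Dec (P w)) → Dec (∃ λ v' → Fires v z v' × P v')
      fire-dec v z {P} up P? = map′
        (λ { (le , p) → fired v z , (λ i → ℤ.≤-reflexive (ℤ.0≤i⇒+∣i∣≡i (le i))) , p })
        (λ { (v' , f , p) → let le = λ i → ℤ.≤-trans (ℤ.+≤+ z≤n) (f i) in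
             le , up (λ i → ℤ.drop‿+≤+ (subst (+ v' i ℤ.≤_) (sym (ℤ.0≤i⇒+∣i∣≡i (le i))) (f i))) p })
        ((Fin.all? λ i → + 0 ℤ.≤? + v i ℤ.+ z i) ×-dec P? (fired v z))

      attr≤? : ∀ k q v → Dec (Attr≤ δ X k q v)
      attr≤? zero    q v = no id
      attr≤? (suc k) q v = all∈? (options δ q) λ o → any∈? o λ e _ →
        fire-dec v (eff e) (λ p → Sum.map (λ { (a , x) → a , X-up p x }) (attr≤-up k p))
          λ w → ((acc e Bool.≟ true) ×-dec X? (tgt e) w) ⊎-dec attr≤? k (tgt e) w
        where
        all∈? : {A : Set} {P : A → Set} (xs : List A) → (∀ x → Dec (P x)) → Dec (∀ x → x ∈ xs → P x)
        all∈? []       f = yes λ _ ()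
        all∈? (x ∷ xs) f = map′ (λ { (p , r) _ (here refl) → p ; (p , r) y (there m) → r y m })
          (λ g → g x (here refl) , λ y → g y ∘ there) (f x ×-dec all∈? xs f)

  module Backward {d : ℕ} (S : VASSMDP d) (qF : Fin (VASSMDP.nQ S))
                  (L : List (Conf (VASSMDP.nQ S) d)) (good : Good (Translation.game S qF) (↑ L)) where
    open VASSMDP S
    open Play S
    open Translation S qF

    R : ℕ → Pred nQ d
    R = Attr≤ game (↑ L)

    R? : ∀ k q v → Dec (R k q v)
    R? = attr≤? (λ p → ↑-up p) (↑? L)

    rank = uniform {δ = game} {X = ↑ L} {P = λ k b → R k (proj₁ b) (proj₂ b)} (λ le → attr≤-mono (ℕ.≤⇒≤′ le)) L
             λ b m → attr-bounded (good (proj₁ b) (proj₂ b) (∈⇒↑ m))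

    -- The finitely many basis elements have a largest rank, and monotonicity carries it to
    -- everything above them.
    N : ℕ
    N = proj₁ rank

    ↑⇒R : ∀ {q v} → ↑ L q v → R N q v
    ↑⇒R m = let (r , u) , b∈ , e , le = find m in
      subst (λ q → R N q _) e (attr≤-up N le (proj₂ rank (r , u) b∈))

    -- The invariant of the strategy; unlike `↑ L` it also admits the configurations between two
    -- visits.
    Safe : Config S → Set
    Safe (q , v) = R N q (lookup v)

    Hit : ℕ → Config S → Set
    Hit k c = (proj₁ c ≡ qF × Safe c) ⊎ R k (proj₁ c) (lookup (proj₂ c))

    hit-mono : ∀ {k l} c → k ℕ.≤ l → Hit k c → Hit l c
    hit-mono _ le = Sum.map₂ (attr≤-mono (ℕ.≤⇒≤′ le))

    hit? : ∀ k c → Dec (Hit k c)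
    hit? k (q , v) = ((q Fin.≟ qF) ×-dec R? N q (lookup v)) ⊎-dec R? k q (lookup v)

    hit⇒safe : ∀ {k} c → k ℕ.≤ N → Hit k c → Safe c
    hit⇒safe _ le (inj₁ (_ , s)) = s
    hit⇒safe _ le (inj₂ r)       = attr≤-mono (ℕ.≤⇒≤′ le) r

    CanHit : ℕ → Config S → Set
    CanHit k c = ∃ λ c' → c' ∈ successors S c × Hit k c'

    progress : ∀ k c → R (suc k) (proj₁ c) (lookup (proj₂ c)) →
               ∃ λ c' → ∃ λ w → (c' , w) ∈ enabledW S c × Hit k c'
    -- The first option of every state is the one that leaves the choice to the player.
    progress k (q , v) r with r _ (here refl)
    ... | e , e∈ , u , f , res with ∈.∈-map⁻ edge e∈
    ...   | (_ , z , q') , t∈ , refl with ∈-outgoing t∈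
    ...     | t∈T , refl =
      let v' , w , m , g = transition-step q v z q' t∈T (λ i → ℤ.≤-trans (ℤ.+≤+ z≤n) (f i))
          le : u ≼ lookup v'
          le i = ℤ.drop‿+≤+ (subst (+ u i ℤ.≤_) (sym (g i)) (f i))
      in (q' , v') , w , m , Sum.map (λ { (a , x) → visit (q' Fin.≟ qF) a , attr≤-up N le (↑⇒R x) }) (attr≤-up k le) res
      where
      visit : (D : Dec (q' ≡ qF)) → ⌊ D ⌋ ≡ true → q' ≡ qF
      visit (yes e) _ = e

    canHit : ∀ {k c} → R (suc k) (proj₁ c) (lookup (proj₂ c)) → CanHit k c
    canHit {k} {c} r = let c' , w , m , h = progress k c r in c' , ∈.∈-map⁺ proj₁ m , h

    -- The option that fixes an outcome has a single edge, so the attractor vouches for each outcome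
    -- separately.
    all-safe : ∀ {k c} → k ℕ.≤ N → isProb (proj₁ c) ≡ true → R (suc k) (proj₁ c) (lookup (proj₂ c)) →
               ∀ {c' w} → (c' , w) ∈ enabledW S c → Safe c'
    all-safe {k} {c} le pq r {c'} m with step-transition c m
    ... | t , t∈ , refl , g with r _ (forced-option pq t∈)
    ...   | _ , here refl , u , f , res =
      attr≤-up N (λ i → ℤ.drop‿+≤+ (subst (+ u i ℤ.≤_) (sym (g i)) (f i)))
        ([ (λ { (_ , x) → ↑⇒R x }) , attr≤-mono (ℕ.≤⇒≤′ le) ]′ res)

    -- A hit of least possible rank serves all bounds j at once, so the strategy need not know the
    -- rank that the analysis assigns to c.
    Best : ℕ → Config S → Config S → Set
    Best k c c' = c' ∈ successors S c × Hit k c' × (∀ j → j ℕ.≤ k → CanHit j c → Hit j c')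

    search : ∀ k c → (∃ λ c' → Best k c c') ⊎ (∀ j → j ℕ.≤ k → ¬ CanHit j c)
    search zero c with any∈? (successors S c) (λ c' _ → hit? 0 c')
    ... | yes (c' , s , h) = inj₁ (c' , s , h , λ { zero _ _ → h })
    ... | no none          = inj₂ λ { zero _ → none }
    search (suc k) c with search k c
    ... | inj₁ (c' , s , h , best) = inj₁ (c' , s , hit-mono c' (ℕ.n≤1+n k) h ,
            λ j le can → [ (λ j<k → best j (ℕ.≤-pred j<k) can) , (λ { refl → hit-mono c' (ℕ.n≤1+n k) h }) ]′ (ℕ.m≤n⇒m<n∨m≡n le))
    ... | inj₂ none with any∈? (successors S c) (λ c' _ → hit? (suc k) c')
    ...   | yes (c' , s , h) = inj₁ (c' , s , h ,
            λ j le can → [ (λ j<k → ⊥-elim (none j (ℕ.≤-pred j<k) can)) , (λ { refl → h }) ]′ (ℕ.m≤n⇒m<n∨m≡n le))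
    ...   | no none' = inj₂ λ j le can → [ (λ j<k → none j (ℕ.≤-pred j<k) can) , (λ { refl → none' can }) ]′ (ℕ.m≤n⇒m<n∨m≡n le)

    -- A default that makes the strategy total; by `σ-hit` a safe configuration does not resort to
    -- it.
    first : ∀ c → ¬ successors S c ≡ [] → Σ (Config S) (Step S c)
    first c ne with successors S c
    ... | []     = ⊥-elim (ne refl)
    ... | c' ∷ _ = c' , here refl

    σ : Strategy S
    σ h c pq ne = [ (λ { (c' , s , _) → c' , s }) , (λ _ → first c ne) ]′ (search N c)

    σ-hit : ∀ {h c c' k} → k ℕ.≤ N → Chosen σ qF h c c' → R (suc k) (proj₁ c) (lookup (proj₂ c)) → Hit k c'
    σ-hit {c = c} {k = k} le (chosen pq ne) r with search N c
    ... | inj₁ (c' , s , _ , best) = best k le (canHit r)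
    ... | inj₂ none                = ⊥-elim (none k le (canHit r))

    p : ℕ → ℕ → List (Config S) → Config S → ℚᵘ
    p = aux S σ qF

    M : ℕ
    M = sumℕ (map τ T)

    total≤M : ∀ c → total c ℕ.≤ M
    total≤M c = go T
      where
      go : ∀ ts → sumℕ (map proj₂ (mapMaybe (fire S c) ts)) ℕ.≤ sumℕ (map τ ts)
      go []       = z≤n
      go (t ∷ ts) with fire S c t in eq
      ... | nothing       = ℕ.≤-trans (go ts) (ℕ.m≤n+m _ (τ t))
      ... | just (c' , w) = ℕ.+-mono-≤ (ℕ.≤-reflexive (proj₂ (proj₂ (proj₂ (fire-inv c t eq))))) (go ts)

    -- At most M weight is enabled and each weight is at least one, so this bounds every outcome
    -- probability from below.
    least : ℚᵘ
    least = mkℚᵘ (+ 1) M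

    least≤ : ∀ c {c' w} → (c' , w) ∈ enabledW S c → least ≤ weight (total c ∸ 1) w
    least≤ c {w = w} m = *≤* (ℤ.≤-trans (ℤ.*-monoˡ-≤-nonNeg (+ 1) (ℤ.+≤+ (s≤s (ℕ.≤-trans (ℕ.m∸n≤m (total c) 1) (total≤M c)))))
      (ℤ.*-monoʳ-≤-nonNeg (+ suc M) (ℤ.+≤+ (weights-pos c m))))

    power : ℕ → ℚᵘ
    power zero    = 1ℚᵘ
    power (suc n) = least * power n

    power-pos : ∀ n → Positive (power n)
    power-pos zero    = _
    power-pos (suc n) = ℚ.pos*pos⇒pos least (power n) {{power-pos n}}

    power-≥0 : ∀ n → NonNegative (power n)
    power-≥0 n = ℚ.pos⇒nonNeg (power n) {{power-pos n}}

    least≤1 : least ≤ 1ℚᵘ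
    least≤1 = *≤* (ℤ.+≤+ (s≤s z≤n))

    power-suc : ∀ n → power (suc n) ≤ power n
    power-suc n = ℚ.≤-trans (ℚ.*-monoˡ-≤-nonNeg (power n) {{power-≥0 n}} least≤1) (ℚ.≤-reflexive (ℚ.*-identityˡ (power n)))

    power-≤1 : ∀ n → power n ≤ 1ℚᵘ
    power-≤1 zero    = ℚ.≤-refl
    power-≤1 (suc n) = ℚ.≤-trans (power-suc n) (power-≤1 n)

    -- If m visits have probability ≥ β + ε and m + 1 visits ≥ β from every safe
    -- configuration, then rank n improves the second bound by ε / (M + 1)ⁿ.
    module Step {m K : ℕ} {β ε : ℚᵘ} {{ε≥0 : NonNegative ε}}
                (low  : ∀ h c → Safe c → β ≤ p (suc m) K h c)
                (high : ∀ h c → Safe c → β + ε ≤ p m K h c) where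

      K≤ : ∀ n → K ℕ.≤′ n ℕ.+ K
      K≤ n = ℕ.≤⇒≤′ (ℕ.m≤n+m K n)

      β≤β+ε : β ≤ β + ε
      β≤β+ε = ℚ.≤-trans (ℚ.≤-reflexive (ℚ.≃-sym (ℚ.+-identityʳ β))) (ℚ.+-monoʳ-≤ β (ℚ.nonNegative⁻¹ ε))

      next-low : ∀ n h c c' → Safe c' → β ≤ next σ qF (suc m) (n ℕ.+ K) h c c'
      next-low n h c c' s with proj₁ c' Fin.≟ qF
      ... | yes _ = ℚ.≤-trans β≤β+ε (ℚ.≤-trans (high (h ++ [ c ]) c' s) (aux-mono σ qF m (h ++ [ c ]) c' (K≤ n)))
      ... | no _  = ℚ.≤-trans (low (h ++ [ c ]) c' s) (aux-mono σ qF (suc m) (h ++ [ c ]) c' (K≤ n))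

      gain : ∀ n h c → n ℕ.≤ N → R n (proj₁ c) (lookup (proj₂ c)) → β + power n * ε ≤ p (suc m) (n ℕ.+ K) h c

      next-gain : ∀ n h c c' → n ℕ.≤ N → Hit n c' → β + power n * ε ≤ next σ qF (suc m) (n ℕ.+ K) h c c'
      next-gain n h c c' n≤N hit with proj₁ c' Fin.≟ qF | hit
      ... | yes _ | _ = ℚ.≤-trans (ℚ.+-monoʳ-≤ β (ℚ.≤-trans (ℚ.*-monoˡ-≤-nonNeg ε (power-≤1 n)) (ℚ.≤-reflexive (ℚ.*-identityˡ ε))))
              (ℚ.≤-trans (high (h ++ [ c ]) c' (hit⇒safe c' n≤N hit)) (aux-mono σ qF m (h ++ [ c ]) c' (K≤ n)))
      ... | no ¬F | inj₁ (F , _) = ⊥-elim (¬F F)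
      ... | no _  | inj₂ r       = gain n (h ++ [ c ]) c' n≤N r

      gain (suc n) h c n<N r with unfold σ qF h c
      ... | inj₁ (e , _) = ⊥-elim (∈[] (subst (proj₁ (canHit r) ∈_) e (proj₁ (proj₂ (canHit r)))))
        where
        ∈[] : ∀ {A : Set} {x : A} → ¬ x ∈ []
        ∈[] ()
      ... | inj₂ (inj₁ (c' , ch , e)) = subst (β + power (suc n) * ε ≤_) (sym (e m (n ℕ.+ K)))
        (ℚ.≤-trans (ℚ.+-monoʳ-≤ β (ℚ.*-monoˡ-≤-nonNeg ε (power-suc n)))
          (next-gain n h c c' (ℕ.<⇒≤ n<N) (σ-hit (ℕ.<⇒≤ n<N) ch r)))
      ... | inj₂ (inj₂ (pq , ne , e)) = subst (β + power (suc n) * ε ≤_) (sym (e m (n ℕ.+ K)))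
        -- The hitting outcome gains `power n * ε` with weight at least `least`; the other outcomes
        -- are safe and still reach β.
        (let c' , w , c'∈ , hit = progress n c r in
         combine (weight D w) (f c') (least≤ c c'∈) _ (next-gain n h c c' (ℕ.<⇒≤ n<N) hit)
           (mean-gap D {λ _ → β} {f} (enabledW S c) (λ x v x∈ → next-low n h c x (all-safe (ℕ.<⇒≤ n<N) pq r x∈)) c'∈))
        where
        D = total c ∸ 1
        f = next σ qF (suc m) (n ℕ.+ K) h c
        combine : ∀ a b → least ≤ a → NonNegative a → β + power n * ε ≤ b →
                  mean D (λ _ → β) (enabledW S c) + a * b ≤ mean D f (enabledW S c) + a * β →
                  β + power (suc n) * ε ≤ mean D f (enabledW S c)
        combine a b le a≥0 hit gap = Probability.+-cancelˡ-≤ (a * β) (begin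
          a * β + (β + (least * power n) * ε)   ≤⟨ ℚ.+-monoʳ-≤ (a * β) (ℚ.+-monoʳ-≤ β (ℚ.*-monoˡ-≤-nonNeg ε (ℚ.*-monoˡ-≤-nonNeg (power n) {{power-≥0 n}} le))) ⟩
          a * β + (β + (a * power n) * ε)       ≃⟨ lemma a β (power n) ε ⟩
          β + a * (β + power n * ε)             ≤⟨ ℚ.+-monoʳ-≤ β (ℚ.*-monoʳ-≤-nonNeg a {{a≥0}} hit) ⟩
          β + a * b                             ≃⟨ ℚ.+-congˡ (a * b) (mean-full D β (enabledW S c) (total-pos c ne)) ⟨
          mean D (λ _ → β) (enabledW S c) + a * b ≤⟨ gap ⟩
          mean D f (enabledW S c) + a * β       ≃⟨ ℚ.+-comm (mean D f (enabledW S c)) (a * β) ⟩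
          a * β + mean D f (enabledW S c)       ∎)
          where
          open ℚ.≤-Reasoning
          open +-*-Solver
          lemma : ∀ a b w e → a * b + (b + (a * w) * e) ≃ b + a * (b + w * e)
          lemma = solve 4 (λ a b w e → a :* b :+ (b :+ (a :* w) :* e) := b :+ a :* (b :+ w :* e)) ℚ.≃-refl

    times : ℕ → ℚᵘ → ℚᵘ
    times zero    s = 0ℚᵘ
    times (suc r) s = times r s + s

    -- For s = (a + 1)/(b + 1), adding b + 1 copies gives a + 1 ≥ 1.
    archimedes : ∀ s → Positive s → ∃ λ r → 1ℚᵘ ≤ times r s
    archimedes (mkℚᵘ (+ suc a) b) _ = suc b , ℚ.≤-trans one≤ (ℚ.≤-reflexive (ℚ.≃-sym (times-* (suc b))))
      where
      s = mkℚᵘ (+ suc a) b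
      times-* : ∀ r → times r s ≃ weight b (r ℕ.* suc a)
      times-* zero    = *≡* refl
      times-* (suc r) = ℚ.≃-trans (ℚ.+-congˡ s (times-* r)) (ℚ.≃-trans (ℚ.+-comm (weight b (r ℕ.* suc a)) s)
        (ℚ.≃-sym (weight-+ b (suc a) (r ℕ.* suc a))))
      one≤ : 1ℚᵘ ≤ weight b (suc b ℕ.* suc a)
      one≤ = *≤* (subst₂ ℤ._≤_ (sym (ℤ.*-identityˡ (+ suc b))) (sym (ℤ.*-identityʳ (+ (suc b ℕ.* suc a))))
               (ℤ.+≤+ (ℕ.m≤m*n (suc b) (suc a))))

    Uniform : ℕ → ℕ → Set
    Uniform m j = ∃ λ k → ∀ h c → Safe c → 1ℚᵘ ≤ p m k h c + mkℚᵘ (+ 1) j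

    -- A lower bound β = `times r s` for m + 1 visits is raised by s in each round while β + 2ε ≤ 1,
    -- and `archimedes` limits the rounds. Its uniformity over histories and safe configurations
    -- lets a round restart wherever the play has arrived.
    uniform-suc : ∀ m → (∀ j → Uniform m j) → ∀ j → Uniform (suc m) j
    uniform-suc m IH j = finish (iterate (proj₁ (archimedes s (s-pos))))
      where
      ε δ s : ℚᵘ
      ε = half j
      δ = mkℚᵘ (+ 1) j
      s = power N * ε
      s-pos : Positive s
      s-pos = ℚ.pos*pos⇒pos (power N) {{power-pos N}} ε
      k₀ = proj₁ (IH (j ℕ.+ suc j))

      iterate : ∀ r → Uniform (suc m) j ⊎ ∃ λ k → ∀ h c → Safe c → times r s ≤ p (suc m) k h c
      iterate zero = inj₂ (0 , λ h c _ → aux-≥0 σ qF (suc m) 0 h c)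
      iterate (suc r) with iterate r
      ... | inj₁ done = inj₁ done
      -- One ε is the tolerance of the hypothesis on m, so success of the test yields the premise
      -- `high`. On failure β is already within 2ε = 1/(j + 1) of one.
      ... | inj₂ (k , low) with (times r s + ε) + ε ℚ.≤? 1ℚᵘ
      ...   | yes le = inj₂ (N ℕ.+ (k ℕ.+ k₀) , λ h c safe → Step.gain {m} {k ℕ.+ k₀} {times r s} {ε}
                (λ h c safe → ℚ.≤-trans (low h c safe) (aux-mono σ qF (suc m) h c (ℕ.≤⇒≤′ (ℕ.m≤m+n k k₀))))
                (λ h c safe → ℚ.≤-trans (cancel (ℚ.≤-trans le (proj₂ (IH (j ℕ.+ suc j)) h c safe)))
                                (aux-mono σ qF m h c (ℕ.≤⇒≤′ (ℕ.m≤n+m k₀ k))))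
                N h c ℕ.≤-refl safe)
        where
        cancel : ∀ {a b} → a + ε ≤ b + ε → a ≤ b
        cancel {a} {b} le = Probability.+-cancelˡ-≤ ε (ℚ.≤-trans (ℚ.≤-reflexive (ℚ.+-comm ε a)) (ℚ.≤-trans le (ℚ.≤-reflexive (ℚ.+-comm b ε))))
      ...   | no ¬le = inj₁ (k , λ h c safe → begin
                1ℚᵘ                        ≤⟨ ℚ.≰⇒≥ ¬le ⟩
                (times r s + ε) + ε        ≃⟨ ℚ.+-assoc (times r s) ε ε ⟩
                times r s + (ε + ε)        ≃⟨ ℚ.+-congʳ (times r s) (half+half j) ⟩
                times r s + δ              ≤⟨ ℚ.+-monoˡ-≤ δ (low h c safe) ⟩
                p (suc m) k h c + δ        ∎)
        where open ℚ.≤-Reasoning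

      finish : _ → Uniform (suc m) j
      finish (inj₁ done)      = done
      finish (inj₂ (k , low)) = k , λ h c safe → begin
        1ℚᵘ                                      ≤⟨ proj₂ (archimedes s s-pos) ⟩
        times (proj₁ (archimedes s s-pos)) s     ≤⟨ low h c safe ⟩
        p (suc m) k h c                          ≃⟨ ℚ.+-identityʳ (p (suc m) k h c) ⟨
        p (suc m) k h c + 0ℚᵘ                    ≤⟨ ℚ.+-monoʳ-≤ (p (suc m) k h c) (ℚ.nonNegative⁻¹ δ) ⟩
        p (suc m) k h c + δ                      ∎
        where open ℚ.≤-Reasoning

    uniformly : ∀ m j → Uniform m j
    uniformly zero    j = 0 , λ h c _ → ℚ.≤-trans (ℚ.≤-reflexive (ℚ.≃-sym (ℚ.+-identityʳ 1ℚᵘ)))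
      (ℚ.+-monoʳ-≤ 1ℚᵘ (ℚ.nonNegative⁻¹ (mkℚᵘ (+ 1) j)))
    uniformly (suc m) = uniform-suc m (uniformly m)

    almost-sure : ∀ {q v} → ↑ L q (lookup v) → AlmostSureRepReach S (q , v) qF σ
    almost-sure {q} {v} x m j = let k , f = uniformly (dec S qF (q , v) m) j in k , f [] (q , v) (↑⇒R x)

-- The decision procedure

open Games using (Win)
open KnownCredit using (win?)
open Reduction using (module Translation)
open Strategies using (module Backward)

theorem8 : (d : ℕ) (S : VASSMDP d) → IsOneVASS S →
    (c₀ : Config S) (qF : Fin (VASSMDP.nQ S)) →
    Dec (∃ λ (σ : Strategy S) → AlmostSureRepReach S c₀ qF σ)
theorem8 d S one (q , v) qF = map′ backward forward (win? game q (lookup v))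
  where
  open Translation S qF
  backward : Win game q (lookup v) → ∃ λ (σ : Strategy S) → AlmostSureRepReach S (q , v) qF σ
  backward (L , good , m) = Backward.σ S qF L good , Backward.almost-sure S qF L good m
  forward : (∃ λ (σ : Strategy S) → AlmostSureRepReach S (q , v) qF σ) → Win game q (lookup v)
  forward (σ , sure) = Forward.sure⇒win one σ sure
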